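{- For every $n\ge 1$ and every set $S\subseteq\mathbb{R}^n$: $S$ is semi-polinear if and only if $S$ is mixed-linear (i.e. definable in the mixed additive theory $\mathrm{FO}(\mathbb{R},\mathbb{Z},+,\leq)$).
   Context: The mixed additive theory $\mathrm{FO}(\mathbb{R},\mathbb{Z},+,\leq)$ is the first-order logic over the real numbers with addition, the order $\leq$, and a unary predicate for membership in $\mathbb{Z}$ (equivalently, with quantification over both reals and integers). A set $S\subseteq\mathbb{R}^n$ is mixed-linear if it is the set of tuples satisfying some formula of this logic (without parameters) with $n$ free variables. A polyhedral convex set of $\mathbb{R}^n$ is a set of the form $C=\{c\in\mathbb{R}^n\mid \forall j\in\{1,\dots,k\}\ \sum_{i=1}^n\alpha_j[i]\,c[i]\ \#_j\ \beta_j\}$ for some finite (possibly empty) sequence of tuples $(\alpha_j,\#_j,\beta_j)\in\mathbb{Q}^n\times\{<,\leq,=,\geq,>\}\times\mathbb{Q}$. A finitely generated monoid is a subset $M\subseteq\mathbb{Z}^n$ such that $M=P^*$ for some finite $P\subseteq\mathbb{Z}^n$, where $P^*=\{0\}\cup\{p_1+\cdots+p_k\mid k\ge 1,\ p_i\in P\}$. A polinear set is a subset $L\subseteq\mathbb{R}^n$ of the form $L=C+b+M=\{c+z\mid c\in C,\ z\in b+M\}$, where $b\in\mathbb{Z}^n$, $M\subseteq\mathbb{Z}^n$ is a finitely generated monoid, and $C\subseteq[0,1)^n$ is a non-empty polyhedral convex set. A semi-polinear set is a finite (possibly empty) union of polinear sets. -}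

module Defs where

open import Level using (Level; 0ℓ; _⊔_) renaming (suc to lsuc)
open import Data.Fin.Base using (Fin)
open import Data.Integer.Base as ℤ using (ℤ; 0ℤ)
open import Data.List.Base as List using (List)
import Data.List.Membership.Propositional as List∈
open import Data.List.Relation.Unary.All using (All)
open import Data.Nat.Base as ℕ using (ℕ)
import Data.Nat.Properties as ℕ
open import Data.Product.Base using (Σ-syntax; ∃-syntax; _×_; _,_)
open import Data.Rational.Base as ℚ using (ℚ; 0ℚ; 1ℚ; ½)
import Data.Rational.Properties as ℚ
open import Data.Rational.Solver using (module +-*-Solver)
open import Data.Sum.Base using (_⊎_)
open import Data.Vec.Base as Vec using (Vec; _∷_)
open import Data.Vec.Relation.Binary.Pointwise.Inductive using (Pointwise)
import Data.Vec.Relation.Unary.All as Vecᴬ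
open import Relation.Binary.PropositionalEquality
  using (_≡_; refl; sym; trans; cong; subst)
open import Relation.Nullary.Negation.Core using (¬_)
open import Relation.Unary using (Pred; _∈_; _⊆_; _≐_; Satisfiable; ⋃)

private
  variable
    n : ℕ
    ℓ : Level

------------------------------------------------------------------------
-- The real numbers: Cauchy sequences of rationals, up to the setoid
-- equality _≈_ of having a null difference.  Results about them are
-- meant to be read under excluded middle, taken as a hypothesis.

IsCauchy : (ℕ → ℚ) → Set
IsCauchy s =
  ∀ ε → 0ℚ ℚ.< ε →
  ∃[ N ] (∀ i j → N ℕ.≤ i → N ℕ.≤ j → ℚ.∣ s i ℚ.- s j ∣ ℚ.< ε)

record ℝ : Set where
  constructor mkℝ
  field
    seq    : ℕ → ℚ
    cauchy : IsCauchy seq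

open ℝ public

infix 4 _≈_ _≤_ _<_

_≈_ : ℝ → ℝ → Set
x ≈ y =
  ∀ ε → 0ℚ ℚ.< ε →
  ∃[ N ] (∀ i → N ℕ.≤ i → ℚ.∣ seq x i ℚ.- seq y i ∣ ℚ.< ε)

_≤_ : ℝ → ℝ → Set
x ≤ y =
  ∀ ε → 0ℚ ℚ.< ε →
  ∃[ N ] (∀ i → N ℕ.≤ i → seq x i ℚ.≤ seq y i ℚ.+ ε)

_<_ : ℝ → ℝ → Set
x < y =
  ∃[ ε ] (0ℚ ℚ.< ε ×
  ∃[ N ] (∀ i → N ℕ.≤ i → seq x i ℚ.+ ε ℚ.≤ seq y i))

private
  const-cauchy : ∀ q → IsCauchy (λ _ → q)
  const-cauchy q ε 0<ε = 0 , λ _ _ _ _ →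
    subst (λ r → ℚ.∣ r ∣ ℚ.< ε) (sym (ℚ.+-inverseʳ q)) 0<ε

  +-cauchy : ∀ s t → IsCauchy s → IsCauchy t →
             IsCauchy (λ i → s i ℚ.+ t i)
  +-cauchy s t cs ct ε 0<ε
    with ε/2>0 ← subst (ℚ._< ½ ℚ.* ε) (ℚ.*-zeroʳ ½) (ℚ.*-monoʳ-<-pos ½ 0<ε)
    with M , s-close ← cs (½ ℚ.* ε) ε/2>0
       | N , t-close ← ct (½ ℚ.* ε) ε/2>0
    = M ℕ.⊔ N , close
    where
    open ℚ.≤-Reasoning
    open +-*-Solver

    regroup : ∀ a b c d →
              (a ℚ.+ b) ℚ.- (c ℚ.+ d) ≡ (a ℚ.- c) ℚ.+ (b ℚ.- d)
    regroup = solve 4 (λ a b c d →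
      (a :+ b) :- (c :+ d) := (a :- c) :+ (b :- d)) refl

    halves : ∀ r → ½ ℚ.* r ℚ.+ ½ ℚ.* r ≡ r
    halves r = trans (sym (ℚ.*-distribʳ-+ r ½ ½)) (ℚ.*-identityˡ r)

    close : ∀ i j → M ℕ.⊔ N ℕ.≤ i → M ℕ.⊔ N ℕ.≤ j →
            ℚ.∣ (s i ℚ.+ t i) ℚ.- (s j ℚ.+ t j) ∣ ℚ.< ε
    close i j i≥ j≥ = begin-strict
      ℚ.∣ (s i ℚ.+ t i) ℚ.- (s j ℚ.+ t j) ∣
        ≡⟨ cong ℚ.∣_∣ (regroup (s i) (t i) (s j) (t j)) ⟩
      ℚ.∣ (s i ℚ.- s j) ℚ.+ (t i ℚ.- t j) ∣
        ≤⟨ ℚ.∣p+q∣≤∣p∣+∣q∣ (s i ℚ.- s j) (t i ℚ.- t j) ⟩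
      ℚ.∣ s i ℚ.- s j ∣ ℚ.+ ℚ.∣ t i ℚ.- t j ∣
        <⟨ ℚ.+-mono-<
             (s-close i j (ℕ.m⊔n≤o⇒m≤o M N i≥) (ℕ.m⊔n≤o⇒m≤o M N j≥))
             (t-close i j (ℕ.m⊔n≤o⇒n≤o M N i≥) (ℕ.m⊔n≤o⇒n≤o M N j≥)) ⟩
      ½ ℚ.* ε ℚ.+ ½ ℚ.* ε
        ≡⟨ halves ε ⟩
      ε ∎

  *-cauchy : ∀ q s → IsCauchy s → IsCauchy (λ i → q ℚ.* s i)
  *-cauchy q s cs ε 0<ε = let N , s-close = cs δ 0<δ in N , close s-close
    where
    open ℚ.≤-Reasoning
    open +-*-Solver

    K : ℚ
    K = ℚ.∣ q ∣ ℚ.+ 1ℚ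

    instance
      ∣q∣-nonNeg : ℚ.NonNegative ℚ.∣ q ∣
      ∣q∣-nonNeg = ℚ.nonNegative (ℚ.0≤∣p∣ q)

      K-pos : ℚ.Positive K
      K-pos = ℚ.nonNeg+pos⇒pos ℚ.∣ q ∣ 1ℚ

      K-nonZero : ℚ.NonZero K
      K-nonZero = ℚ.pos⇒nonZero K

      1/K-pos : ℚ.Positive (ℚ.1/ K)
      1/K-pos = ℚ.1/pos⇒pos K

    δ : ℚ
    δ = ℚ.1/ K ℚ.* ε

    0<δ : 0ℚ ℚ.< δ
    0<δ = subst (ℚ._< δ) (ℚ.*-zeroʳ (ℚ.1/ K)) (ℚ.*-monoʳ-<-pos (ℚ.1/ K) 0<ε)

    Kδ≡ε : K ℚ.* δ ≡ ε
    Kδ≡ε = trans (sym (ℚ.*-assoc K (ℚ.1/ K) ε))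
          (trans (cong (ℚ._* ε) (ℚ.*-inverseʳ K)) (ℚ.*-identityˡ ε))

    expand : ∀ a d → a ℚ.* d ℚ.+ d ≡ (a ℚ.+ 1ℚ) ℚ.* d
    expand = solve 2 (λ a d → a :* d :+ d := (a :+ con 1ℚ) :* d) refl

    factor : ∀ a x y → a ℚ.* x ℚ.- a ℚ.* y ≡ a ℚ.* (x ℚ.- y)
    factor = solve 3 (λ a x y → a :* x :- a :* y := a :* (x :- y)) refl

    close : ∀ {N} →
            (∀ i j → N ℕ.≤ i → N ℕ.≤ j → ℚ.∣ s i ℚ.- s j ∣ ℚ.< δ) →
            ∀ i j → N ℕ.≤ i → N ℕ.≤ j →
            ℚ.∣ q ℚ.* s i ℚ.- q ℚ.* s j ∣ ℚ.< ε
    close s-close i j i≥ j≥ = begin-strict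
      ℚ.∣ q ℚ.* s i ℚ.- q ℚ.* s j ∣
        ≡⟨ cong ℚ.∣_∣ (factor q (s i) (s j)) ⟩
      ℚ.∣ q ℚ.* (s i ℚ.- s j) ∣
        ≡⟨ ℚ.∣p*q∣≡∣p∣*∣q∣ q (s i ℚ.- s j) ⟩
      ℚ.∣ q ∣ ℚ.* ℚ.∣ s i ℚ.- s j ∣
        ≤⟨ ℚ.*-monoˡ-≤-nonNeg ℚ.∣ q ∣ (ℚ.<⇒≤ (s-close i j i≥ j≥)) ⟩
      ℚ.∣ q ∣ ℚ.* δ
        ≡⟨ ℚ.+-identityʳ (ℚ.∣ q ∣ ℚ.* δ) ⟨
      ℚ.∣ q ∣ ℚ.* δ ℚ.+ 0ℚ
        <⟨ ℚ.+-monoʳ-< (ℚ.∣ q ∣ ℚ.* δ) 0<δ ⟩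
      ℚ.∣ q ∣ ℚ.* δ ℚ.+ δ
        ≡⟨ expand ℚ.∣ q ∣ δ ⟩
      K ℚ.* δ
        ≡⟨ Kδ≡ε ⟩
      ε ∎

infixl 6 _+_
infixl 7 _·_

fromℚ : ℚ → ℝ
fromℚ q = mkℝ (λ _ → q) (const-cauchy q)

fromℤ : ℤ → ℝ
fromℤ z = fromℚ (z ℚ./ 1)

0ℝ 1ℝ : ℝ
0ℝ = fromℚ 0ℚ
1ℝ = fromℚ 1ℚ

_+_ : ℝ → ℝ → ℝ
x + y = mkℝ (λ i → seq x i ℚ.+ seq y i)
            (+-cauchy (seq x) (seq y) (cauchy x) (cauchy y))

-- Only multiples by rational scalars are needed.
_·_ : ℚ → ℝ → ℝ
q · x = mkℝ (λ i → q ℚ.* seq x i) (*-cauchy q (seq x) (cauchy x))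

IsInteger : Pred ℝ 0ℓ
IsInteger x = ∃[ z ] x ≈ fromℤ z

------------------------------------------------------------------------
-- Vectors

infix 4 _≈ⁿ_
infixl 6 _+ⁿ_ _+ᶻ_

_≈ⁿ_ : Vec ℝ n → Vec ℝ n → Set
_≈ⁿ_ = Pointwise _≈_

_+ⁿ_ : Vec ℝ n → Vec ℝ n → Vec ℝ n
_+ⁿ_ = Vec.zipWith _+_

_+ᶻ_ : Vec ℤ n → Vec ℤ n → Vec ℤ n
_+ᶻ_ = Vec.zipWith ℤ._+_

0ᶻ : Vec ℤ n
0ᶻ = Vec.replicate _ 0ℤ

fromℤⁿ : Vec ℤ n → Vec ℝ n
fromℤⁿ = Vec.map fromℤ

linear : Vec ℚ n → Vec ℝ n → ℝ
linear α c = Vec.foldr′ _+_ 0ℝ (Vec.zipWith _·_ α c)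

------------------------------------------------------------------------
-- Polyhedral convex sets

data Comparison : Set where
  lt le eq ge gt : Comparison

compare : Comparison → ℝ → ℝ → Set
compare lt x y = x < y
compare le x y = x ≤ y
compare eq x y = x ≈ y
compare ge x y = y ≤ x
compare gt x y = y < x

Constraint : ℕ → Set
Constraint n = Vec ℚ n × Comparison × ℚ

Satisfies : Vec ℝ n → Constraint n → Set
Satisfies c (α , # , β) = compare # (linear α c) (fromℚ β)

IsPolyhedralConvex : Pred (Vec ℝ n) ℓ → Set ℓ
IsPolyhedralConvex {n} C =
  Σ[ cs ∈ List (Constraint n) ] C ≐ (λ c → All (Satisfies c) cs)

UnitCube : Pred (Vec ℝ n) 0ℓ
UnitCube = Vecᴬ.All (λ x → 0ℝ ≤ x × x < 1ℝ)

------------------------------------------------------------------------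
-- Finitely generated monoids

-- P * is P^*, the set of finite sums of elements of P; the empty list
-- of summands accounts for 0.
_* : List (Vec ℤ n) → Pred (Vec ℤ n) 0ℓ
(P *) z = ∃[ ps ] (All (List∈._∈ P) ps × z ≡ List.foldr _+ᶻ_ 0ᶻ ps)

IsFGMonoid : Pred (Vec ℤ n) ℓ → Set ℓ
IsFGMonoid {n} M = Σ[ P ∈ List (Vec ℤ n) ] M ≐ P *

------------------------------------------------------------------------
-- Polinear and semi-polinear sets

translate : Vec ℤ n → Pred (Vec ℤ n) 0ℓ → Pred (Vec ℤ n) 0ℓ
translate b M z = ∃[ m ] (m ∈ M × z ≡ b +ᶻ m)

_⊞_ : Pred (Vec ℝ n) 0ℓ → Pred (Vec ℤ n) 0ℓ → Pred (Vec ℝ n) 0ℓ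
(C ⊞ Z) x = ∃[ c ] ∃[ z ] (c ∈ C × z ∈ Z × x ≈ⁿ c +ⁿ fromℤⁿ z)

IsPolinear : Pred (Vec ℝ n) ℓ → Set (lsuc 0ℓ ⊔ ℓ)
IsPolinear {n} L =
  Σ[ C ∈ Pred (Vec ℝ n) 0ℓ ] Σ[ b ∈ Vec ℤ n ] Σ[ M ∈ Pred (Vec ℤ n) 0ℓ ]
    ( IsPolyhedralConvex C × Satisfiable C × C ⊆ UnitCube
    × IsFGMonoid M
    × L ≐ C ⊞ translate b M )

IsSemiPolinear : Pred (Vec ℝ n) ℓ → Set (lsuc 0ℓ ⊔ ℓ)
IsSemiPolinear {n} S =
  ∃[ k ] Σ[ L ∈ (Fin k → Pred (Vec ℝ n) 0ℓ) ]
    ((∀ i → IsPolinear (L i)) × S ≐ ⋃ (Fin k) L)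

------------------------------------------------------------------------
-- FO(ℝ, ℤ, +, ≤), with de Bruijn variables: Formula n has its free
-- variables among n, and a quantifier binds variable zero of its body.

infixl 6 _⊕_
infix  5 _≤ᶠ_ _≈ᶠ_
infixr 4 _∧ᶠ_
infixr 3 _∨ᶠ_
infixr 2 _⇒ᶠ_

data Term (n : ℕ) : Set where
  var : Fin n → Term n
  _⊕_ : Term n → Term n → Term n

data Formula (n : ℕ) : Set where
  _≤ᶠ_ _≈ᶠ_           : Term n → Term n → Formula n
  isInt               : Term n → Formula n
  ¬ᶠ_                 : Formula n → Formula n
  _∧ᶠ_ _∨ᶠ_ _⇒ᶠ_      : Formula n → Formula n → Formula n
  ∃ᶠ_ ∀ᶠ_             : Formula (ℕ.suc n) → Formula n

⟦_⟧ : Term n → Vec ℝ n → ℝ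
⟦ var i ⟧ x = Vec.lookup x i
⟦ s ⊕ t ⟧ x = ⟦ s ⟧ x + ⟦ t ⟧ x

infix 1 _⊨_

_⊨_ : Vec ℝ n → Formula n → Set
x ⊨ s ≤ᶠ t  = ⟦ s ⟧ x ≤ ⟦ t ⟧ x
x ⊨ s ≈ᶠ t  = ⟦ s ⟧ x ≈ ⟦ t ⟧ x
x ⊨ isInt t = IsInteger (⟦ t ⟧ x)
x ⊨ ¬ᶠ φ    = ¬ (x ⊨ φ)
x ⊨ φ ∧ᶠ ψ  = (x ⊨ φ) × (x ⊨ ψ)
x ⊨ φ ∨ᶠ ψ  = (x ⊨ φ) ⊎ (x ⊨ ψ)
x ⊨ φ ⇒ᶠ ψ  = (x ⊨ φ) → (x ⊨ ψ)
x ⊨ ∃ᶠ φ    = Σ[ r ∈ ℝ ] (r ∷ x ⊨ φ)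
x ⊨ ∀ᶠ φ    = ∀ (r : ℝ) → r ∷ x ⊨ φ

IsMixedLinear : Pred (Vec ℝ n) ℓ → Set ℓ
IsMixedLinear {n} S = Σ[ φ ∈ Formula n ] S ≐ (_⊨ φ)

{-# OPTIONS --safe #-}

-- Every vector x of reals splits as c + z with c in the unit cube and z integral,
-- and a formula becomes a finite union of products P × Q, with P a condition on c
-- and Q a condition on z: an atom compares two values that differ by a bounded
-- amount on the cube and by an integer on z, so finitely many integer offsets k
-- suffice, and ∃ acts on P and Q separately.  On P it is Fourier-Motzkin
-- elimination.  On Q it is the same elimination after restriction to residue
-- classes modulo the coefficient of the eliminated variable, where the least
-- integer above an affine bound is itself affine.  Finally the integer points of
-- a polyhedron, cut along orthants so as to make its recession cone pointed, are
-- semilinear by Dickson's lemma applied to the slacks of its constraints.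
-- Conversely, x lies in C + b + P* iff x - b - Σ lᵢ pᵢ satisfies the constraints of
-- C for some naturals lᵢ, and rational constraints are definable because 1 is the
-- least positive integer.
module Submission where

open import Level using (Level; 0ℓ; _⊔_) renaming (suc to lsuc)
open import Algebra.Bundles using (CommutativeMonoid; CommutativeRing)
import Algebra.Properties.CommutativeSemigroup as CSemigroup
open import Axiom.ExcludedMiddle using (ExcludedMiddle)
open import Data.Bool.Base using (Bool; true; false; _∨_)
open import Data.Empty using (⊥-elim)
open import Data.Fin.Base as Fin using (Fin; zero; suc; _↑ˡ_; _↑ʳ_; splitAt)
import Data.Fin.Properties as Fin
open import Data.Integer.Base as ℤ using (ℤ; +_; 0ℤ; 1ℤ; -1ℤ)
import Data.Integer.DivMod as ℤ
import Data.Integer.Properties as ℤ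
import Data.Integer.Solver
open import Data.List.Base as List using (List; []; _∷_; _++_)
import Data.List.Membership.Propositional as List∈
import Data.List.Membership.Propositional.Properties as List∈
open import Data.List.Relation.Unary.All as All using (All; []; _∷_)
import Data.List.Relation.Unary.All.Properties as All
open import Data.List.Relation.Unary.Any as Any using (Any; here; there)
import Data.List.Relation.Unary.Any.Properties as Any
open import Data.Nat.Base as ℕ using (ℕ; zero; suc; _≥_)
import Data.Nat.Properties as ℕ
open import Data.Product.Base using (Σ-syntax; ∃-syntax; _×_; _,_; proj₁; proj₂)
open import Data.Rational.Base as ℚ using (ℚ; 0ℚ; 1ℚ; ½)
import Data.Rational.Properties as ℚ
open import Data.Rational.Solver using (module +-*-Solver)
import Data.Rational.Unnormalised.Base as ℚᵘ
import Data.Rational.Unnormalised.Properties as ℚᵘ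
open import Data.Sign.Base using (Sign)
open import Data.Sum.Base as Sum using (_⊎_; inj₁; inj₂; [_,_]′)
open import Data.Unit.Base using (tt)
open import Data.Vec.Base as Vec using (Vec; []; _∷_)
import Data.Vec.Properties as Vec
import Data.Vec.Relation.Binary.Pointwise.Inductive as Pointwise
import Data.Vec.Relation.Unary.All as Vecᴬ
import Data.Vec.Relation.Unary.All.Properties as Vecᴬ
open import Function.Base using (_∘_; id)
open import Function.Bundles using (_⇔_; mk⇔)
open import Relation.Binary.Definitions using (Tri; tri<; tri≈; tri>)
open import Relation.Binary.PropositionalEquality
  using (_≡_; _≢_; refl; sym; trans; cong; cong₂; subst; subst₂; module ≡-Reasoning)
open import Relation.Nullary using (Dec; ¬_; yes; no)
open import Relation.Unary using (Pred; _∪_; _∩_; ∁; ∅; U; _⊆_; _≐_; ⋃)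
open import Defs using (ℝ; IsSemiPolinear; IsMixedLinear)

-- Both eliminations rest on a one-dimensional Helly argument: in a total order, finitely many
-- nonempty up-closed and down-closed sets have a common point as soon as each up-closed one meets
-- each down-closed one. Comparing sets by inclusion instead of comparing bounds lets strict and
-- weak inequalities mix, and leaves only the elimination from a single pair of constraints to
-- depend on the domain. There the two cases part: over ℝ a midpoint settles a pair, whereas over ℤ
-- the projection of a polyhedron need not be a finite union of polyhedra (the even numbers).
-- Integer sets are therefore described by a modulus `M` such that the restriction along every
-- `r + M w` is such a union; complements are taken class by class, and moduli are made common by
-- multiplying them. Excluded middle decides the order of reals, membership in a half-space, the
-- existence of minimal elements in Dickson's lemma, and whether a piece of the cube is empty. Reals
-- form only a setoid, so formulas have to be shown invariant under `≈ⁿ` before a vector can be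
-- exchanged for its decomposition `c + z`.

module RealNumbers where

  -- Order and arithmetic of the Cauchy reals, up to the floor function

  open Defs hiding (lt; le; eq; ge; gt)

  ½-pos : ∀ {ε} → 0ℚ ℚ.< ε → 0ℚ ℚ.< ½ ℚ.* ε
  ½-pos {ε} 0<ε = subst (ℚ._< ½ ℚ.* ε) (ℚ.*-zeroʳ ½) (ℚ.*-monoʳ-<-pos ½ 0<ε)

  ½+½ : ∀ r → ½ ℚ.* r ℚ.+ ½ ℚ.* r ≡ r
  ½+½ r = trans (sym (ℚ.*-distribʳ-+ r ½ ½)) (ℚ.*-identityˡ r)

  ½<1 : ∀ {ε} → 0ℚ ℚ.< ε → ½ ℚ.* ε ℚ.< ε
  ½<1 {ε} 0<ε = subst₂ ℚ._<_ (ℚ.+-identityʳ _) (½+½ ε)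
    (ℚ.+-monoʳ-< (½ ℚ.* ε) (½-pos 0<ε))

  p≤∣p∣ : ∀ p → p ℚ.≤ ℚ.∣ p ∣
  p≤∣p∣ p with ℚ.≤-total 0ℚ p
  ... | inj₁ 0≤p = ℚ.≤-reflexive (sym (ℚ.0≤p⇒∣p∣≡p 0≤p))
  ... | inj₂ p≤0 = ℚ.≤-trans p≤0 (ℚ.0≤∣p∣ p)

  module _ where
    open +-*-Solver

    private
      a-b+b : ∀ a b → (a ℚ.- b) ℚ.+ b ≡ a
      a-b+b = solve 2 (λ a b → (a :- b) :+ b := a) refl

      a+e-b : ∀ a e → (a ℚ.+ e) ℚ.- a ≡ e
      a+e-b = solve 2 (λ a e → (a :+ e) :- a := e) refl

      swap-sub : ∀ a b → ℚ.- (a ℚ.- b) ≡ b ℚ.- a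
      swap-sub = solve 2 (λ a b → :- (a :- b) := b :- a) refl

    ∣-∣⇒≤ˡ : ∀ a b {ε} → ℚ.∣ a ℚ.- b ∣ ℚ.< ε → a ℚ.≤ b ℚ.+ ε
    ∣-∣⇒≤ˡ a b {ε} lt = subst₂ ℚ._≤_ (a-b+b a b) (ℚ.+-comm ε b)
      (ℚ.+-monoˡ-≤ b (ℚ.≤-trans (p≤∣p∣ _) (ℚ.<⇒≤ lt)))

    ∣-∣-comm : ∀ a b → ℚ.∣ a ℚ.- b ∣ ≡ ℚ.∣ b ℚ.- a ∣
    ∣-∣-comm a b = trans (sym (ℚ.∣-p∣≡∣p∣ (a ℚ.- b))) (cong ℚ.∣_∣ (swap-sub a b))

    ∣-∣⇒≤ʳ : ∀ a b {ε} → ℚ.∣ a ℚ.- b ∣ ℚ.< ε → b ℚ.≤ a ℚ.+ ε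
    ∣-∣⇒≤ʳ a b {ε} lt = ∣-∣⇒≤ˡ b a (subst (ℚ._< ε) (∣-∣-comm a b) lt)

    ≤-sub : ∀ {a b ε} → a ℚ.≤ b ℚ.+ ε → a ℚ.- b ℚ.≤ ε
    ≤-sub {a} {b} {ε} le = subst (a ℚ.- b ℚ.≤_) (a+e-b b ε) (ℚ.+-monoˡ-≤ (ℚ.- b) le)

    ≤⇒∣-∣≤ : ∀ {a b ε} → a ℚ.≤ b ℚ.+ ε → b ℚ.≤ a ℚ.+ ε → ℚ.∣ a ℚ.- b ∣ ℚ.≤ ε
    ≤⇒∣-∣≤ {a} {b} {ε} le ge with ℚ.∣p∣≡p∨∣p∣≡-p (a ℚ.- b)
    ... | inj₁ e = subst (ℚ._≤ ε) (sym e) (≤-sub le)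
    ... | inj₂ e = subst (ℚ._≤ ε) (sym (trans e (swap-sub a b))) (≤-sub ge)

  ≤-refl : ∀ {x} → x ≤ x
  ≤-refl {x} ε 0<ε = 0 , λ i _ →
    subst (ℚ._≤ seq x i ℚ.+ ε) (ℚ.+-identityʳ _) (ℚ.+-monoʳ-≤ (seq x i) (ℚ.<⇒≤ 0<ε))

  ≤-trans : ∀ {x y z} → x ≤ y → y ≤ z → x ≤ z
  ≤-trans {x} {y} {z} x≤y y≤z ε 0<ε
    with M , p ← x≤y _ (½-pos 0<ε) | N , q ← y≤z _ (½-pos 0<ε)
    = M ℕ.⊔ N , λ i i≥ → begin
      seq x i                                ≤⟨ p i (ℕ.m⊔n≤o⇒m≤o M N i≥) ⟩
      seq y i ℚ.+ ½ ℚ.* ε                    ≤⟨ ℚ.+-monoˡ-≤ (½ ℚ.* ε) (q i (ℕ.m⊔n≤o⇒n≤o M N i≥)) ⟩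
      seq z i ℚ.+ ½ ℚ.* ε ℚ.+ ½ ℚ.* ε        ≡⟨ ℚ.+-assoc (seq z i) _ _ ⟩
      seq z i ℚ.+ (½ ℚ.* ε ℚ.+ ½ ℚ.* ε)      ≡⟨ cong (seq z i ℚ.+_) (½+½ ε) ⟩
      seq z i ℚ.+ ε                          ∎
    where open ℚ.≤-Reasoning

  ≈⇒≤ : ∀ {x y} → x ≈ y → x ≤ y
  ≈⇒≤ {x} {y} x≈y ε 0<ε with N , p ← x≈y ε 0<ε = N , λ i i≥ → ∣-∣⇒≤ˡ (seq x i) (seq y i) (p i i≥)

  ≈⇒≥ : ∀ {x y} → x ≈ y → y ≤ x
  ≈⇒≥ {x} {y} x≈y ε 0<ε with N , p ← x≈y ε 0<ε = N , λ i i≥ → ∣-∣⇒≤ʳ (seq x i) (seq y i) (p i i≥)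

  ≤-antisym : ∀ {x y} → x ≤ y → y ≤ x → x ≈ y
  ≤-antisym x≤y y≤x ε 0<ε
    with M , p ← x≤y _ (½-pos 0<ε) | N , q ← y≤x _ (½-pos 0<ε)
    = M ℕ.⊔ N , λ i i≥ → ℚ.≤-<-trans
        (≤⇒∣-∣≤ (p i (ℕ.m⊔n≤o⇒m≤o M N i≥)) (q i (ℕ.m⊔n≤o⇒n≤o M N i≥)))
        (½<1 0<ε)

  ≈-refl : ∀ {x} → x ≈ x
  ≈-refl {x} = ≤-antisym {x} {x} (≤-refl {x}) (≤-refl {x})

  ≈-sym : ∀ {x y} → x ≈ y → y ≈ x
  ≈-sym {x} {y} p = ≤-antisym {y} {x} (≈⇒≥ {x} {y} p) (≈⇒≤ {x} {y} p)

  ≈-trans : ∀ {x y z} → x ≈ y → y ≈ z → x ≈ z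
  ≈-trans {x} {y} {z} p q = ≤-antisym {x} {z}
    (≤-trans {x} {y} {z} (≈⇒≤ {x} {y} p) (≈⇒≤ {y} {z} q))
    (≤-trans {z} {y} {x} (≈⇒≥ {y} {z} q) (≈⇒≥ {x} {y} p))

  ≗⇒≤ : ∀ {x y} → (∀ i → seq x i ≡ seq y i) → x ≤ y
  ≗⇒≤ {x} {y} e ε 0<ε with N , p ← ≤-refl {x} ε 0<ε =
    N , λ i i≥ → subst (λ a → seq x i ℚ.≤ a ℚ.+ ε) (e i) (p i i≥)

  ≗⇒≈ : ∀ {x y} → (∀ i → seq x i ≡ seq y i) → x ≈ y
  ≗⇒≈ {x} {y} e = ≤-antisym {x} {y} (≗⇒≤ {x} {y} e) (≗⇒≤ {y} {x} (sym ∘ e))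

  +-mono-≤ : ∀ {x y u v} → x ≤ y → u ≤ v → x + u ≤ y + v
  +-mono-≤ {x} {y} {u} {v} x≤y u≤v ε 0<ε
    with M , p ← x≤y _ (½-pos 0<ε) | N , q ← u≤v _ (½-pos 0<ε)
    = M ℕ.⊔ N , λ i i≥ → begin
      seq x i ℚ.+ seq u i
        ≤⟨ ℚ.+-mono-≤ (p i (ℕ.m⊔n≤o⇒m≤o M N i≥)) (q i (ℕ.m⊔n≤o⇒n≤o M N i≥)) ⟩
      (seq y i ℚ.+ ½ ℚ.* ε) ℚ.+ (seq v i ℚ.+ ½ ℚ.* ε)
        ≡⟨ regroup (seq y i) (seq v i) (½ ℚ.* ε) ⟩
      seq y i ℚ.+ seq v i ℚ.+ (½ ℚ.* ε ℚ.+ ½ ℚ.* ε)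
        ≡⟨ cong (seq y i ℚ.+ seq v i ℚ.+_) (½+½ ε) ⟩
      seq y i ℚ.+ seq v i ℚ.+ ε ∎
    where
    open ℚ.≤-Reasoning
    open +-*-Solver
    regroup : ∀ a b d → (a ℚ.+ d) ℚ.+ (b ℚ.+ d) ≡ a ℚ.+ b ℚ.+ (d ℚ.+ d)
    regroup = solve 3 (λ a b d → (a :+ d) :+ (b :+ d) := a :+ b :+ (d :+ d)) refl

  -- Weak order leaves a slack as small as desired. It is taken to be half of the gap `ε`, and the
  -- other half survives as the gap between the sums.
  +-mono-<-≤ : ∀ {x y u v} → x < y → u ≤ v → x + u < y + v
  +-mono-<-≤ {x} {y} {u} {v} (ε , 0<ε , M , p) u≤v
    with N , q ← u≤v _ (½-pos 0<ε)
    = ½ ℚ.* ε , ½-pos 0<ε , M ℕ.⊔ N , λ i i≥ → cancel (begin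
      (seq x i ℚ.+ seq u i ℚ.+ ½ ℚ.* ε) ℚ.+ ½ ℚ.* ε
        ≡⟨ regroup (seq x i) (seq u i) (½ ℚ.* ε) ⟩
      (seq x i ℚ.+ (½ ℚ.* ε ℚ.+ ½ ℚ.* ε)) ℚ.+ seq u i
        ≡⟨ cong (λ e → seq x i ℚ.+ e ℚ.+ seq u i) (½+½ ε) ⟩
      (seq x i ℚ.+ ε) ℚ.+ seq u i
        ≤⟨ ℚ.+-mono-≤ (p i (ℕ.m⊔n≤o⇒m≤o M N i≥)) (q i (ℕ.m⊔n≤o⇒n≤o M N i≥)) ⟩
      seq y i ℚ.+ (seq v i ℚ.+ ½ ℚ.* ε)
        ≡⟨ ℚ.+-assoc (seq y i) (seq v i) _ ⟨
      (seq y i ℚ.+ seq v i) ℚ.+ ½ ℚ.* ε ∎)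
    where
    open ℚ.≤-Reasoning
    open +-*-Solver
    regroup : ∀ a b d → (a ℚ.+ b ℚ.+ d) ℚ.+ d ≡ (a ℚ.+ (d ℚ.+ d)) ℚ.+ b
    regroup = solve 3 (λ a b d → (a :+ b :+ d) :+ d := (a :+ (d :+ d)) :+ b) refl
    undo : ∀ a d → a ℚ.+ d ℚ.- d ≡ a
    undo = solve 2 (λ a d → a :+ d :- d := a) refl
    cancel : ∀ {a b d} → a ℚ.+ d ℚ.≤ b ℚ.+ d → a ℚ.≤ b
    cancel {a} {b} {d} le = subst₂ ℚ._≤_ (undo a d) (undo b d) (ℚ.+-monoˡ-≤ (ℚ.- d) le)

  <⇒≱ : ∀ {x y} → x < y → ¬ (y ≤ x)
  <⇒≱ {x} {y} (ε , 0<ε , M , p) y≤x with N , q ← y≤x _ (½-pos 0<ε) =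
    ℚ.<-irrefl refl (begin-strict
      seq x k ℚ.+ ½ ℚ.* ε  <⟨ ℚ.+-monoʳ-< (seq x k) (½<1 0<ε) ⟩
      seq x k ℚ.+ ε        ≤⟨ p k (ℕ.m≤m⊔n M N) ⟩
      seq y k              ≤⟨ q k (ℕ.m≤n⊔m M N) ⟩
      seq x k ℚ.+ ½ ℚ.* ε  ∎)
    where
    open ℚ.≤-Reasoning
    k = M ℕ.⊔ N

  private
    +-cancelʳ-≤ : ∀ {a b} d → a ℚ.+ d ℚ.≤ b ℚ.+ d → a ℚ.≤ b
    +-cancelʳ-≤ {a} {b} d le = subst₂ ℚ._≤_ (undo a d) (undo b d) (ℚ.+-monoˡ-≤ (ℚ.- d) le)
      where
      open +-*-Solver
      undo : ∀ a d → a ℚ.+ d ℚ.- d ≡ a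
      undo = solve 2 (λ a d → a :+ d :- d := a) refl

  -- Holds without excluded middle, because the order of ℚ is decidable: both sequences are compared
  -- at one index `k` beyond which each moves by less than `δ`. If `x` leads `y` there by `3δ`, a
  -- gap `δ` survives the two drifts, so `y < x`. Otherwise `x` exceeds `y` later on by at most `3δ`
  -- plus two drifts, and `5δ ≤ ε` since `δ` is an eighth of `ε`.
  ≮⇒≥ : ∀ {x y} → ¬ (y < x) → x ≤ y
  ≮⇒≥ {x} {y} y≮x ε 0<ε = let M , p = cauchy x δ 0<δ ; N , q = cauchy y δ 0<δ in
    decide (M ℕ.⊔ N)
      (λ i i≥ → p i (M ℕ.⊔ N) (ℕ.m⊔n≤o⇒m≤o M N i≥) (ℕ.m≤m⊔n M N))
      (λ i i≥ → q i (M ℕ.⊔ N) (ℕ.m⊔n≤o⇒n≤o M N i≥) (ℕ.m≤n⊔m M N))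
    where
    open ℚ.≤-Reasoning
    open +-*-Solver
    h e δ : ℚ
    h = ½ ℚ.* ε
    e = ½ ℚ.* h
    δ = ½ ℚ.* e
    0<δ : 0ℚ ℚ.< δ
    0<δ = ½-pos (½-pos (½-pos 0<ε))

    shuffle : ∀ a d → a ℚ.+ d ℚ.+ d ℚ.+ (d ℚ.+ d) ≡ a ℚ.+ (d ℚ.+ d ℚ.+ d) ℚ.+ d
    shuffle = solve 2 (λ a d → a :+ d :+ d :+ (d :+ d) := a :+ (d :+ d :+ d) :+ d) refl

    collect : ∀ a d → a ℚ.+ d ℚ.+ (d ℚ.+ d ℚ.+ d) ℚ.+ d ≡ a ℚ.+ (d ℚ.+ d ℚ.+ (d ℚ.+ d) ℚ.+ d)
    collect = solve 2 (λ a d → a :+ d :+ (d :+ d :+ d) :+ d := a :+ (d :+ d :+ (d :+ d) :+ d)) refl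

    5δ≤ε : δ ℚ.+ δ ℚ.+ (δ ℚ.+ δ) ℚ.+ δ ℚ.≤ ε
    5δ≤ε = begin
      δ ℚ.+ δ ℚ.+ (δ ℚ.+ δ) ℚ.+ δ  ≡⟨ cong₂ (λ a b → a ℚ.+ b ℚ.+ δ) (½+½ e) (½+½ e) ⟩
      e ℚ.+ e ℚ.+ δ                ≡⟨ cong (ℚ._+ δ) (½+½ h) ⟩
      h ℚ.+ δ                      ≤⟨ ℚ.+-monoʳ-≤ h (ℚ.<⇒≤ (ℚ.<-trans (½<1 (½-pos (½-pos 0<ε))) (½<1 (½-pos 0<ε)))) ⟩
      h ℚ.+ h                      ≡⟨ ½+½ ε ⟩
      ε                            ∎

    decide : ∀ k → (∀ i → k ℕ.≤ i → ℚ.∣ seq x i ℚ.- seq x k ∣ ℚ.< δ) →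
             (∀ i → k ℕ.≤ i → ℚ.∣ seq y i ℚ.- seq y k ∣ ℚ.< δ) →
             ∃[ N ] (∀ i → N ℕ.≤ i → seq x i ℚ.≤ seq y i ℚ.+ ε)
    decide k p q with (seq y k ℚ.+ (δ ℚ.+ δ ℚ.+ δ)) ℚ.≤? seq x k
    ... | yes far = ⊥-elim (y≮x (δ , 0<δ , k , λ i i≥ → +-cancelʳ-≤ (δ ℚ.+ δ) (begin
      seq y i ℚ.+ δ ℚ.+ (δ ℚ.+ δ)
        ≤⟨ ℚ.+-monoˡ-≤ (δ ℚ.+ δ) (ℚ.+-monoˡ-≤ δ (∣-∣⇒≤ˡ (seq y i) (seq y k) (q i i≥))) ⟩
      seq y k ℚ.+ δ ℚ.+ δ ℚ.+ (δ ℚ.+ δ)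
        ≡⟨ shuffle (seq y k) δ ⟩
      seq y k ℚ.+ (δ ℚ.+ δ ℚ.+ δ) ℚ.+ δ
        ≤⟨ ℚ.+-monoˡ-≤ δ far ⟩
      seq x k ℚ.+ δ
        ≤⟨ ℚ.+-monoˡ-≤ δ (∣-∣⇒≤ʳ (seq x i) (seq x k) (p i i≥)) ⟩
      seq x i ℚ.+ δ ℚ.+ δ
        ≡⟨ ℚ.+-assoc (seq x i) δ δ ⟩
      seq x i ℚ.+ (δ ℚ.+ δ) ∎)))
    ... | no near = k , λ i i≥ → begin
      seq x i
        ≤⟨ ∣-∣⇒≤ˡ (seq x i) (seq x k) (p i i≥) ⟩
      seq x k ℚ.+ δ
        ≤⟨ ℚ.+-monoˡ-≤ δ (ℚ.<⇒≤ (ℚ.≰⇒> near)) ⟩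
      seq y k ℚ.+ (δ ℚ.+ δ ℚ.+ δ) ℚ.+ δ
        ≤⟨ ℚ.+-monoˡ-≤ δ (ℚ.+-monoˡ-≤ (δ ℚ.+ δ ℚ.+ δ) (∣-∣⇒≤ʳ (seq y i) (seq y k) (q i i≥))) ⟩
      seq y i ℚ.+ δ ℚ.+ (δ ℚ.+ δ ℚ.+ δ) ℚ.+ δ
        ≡⟨ collect (seq y i) δ ⟩
      seq y i ℚ.+ (δ ℚ.+ δ ℚ.+ (δ ℚ.+ δ) ℚ.+ δ)
        ≤⟨ ℚ.+-monoʳ-≤ (seq y i) 5δ≤ε ⟩
      seq y i ℚ.+ ε ∎

  <⇒≤ : ∀ {x y} → x < y → x ≤ y
  <⇒≤ {x} {y} x<y = ≮⇒≥ {x} {y} λ y<x → <⇒≱ {x} {y} x<y (<⇒≤′ y<x)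
    where
    <⇒≤′ : y < x → y ≤ x
    <⇒≤′ (ε , 0<ε , N , p) δ 0<δ = N , λ i i≥ → ℚ.≤-trans
      (ℚ.≤-trans (subst (ℚ._≤ seq y i ℚ.+ ε) (ℚ.+-identityʳ _) (ℚ.+-monoʳ-≤ (seq y i) (ℚ.<⇒≤ 0<ε))) (p i i≥))
      (subst (ℚ._≤ seq x i ℚ.+ δ) (ℚ.+-identityʳ _) (ℚ.+-monoʳ-≤ (seq x i) (ℚ.<⇒≤ 0<δ)))

  ·-mono-≤ : ∀ q {x y} .{{_ : ℚ.Positive q}} → x ≤ y → q · x ≤ q · y
  ·-mono-≤ q {x} {y} x≤y ε 0<ε = let N , p = x≤y δ 0<δ in N , λ i i≥ → begin
    q ℚ.* seq x i              ≤⟨ ℚ.*-monoˡ-≤-nonNeg q (p i i≥) ⟩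
    q ℚ.* (seq y i ℚ.+ δ)      ≡⟨ ℚ.*-distribˡ-+ q (seq y i) δ ⟩
    q ℚ.* seq y i ℚ.+ q ℚ.* δ  ≡⟨ cong (q ℚ.* seq y i ℚ.+_) qδ≡ε ⟩
    q ℚ.* seq y i ℚ.+ ε        ∎
    where
    open ℚ.≤-Reasoning
    instance
      q-nonZero : ℚ.NonZero q
      q-nonZero = ℚ.pos⇒nonZero q
      q-nonNeg : ℚ.NonNegative q
      q-nonNeg = ℚ.pos⇒nonNeg q
      1/q-pos : ℚ.Positive (ℚ.1/ q)
      1/q-pos = ℚ.1/pos⇒pos q
    δ : ℚ
    δ = ℚ.1/ q ℚ.* ε
    0<δ : 0ℚ ℚ.< δ
    0<δ = subst (ℚ._< δ) (ℚ.*-zeroʳ (ℚ.1/ q)) (ℚ.*-monoʳ-<-pos (ℚ.1/ q) 0<ε)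
    qδ≡ε : q ℚ.* δ ≡ ε
    qδ≡ε = trans (sym (ℚ.*-assoc q (ℚ.1/ q) ε))
          (trans (cong (ℚ._* ε) (ℚ.*-inverseʳ q)) (ℚ.*-identityˡ ε))

  ·-mono-< : ∀ q {x y} .{{_ : ℚ.Positive q}} → x < y → q · x < q · y
  ·-mono-< q {x} {y} (ε , 0<ε , N , p) =
    q ℚ.* ε , subst (ℚ._< q ℚ.* ε) (ℚ.*-zeroʳ q) (ℚ.*-monoʳ-<-pos q 0<ε) , N , λ i i≥ →
    subst (ℚ._≤ q ℚ.* seq y i) (ℚ.*-distribˡ-+ q (seq x i) ε)
      (ℚ.*-monoˡ-≤-nonNeg q {{ℚ.pos⇒nonNeg q}} (p i i≥))

  fromℚ-mono-≤ : ∀ {p q} → p ℚ.≤ q → fromℚ p ≤ fromℚ q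
  fromℚ-mono-≤ {p} {q} p≤q ε 0<ε = 0 , λ _ _ → ℚ.≤-trans p≤q
    (subst (ℚ._≤ q ℚ.+ ε) (ℚ.+-identityʳ _) (ℚ.+-monoʳ-≤ q (ℚ.<⇒≤ 0<ε)))

  fromℚ-mono-< : ∀ {p q} → p ℚ.< q → fromℚ p < fromℚ q
  fromℚ-mono-< {p} {q} p<q = q ℚ.- p ,
    subst (ℚ._< q ℚ.- p) (ℚ.+-inverseʳ p) (ℚ.+-monoˡ-< (ℚ.- p) p<q) ,
    0 , λ _ _ → ℚ.≤-reflexive (cancel p q)
    where
    open +-*-Solver
    cancel : ∀ p q → p ℚ.+ (q ℚ.- p) ≡ q
    cancel = solve 2 (λ p q → p :+ (q :- p) := q) refl

  fromℚ-cancel-≤ : ∀ {p q} → fromℚ p ≤ fromℚ q → p ℚ.≤ q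
  fromℚ-cancel-≤ {p} {q} p≤q = ℚ.≮⇒≥ λ q<p → <⇒≱ {fromℚ q} {fromℚ p} (fromℚ-mono-< q<p) p≤q

  toℚ : ℤ → ℚ
  toℚ z = z ℚ./ 1

  private
    toℚᵘ-toℚ : ∀ z → ℚ.toℚᵘ (toℚ z) ℚᵘ.≃ ℚᵘ.mkℚᵘ z 0
    toℚᵘ-toℚ z = ℚ.toℚᵘ-fromℚᵘ (ℚᵘ.mkℚᵘ z 0)

  toℚ-+ : ∀ a b → toℚ (a ℤ.+ b) ≡ toℚ a ℚ.+ toℚ b
  toℚ-+ a b = ℚ.toℚᵘ-injective (begin
    ℚ.toℚᵘ (toℚ (a ℤ.+ b))                   ≈⟨ toℚᵘ-toℚ (a ℤ.+ b) ⟩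
    ℚᵘ.mkℚᵘ (a ℤ.+ b) 0                      ≈⟨ ℚᵘ.*≡* (cong (ℤ._* 1ℤ) (cong₂ ℤ._+_ (sym (ℤ.*-identityʳ a)) (sym (ℤ.*-identityʳ b)))) ⟩
    ℚᵘ.mkℚᵘ a 0 ℚᵘ.+ ℚᵘ.mkℚᵘ b 0             ≈⟨ ℚᵘ.+-cong (toℚᵘ-toℚ a) (toℚᵘ-toℚ b) ⟨
    ℚ.toℚᵘ (toℚ a) ℚᵘ.+ ℚ.toℚᵘ (toℚ b)       ≈⟨ ℚ.toℚᵘ-homo-+ (toℚ a) (toℚ b) ⟨
    ℚ.toℚᵘ (toℚ a ℚ.+ toℚ b)                 ∎)
    where open ℚᵘ.≃-Reasoning

  toℚ-* : ∀ a b → toℚ (a ℤ.* b) ≡ toℚ a ℚ.* toℚ b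
  toℚ-* a b = ℚ.toℚᵘ-injective (begin
    ℚ.toℚᵘ (toℚ (a ℤ.* b))                   ≈⟨ toℚᵘ-toℚ (a ℤ.* b) ⟩
    ℚᵘ.mkℚᵘ a 0 ℚᵘ.* ℚᵘ.mkℚᵘ b 0             ≈⟨ ℚᵘ.*-cong (toℚᵘ-toℚ a) (toℚᵘ-toℚ b) ⟨
    ℚ.toℚᵘ (toℚ a) ℚᵘ.* ℚ.toℚᵘ (toℚ b)       ≈⟨ ℚ.toℚᵘ-homo-* (toℚ a) (toℚ b) ⟨
    ℚ.toℚᵘ (toℚ a ℚ.* toℚ b)                 ∎)
    where open ℚᵘ.≃-Reasoning

  toℚ-mono-≤ : ∀ {a b} → a ℤ.≤ b → toℚ a ℚ.≤ toℚ b
  toℚ-mono-≤ {a} {b} a≤b = ℚ.toℚᵘ-cancel-≤ (begin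
    ℚ.toℚᵘ (toℚ a)  ≃⟨ toℚᵘ-toℚ a ⟩
    ℚᵘ.mkℚᵘ a 0     ≤⟨ ℚᵘ.*≤* (ℤ.*-monoʳ-≤-nonNeg 1ℤ a≤b) ⟩
    ℚᵘ.mkℚᵘ b 0     ≃⟨ toℚᵘ-toℚ b ⟨
    ℚ.toℚᵘ (toℚ b)  ∎)
    where open ℚᵘ.≤-Reasoning

  toℚ-mono-< : ∀ {a b} → a ℤ.< b → toℚ a ℚ.< toℚ b
  toℚ-mono-< {a} {b} a<b = ℚ.toℚᵘ-cancel-< (begin-strict
    ℚ.toℚᵘ (toℚ a)  ≃⟨ toℚᵘ-toℚ a ⟩
    ℚᵘ.mkℚᵘ a 0     <⟨ ℚᵘ.*<* (ℤ.*-monoʳ-<-pos 1ℤ a<b) ⟩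
    ℚᵘ.mkℚᵘ b 0     ≃⟨ toℚᵘ-toℚ b ⟨
    ℚ.toℚᵘ (toℚ b)  ∎)
    where open ℚᵘ.≤-Reasoning

  toℚ-cancel-≤ : ∀ {a b} → toℚ a ℚ.≤ toℚ b → a ℤ.≤ b
  toℚ-cancel-≤ {a} {b} le with a ℤ.≤? b
  ... | yes a≤b = a≤b
  ... | no a≰b = ⊥-elim (ℚ.<-irrefl refl (ℚ.<-≤-trans (toℚ-mono-< (ℤ.≰⇒> a≰b)) le))

  -- The denominator is at least one. This is the Archimedean bound from which `bounded` is
  -- obtained.
  ∣p∣≤numerator : ∀ p → ℚ.∣ p ∣ ℚ.≤ toℚ (+ ℤ.∣ ℚ.numerator p ∣)
  ∣p∣≤numerator (ℚ.mkℚ n d _) = ℚ.toℚᵘ-cancel-≤ (begin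
    ℚᵘ.mkℚᵘ (+ ℤ.∣ n ∣) d              ≤⟨ ℚᵘ.*≤* (ℤ.*-monoˡ-≤-nonNeg (+ ℤ.∣ n ∣) (ℤ.+≤+ (ℕ.s≤s ℕ.z≤n))) ⟩
    ℚᵘ.mkℚᵘ (+ ℤ.∣ n ∣) 0              ≃⟨ toℚᵘ-toℚ (+ ℤ.∣ n ∣) ⟨
    ℚ.toℚᵘ (toℚ (+ ℤ.∣ n ∣))           ∎)
    where open ℚᵘ.≤-Reasoning

  bounded : ∀ x → ∃[ m ] (fromℤ (ℤ.- (+ m)) ≤ x × x < fromℤ (+ m))
  bounded x = let N , p = cauchy x 1ℚ (ℚ.*<* (ℤ.+<+ (ℕ.s≤s ℕ.z≤n))) in
    bound N (λ i i≥ → p i N i≥ ℕ.≤-refl)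
    where
    open ℚ.≤-Reasoning
    open +-*-Solver
    shift : ∀ a b → ℚ.- (b ℚ.+ 1ℚ) ℚ.+ (a ℚ.+ 1ℚ ℚ.+ b) ≡ a
    shift = solve 2 (λ a b → :- (b :+ con 1ℚ) :+ (a :+ con 1ℚ :+ b) := a) refl

    bound : ∀ N → (∀ i → N ℕ.≤ i → ℚ.∣ seq x i ℚ.- seq x N ∣ ℚ.< 1ℚ) →
            ∃[ m ] (fromℤ (ℤ.- (+ m)) ≤ x × x < fromℤ (+ m))
    bound N p = m , ≤-trans {fromℤ (ℤ.- (+ m))} {fromℚ (ℚ.- M)} {x}
                     (fromℚ-mono-≤ (ℚ.≤-reflexive (toℚ-neg (+ m))))
                     (λ ε 0<ε → N , λ i i≥ → ℚ.≤-trans (below i i≥)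
                       (subst (ℚ._≤ seq x i ℚ.+ ε) (ℚ.+-identityʳ _) (ℚ.+-monoʳ-≤ (seq x i) (ℚ.<⇒≤ 0<ε))))
                  , (1ℚ , ℚ.*<* (ℤ.+<+ (ℕ.s≤s ℕ.z≤n)) , N , above)
      where
      a = ℤ.∣ ℚ.numerator (seq x N) ∣
      -- `a` bounds the absolute value of `seq x N`. One unit covers the drift after index `N`; the
      -- second is the gap that makes the upper bound strict.
      m = a ℕ.+ 2
      M = toℚ (+ m)
      toℚ-neg : ∀ z → toℚ (ℤ.- z) ≡ ℚ.- toℚ z
      toℚ-neg z = begin-equality
        toℚ (ℤ.- z)                         ≡⟨ solve 2 (λ u v → u := (u :+ v) :- v) refl (toℚ (ℤ.- z)) (toℚ z) ⟩
        (toℚ (ℤ.- z) ℚ.+ toℚ z) ℚ.- toℚ z   ≡⟨ cong (ℚ._- toℚ z) (toℚ-+ (ℤ.- z) z) ⟨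
        toℚ (ℤ.- z ℤ.+ z) ℚ.- toℚ z         ≡⟨ cong (λ u → toℚ u ℚ.- toℚ z) (ℤ.+-inverseˡ z) ⟩
        0ℚ ℚ.- toℚ z                        ≡⟨ ℚ.+-identityˡ _ ⟩
        ℚ.- toℚ z                           ∎
      two : toℚ (+ a) ℚ.+ 1ℚ ℚ.+ 1ℚ ≡ M
      two = trans (ℚ.+-assoc (toℚ (+ a)) 1ℚ 1ℚ) (sym (toℚ-+ (+ a) (+ 2)))
      a+1≤M : toℚ (+ a) ℚ.+ 1ℚ ℚ.≤ M
      a+1≤M = begin
        toℚ (+ a) ℚ.+ 1ℚ              ≡⟨ ℚ.+-identityʳ _ ⟨
        toℚ (+ a) ℚ.+ 1ℚ ℚ.+ 0ℚ       ≤⟨ ℚ.+-monoʳ-≤ (toℚ (+ a) ℚ.+ 1ℚ) {0ℚ} {1ℚ} (ℚ.*≤* (ℤ.+≤+ ℕ.z≤n)) ⟩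
        toℚ (+ a) ℚ.+ 1ℚ ℚ.+ 1ℚ       ≡⟨ two ⟩
        M                             ∎
      above : ∀ i → N ℕ.≤ i → seq x i ℚ.+ 1ℚ ℚ.≤ M
      above i i≥ = begin
        seq x i ℚ.+ 1ℚ                ≤⟨ ℚ.+-monoˡ-≤ 1ℚ (∣-∣⇒≤ˡ (seq x i) (seq x N) (p i i≥)) ⟩
        seq x N ℚ.+ 1ℚ ℚ.+ 1ℚ         ≤⟨ ℚ.+-monoˡ-≤ 1ℚ (ℚ.+-monoˡ-≤ 1ℚ (ℚ.≤-trans (p≤∣p∣ _) (∣p∣≤numerator (seq x N)))) ⟩
        toℚ (+ a) ℚ.+ 1ℚ ℚ.+ 1ℚ       ≡⟨ two ⟩
        M                             ∎
      below : ∀ i → N ℕ.≤ i → ℚ.- M ℚ.≤ seq x i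
      below i i≥ = begin
        ℚ.- M                                    ≡⟨ ℚ.+-identityʳ _ ⟨
        ℚ.- M ℚ.+ 0ℚ                             ≡⟨ cong (ℚ.- M ℚ.+_) (ℚ.+-inverseʳ (seq x N)) ⟨
        ℚ.- M ℚ.+ (seq x N ℚ.- seq x N)          ≤⟨ ℚ.+-monoʳ-≤ (ℚ.- M) (ℚ.+-mono-≤ (∣-∣⇒≤ʳ (seq x i) (seq x N) (p i i≥)) (ℚ.≤-trans (p≤∣p∣ _) (ℚ.≤-reflexive (ℚ.∣-p∣≡∣p∣ (seq x N))))) ⟩
        ℚ.- M ℚ.+ (seq x i ℚ.+ 1ℚ ℚ.+ ℚ.∣ seq x N ∣)  ≤⟨ ℚ.+-monoʳ-≤ (ℚ.- M) (ℚ.+-monoʳ-≤ (seq x i ℚ.+ 1ℚ) (∣p∣≤numerator (seq x N))) ⟩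
        ℚ.- M ℚ.+ (seq x i ℚ.+ 1ℚ ℚ.+ toℚ (+ a))      ≤⟨ ℚ.+-monoˡ-≤ _ (ℚ.neg-antimono-≤ a+1≤M) ⟩
        ℚ.- (toℚ (+ a) ℚ.+ 1ℚ) ℚ.+ (seq x i ℚ.+ 1ℚ ℚ.+ toℚ (+ a))  ≡⟨ shift (seq x i) (toℚ (+ a)) ⟩
        seq x i                                  ∎

  module Classical (em : ExcludedMiddle 0ℓ) where

    ≤⊎> : ∀ x y → x ≤ y ⊎ y < x
    ≤⊎> x y with em {y < x}
    ... | yes y<x = inj₂ y<x
    ... | no y≮x = inj₁ (≮⇒≥ {x} {y} y≮x)

    ≰⇒> : ∀ {x y} → ¬ (x ≤ y) → y < x
    ≰⇒> {x} {y} x≰y with ≤⊎> x y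
    ... | inj₁ x≤y = ⊥-elim (x≰y x≤y)
    ... | inj₂ y<x = y<x

    ≤-<-trans : ∀ {x y z} → x ≤ y → y < z → x < z
    ≤-<-trans {x} {y} {z} x≤y y<z = ≰⇒> {z} {x} λ z≤x → <⇒≱ {y} {z} y<z (≤-trans {z} {x} {y} z≤x x≤y)

    <-≤-trans : ∀ {x y z} → x < y → y ≤ z → x < z
    <-≤-trans {x} {y} {z} x<y y≤z = ≰⇒> {z} {x} λ z≤x → <⇒≱ {x} {y} x<y (≤-trans {y} {z} {x} y≤z z≤x)

    -- A linear search through the unit intervals between `- m` and `m`; excluded middle decides at
    -- each integer on which side `x` lies.
    floor : ∀ x → ∃[ z ] (fromℤ z ≤ x × x < fromℤ (ℤ.suc z))
    floor x = let m , lo , hi = bounded x in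
      search (m ℕ.+ m) (ℤ.- (+ m)) lo
        (subst (λ k → x < fromℤ k) (sym (trans (sym (ℤ.+-assoc (ℤ.- + m) (+ m) (+ m))) (trans (cong (ℤ._+ (+ m)) (ℤ.+-inverseˡ (+ m))) (ℤ.+-identityˡ (+ m))))) hi)
      where
      search : ∀ k a → fromℤ a ≤ x → x < fromℤ (a ℤ.+ (+ k)) →
               ∃[ z ] (fromℤ z ≤ x × x < fromℤ (ℤ.suc z))
      search zero a lo hi = ⊥-elim (<⇒≱ {x} {fromℤ (a ℤ.+ 0ℤ)} hi
        (subst (λ z → fromℤ z ≤ x) (sym (ℤ.+-identityʳ a)) lo))
      search (suc k) a lo hi with ≤⊎> (fromℤ (ℤ.suc a)) x
      ... | inj₁ lo′ = search k (ℤ.suc a) lo′ (subst (λ z → x < fromℤ z)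
              (trans (sym (ℤ.+-assoc a 1ℤ (+ k))) (cong (ℤ._+ (+ k)) (ℤ.+-comm a 1ℤ))) hi)
      ... | inj₂ x<  = a , lo , x<

-- Algebras of finite unions, and elimination of a variable in a total order

module FiniteUnions where

  private
    variable
      c k : Level
      X Y : Set

  record UnionClosed {X : Set} (C : Pred X 0ℓ → Set c) : Set (c ⊔ lsuc 0ℓ) where
    field
      resp  : ∀ {S T} → S ≐ T → C S → C T
      empty : C ∅
      union : ∀ {S T} → C S → C T → C (S ∪ T)

    unions : ∀ {I : Set} (P : I → Pred X 0ℓ) → (∀ i → C (P i)) →
             ∀ is → C (λ x → Any (λ i → P i x) is)
    unions P CP []       = resp ((λ ()) , λ ()) empty
    unions P CP (i ∷ is) = resp ([ here , there ]′ , Any.toSum) (union (CP i) (unions P CP is))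

  record SetAlgebra {X : Set} (C : Pred X 0ℓ → Set c) : Set (c ⊔ lsuc 0ℓ) where
    field
      unionClosed : UnionClosed C
      inter       : ∀ {S T} → C S → C T → C (S ∩ T)
      compl       : ∀ {S} → C S → C (∁ S)
    open UnionClosed unionClosed public

    full : C U
    full = resp ((λ _ → tt) , λ _ ()) (compl empty)

    inters : ∀ {I : Set} (P : I → Pred X 0ℓ) {is} → All (λ i → C (P i)) is →
             C (λ x → All (λ i → P i x) is)
    inters P []         = resp ((λ _ → []) , λ _ → tt) full
    inters P (CP ∷ CPs) = resp ((λ (p , ps) → p ∷ ps) , All.uncons) (inter CP (inters P CPs))

  -- What `bind` needs in order to reduce a set operation to single pieces. Inclusions suffice: the
  -- reverse of `cup` follows from `mono`, and that of `nil` is trivial.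
  record Additive {X Y : Set} (F : Pred X 0ℓ → Pred Y 0ℓ) : Set (lsuc 0ℓ) where
    field
      mono : ∀ {S T} → S ⊆ T → F S ⊆ F T
      nil  : F ∅ ⊆ ∅
      cup  : ∀ {S T} → F (S ∪ T) ⊆ F S ∪ F T

  -- A tree of unions in which every `join` absorbs a set equality, so the pieces carry no indices.
  -- The constructor `none` is separate because `K` need not contain the empty set: linear sets, for
  -- example, are never empty.
  data FinUnion {X : Set} (K : Pred X 0ℓ → Set k) (S : Pred X 0ℓ) : Set (k ⊔ lsuc 0ℓ) where
    one  : K S → FinUnion K S
    none : (∀ x → ¬ S x) → FinUnion K S
    join : ∀ {P Q} → FinUnion K P → FinUnion K Q → S ≐ P ∪ Q → FinUnion K S

  bind : ∀ {K : Pred X 0ℓ → Set k} {C : Pred Y 0ℓ → Set c} {F : Pred X 0ℓ → Pred Y 0ℓ} →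
         UnionClosed C → Additive F → (∀ {P} → K P → C (F P)) → ∀ {S} → FinUnion K S → C (F S)
  bind {X = X} {Y = Y} {C = C} {F = F} closed additive f = go
    where
    open UnionClosed closed
    open Additive additive
    go : ∀ {S} → FinUnion _ S → C (F S)
    go (one KS)               = f KS
    go (none ¬S)              = resp ((λ ()) , ⊥-elim ∘ nil ∘ mono (λ {x} → ¬S x)) empty
    go (join FP FQ (S⊆ , ⊆S)) = resp
      ([ mono (⊆S ∘ inj₁) , mono (⊆S ∘ inj₂) ]′ , cup ∘ mono S⊆) (union (go FP) (go FQ))

  module _ {K : Pred X 0ℓ → Set k} (K-resp : ∀ {S T} → S ≐ T → K S → K T) where

    FinUnion-unionClosed : UnionClosed (FinUnion K)
    FinUnion-unionClosed = record
      { resp  = FinUnion-resp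
      ; empty = none (λ _ ())
      ; union = λ FS FT → join FS FT (id , id)
      }
      where
      FinUnion-resp : ∀ {S T} → S ≐ T → FinUnion K S → FinUnion K T
      FinUnion-resp S≐T (one KS) = one (K-resp S≐T KS)
      FinUnion-resp (S⊆T , T⊆S) (none ¬S) = none (λ x → ¬S x ∘ T⊆S)
      FinUnion-resp (S⊆T , T⊆S) (join FP FQ (S⊆ , ⊆S)) = join FP FQ (S⊆ ∘ T⊆S , S⊆T ∘ ⊆S)

    module _ (K-inter : ∀ {S T} → K S → K T → FinUnion K (S ∩ T))
             (K-compl : ∀ {S} → K S → FinUnion K (∁ S))
             (K-full : FinUnion K U) where

      open UnionClosed FinUnion-unionClosed

      -- Intersection is additive in either argument, so two nested uses of `bind` leave only
      -- intersections of two pieces.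
      FinUnion-inter : ∀ {S T} → FinUnion K S → FinUnion K T → FinUnion K (S ∩ T)
      FinUnion-inter FS FT = bind FinUnion-unionClosed
        (record { mono = λ S⊆T (s , t) → S⊆T s , t
                ; nil = λ ()
                ; cup = λ { (inj₁ s , t) → inj₁ (s , t) ; (inj₂ s , t) → inj₂ (s , t) } })
        (λ KS → bind FinUnion-unionClosed
          (record { mono = λ S⊆T (s , t) → s , S⊆T t
                  ; nil = λ ()
                  ; cup = λ { (s , inj₁ t) → inj₁ (s , t) ; (s , inj₂ t) → inj₂ (s , t) } })
          (K-inter KS) FT) FS

      FinUnion-compl : ∀ {S} → FinUnion K S → FinUnion K (∁ S)
      FinUnion-compl (one KS) = K-compl KS
      FinUnion-compl (none ¬S) = resp ((λ {x} _ → ¬S x) , λ _ → tt) K-full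
      FinUnion-compl (join FP FQ (S⊆ , ⊆S)) = resp
        ((λ (¬p , ¬q) → [ ¬p , ¬q ]′ ∘ S⊆) , λ ¬s → ¬s ∘ ⊆S ∘ inj₁ , ¬s ∘ ⊆S ∘ inj₂)
        (FinUnion-inter (FinUnion-compl FP) (FinUnion-compl FQ))

      FinUnion-algebra : SetAlgebra (FinUnion K)
      FinUnion-algebra = record { unionClosed = FinUnion-unionClosed ; inter = FinUnion-inter ; compl = FinUnion-compl }

  module Polyhedra {H : Set} (⟦_⟧ : H → Pred X 0ℓ) where

    Poly : Pred X 0ℓ → Set
    Poly S = Σ[ hs ∈ List H ] S ≐ (λ x → All (λ h → ⟦ h ⟧ x) hs)

    Poly-resp : ∀ {S T} → S ≐ T → Poly S → Poly T
    Poly-resp (S⊆T , T⊆S) (hs , S⊆ , ⊆S) = hs , S⊆ ∘ T⊆S , S⊆T ∘ ⊆S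

    half : ∀ h → FinUnion Poly ⟦ h ⟧
    half h = one (h ∷ [] , (_∷ []) , All.head)

    module _ (em : ExcludedMiddle 0ℓ) (opposite : ∀ h → Σ[ h′ ∈ H ] ∁ ⟦ h ⟧ ≐ ⟦ h′ ⟧) where

      private
        -- A conjunction fails at its head or in its tail. The two parts may overlap; excluded
        -- middle at the head picks one of them.
        K-compl : ∀ hs → FinUnion Poly (∁ (λ x → All (λ h → ⟦ h ⟧ x) hs))
        K-compl [] = none (λ _ ¬[] → ¬[] [])
        K-compl (h ∷ hs) = let h′ , ⊆h′ , h′⊆ = opposite h in
          join (half h′) (K-compl hs)
            ( (λ {x} ¬hhs → case-em x ¬hhs)
            , [ (λ h′x → h′⊆ h′x ∘ All.head) , (λ ¬hs → ¬hs ∘ All.tail) ]′ )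
          where
          case-em : ∀ x → ¬ All (λ h → ⟦ h ⟧ x) (h ∷ hs) →
                    ⟦ proj₁ (opposite h) ⟧ x ⊎ ¬ All (λ h → ⟦ h ⟧ x) hs
          case-em x ¬hhs with em {⟦ h ⟧ x}
          ... | yes hx = inj₂ (λ hsx → ¬hhs (hx ∷ hsx))
          ... | no ¬hx = inj₁ (proj₁ (proj₂ (opposite h)) ¬hx)

      FinUnion-Poly-algebra : SetAlgebra (FinUnion Poly)
      FinUnion-Poly-algebra = FinUnion-algebra Poly-resp
        (λ (hs , S⊆ , ⊆S) (hs′ , T⊆ , ⊆T) → one
          ( hs ++ hs′
          , (λ (s , t) → All.++⁺ (S⊆ s) (T⊆ t))
          , λ all → ⊆S (All.++⁻ˡ hs all) , ⊆T (All.++⁻ʳ hs all) ))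
        (λ (hs , S⊆ , ⊆S) → UnionClosed.resp (FinUnion-unionClosed Poly-resp)
          ((λ ¬all → ¬all ∘ S⊆) , λ ¬s → ¬s ∘ ⊆S) (K-compl hs))
        (one ([] , (λ _ → []) , λ _ → tt))

  module Helly (em : ExcludedMiddle 0ℓ) {T : Set} (_≤_ : T → T → Set)
               (total : ∀ x y → x ≤ y ⊎ y ≤ x) where

    UpClosed DownClosed : Pred T 0ℓ → Set
    UpClosed P   = ∀ x y → x ≤ y → P x → P y
    DownClosed P = ∀ x y → x ≤ y → P y → P x

    private
      -- Monotone sets in a total order form a chain. `exchange` says that a point of `P` outside
      -- `Q` forces all of `Q` into `P`; for monotone sets it follows by comparing that point with
      -- the given element of `Q`.
      ⊆-total : ∀ {P Q : Pred T 0ℓ} → (∀ x y → P x → ¬ Q x → Q y → P y) → P ⊆ Q ⊎ Q ⊆ P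
      ⊆-total {P} {Q} exchange with em {∃[ x ] (P x × ¬ Q x)}
      ... | yes (x , p , ¬q) = inj₂ (λ {y} → exchange x y p ¬q)
      ... | no ¬∃ = inj₁ (λ {x} → by-em x)
        where
        by-em : ∀ x → P x → Q x
        by-em x p with em {Q x}
        ... | yes q = q
        ... | no ¬q = ⊥-elim (¬∃ (x , p , ¬q))

      ⊆-total-up : ∀ {P Q} → UpClosed P → UpClosed Q → P ⊆ Q ⊎ Q ⊆ P
      ⊆-total-up {P} {Q} upP upQ = ⊆-total {P} {Q} λ x y p ¬q q →
        [ (λ x≤y → upP x y x≤y p) , (λ y≤x → ⊥-elim (¬q (upQ y x y≤x q))) ]′ (total x y)

      ⊆-total-down : ∀ {P Q} → DownClosed P → DownClosed Q → P ⊆ Q ⊎ Q ⊆ P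
      ⊆-total-down {P} {Q} downP downQ = ⊆-total {P} {Q} λ x y p ¬q q →
        [ (λ x≤y → ⊥-elim (¬q (downQ x y x≤y q))) , (λ y≤x → downP y x y≤x p) ]′ (total x y)

    module _ {A : Set} (F : A → Pred T 0ℓ) where

      private
        -- A finite chain under inclusion has a least member. `C` carries the monotonicity on which
        -- comparability depends.
        least : {C : A → Set} → (∀ {a b} → C a → C b → F a ⊆ F b ⊎ F b ⊆ F a) →
                ∀ a as → All C (a ∷ as) →
                ∃[ m ] (m List∈.∈ (a ∷ as) × All (λ b → ∀ t → F m t → F b t) (a ∷ as))
        least cmp a [] _ = a , here refl , (λ _ → id) ∷ []
        least cmp a (b ∷ bs) (Ca ∷ Cs) with least cmp b bs Cs
        ... | m , m∈ , m⊆ with cmp Ca (All.lookup Cs m∈)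
        ...   | inj₁ a⊆m = a , here refl , (λ _ → id) ∷ All.map (λ m⊆b t → m⊆b t ∘ a⊆m) m⊆
        ...   | inj₂ m⊆a = m , there m∈ , (λ _ → m⊆a) ∷ m⊆

      -- The least up-closed set lies inside all other up-closed ones, and likewise for the
      -- down-closed sets, so a common point of the two least sets is common to all. Nonemptiness of
      -- single sets serves the cases where one list is empty, and `t₀` the case where both are.
      helly : T → ∀ us ds → All (UpClosed ∘ F) us → All (DownClosed ∘ F) ds →
              All (λ u → ∃[ t ] F u t) us → All (λ d → ∃[ t ] F d t) ds →
              All (λ u → All (λ d → ∃[ t ] (F u t × F d t)) ds) us →
              ∃[ t ] (All (λ u → F u t) us × All (λ d → F d t) ds)
      helly t₀ [] [] _ _ _ _ _ = t₀ , [] , []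
      helly t₀ (u ∷ us) [] ups _ neU _ _ =
        let m , m∈ , m⊆ = least ⊆-total-up u us ups
            t , Ft = All.lookup neU m∈
        in t , All.map (λ m⊆b → m⊆b t Ft) m⊆ , []
      helly t₀ [] (d ∷ ds) _ downs _ neD _ =
        let m , m∈ , m⊆ = least ⊆-total-down d ds downs
            t , Ft = All.lookup neD m∈
        in t , [] , All.map (λ m⊆b → m⊆b t Ft) m⊆
      helly t₀ (u ∷ us) (d ∷ ds) ups downs _ _ pairs =
        let m , m∈ , m⊆ = least ⊆-total-up u us ups
            m′ , m′∈ , m′⊆ = least ⊆-total-down d ds downs
            t , Ft , Ft′ = All.lookup (All.lookup pairs m∈) m′∈
        in t , All.map (λ m⊆b → m⊆b t Ft) m⊆ , All.map (λ m⊆b → m⊆b t Ft′) m′⊆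

  module Elimination (em : ExcludedMiddle 0ℓ) {T X H H′ : Set} (_≤_ : T → T → Set)
    (total : ∀ x y → x ≤ y ⊎ y ≤ x) (t₀ : T)
    (⟦_⟧ : H → T → X → Set) (⟦_⟧′ : H′ → Pred X 0ℓ) (Up Down : H → Set) where

    open Helly em _≤_ total

    data Kind (h : H) : Set where
      free : ∀ h′ → (∀ t x → ⟦ h ⟧ t x → ⟦ h′ ⟧′ x) → (∀ t x → ⟦ h′ ⟧′ x → ⟦ h ⟧ t x) → Kind h
      up   : Up h → Kind h
      down : Down h → Kind h

    private
      record Sorted (hs : List H) : Set where
        field
          frees     : List H′
          ups downs : List H
          all-up    : All Up ups
          all-down  : All Down downs
          split     : ∀ t x → All (λ h → ⟦ h ⟧ t x) hs →
                      All (λ h → ⟦ h ⟧′ x) frees × All (λ h → ⟦ h ⟧ t x) ups × All (λ h → ⟦ h ⟧ t x) downs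
          merge     : ∀ t x → All (λ h → ⟦ h ⟧′ x) frees → All (λ h → ⟦ h ⟧ t x) ups →
                      All (λ h → ⟦ h ⟧ t x) downs → All (λ h → ⟦ h ⟧ t x) hs

      sort : (∀ h → Kind h) → ∀ hs → Sorted hs
      sort kind [] = record
        { frees = [] ; ups = [] ; downs = [] ; all-up = [] ; all-down = []
        ; split = λ _ _ _ → [] , [] , [] ; merge = λ _ _ _ _ _ → [] }
      sort kind (h ∷ hs) with sort kind hs | kind h
      ... | s | free h′ to from = record
        { frees = h′ ∷ frees ; ups = ups ; downs = downs ; all-up = all-up ; all-down = all-down
        ; split = λ { t x (p ∷ ps) → let fs , us , ds = split t x ps in to t x p ∷ fs , us , ds }
        ; merge = λ { t x (f ∷ fs) us ds → from t x f ∷ merge t x fs us ds } }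
        where open Sorted s
      ... | s | up Uh = record
        { frees = frees ; ups = h ∷ ups ; downs = downs ; all-up = Uh ∷ all-up ; all-down = all-down
        ; split = λ { t x (p ∷ ps) → let fs , us , ds = split t x ps in fs , p ∷ us , ds }
        ; merge = λ { t x fs (u ∷ us) ds → u ∷ merge t x fs us ds } }
        where open Sorted s
      ... | s | down Dh = record
        { frees = frees ; ups = ups ; downs = h ∷ downs ; all-up = all-up ; all-down = Dh ∷ all-down
        ; split = λ { t x (p ∷ ps) → let fs , us , ds = split t x ps in fs , us , p ∷ ds }
        ; merge = λ { t x fs us (d ∷ ds) → d ∷ merge t x fs us ds } }
        where open Sorted s

    -- By `helly`, a common solution `t` exists as soon as every lower bound is compatible with
    -- every upper bound. The elimination proper is thus left to `pair`, which treats two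
    -- constraints, and the answer lives in the class `C`: unions of polyhedra over ℝ, `Presburger`
    -- sets over ℤ.
    eliminate :
      ∀ {C : Pred X 0ℓ → Set c} → SetAlgebra C → (∀ h → C ⟦ h ⟧′) → (∀ h → Kind h) →
      (∀ {h} → Up h → ∀ x → UpClosed (λ t → ⟦ h ⟧ t x) × ∃[ t ] ⟦ h ⟧ t x) →
      (∀ {h} → Down h → ∀ x → DownClosed (λ t → ⟦ h ⟧ t x) × ∃[ t ] ⟦ h ⟧ t x) →
      (∀ {u d} → Up u → Down d → C (λ x → ∃[ t ] (⟦ u ⟧ t x × ⟦ d ⟧ t x))) →
      ∀ hs → C (λ x → ∃[ t ] All (λ h → ⟦ h ⟧ t x) hs)
    eliminate algebra C-free kind up-spec down-spec pair hs = resp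
      ( (λ { {x} (fs , prs) →
           let t , us , ds = helly (λ h t → ⟦ h ⟧ t x) t₀ ups downs
                 (All.map (λ U → proj₁ (up-spec U x)) all-up)
                 (All.map (λ D → proj₁ (down-spec D x)) all-down)
                 (All.map (λ U → proj₂ (up-spec U x)) all-up)
                 (All.map (λ D → proj₂ (down-spec D x)) all-down) prs
           in t , merge t x fs us ds })
      , (λ { {x} (t , all) →
           let fs , us , ds = split t x all
           in fs , All.map (λ u → All.map (λ d → t , u , d) ds) us }) )
      (inter (inters ⟦_⟧′ (All.universal C-free frees))
        (inters (λ u x → All (λ d → ∃[ t ] (⟦ u ⟧ t x × ⟦ d ⟧ t x)) downs)
          (All.map (λ {u} U → inters (λ d x → ∃[ t ] (⟦ u ⟧ t x × ⟦ d ⟧ t x))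
            (All.map (pair U) all-down)) all-up)))
      where
      open SetAlgebra algebra
      open Sorted (sort kind hs)

-- Integer polyhedra on residue classes, closed under Boolean operations and projection

module IntegerSets where

  open Defs using (_+ᶻ_; 0ᶻ; Term; var; _⊕_)
  open FiniteUnions

  private
    variable
      n : ℕ

  module Dot (R : CommutativeRing 0ℓ 0ℓ) where
    open CommutativeRing R renaming (Carrier to A; refl to ≈-refl; sym to ≈-sym; trans to ≈-trans)
    open CSemigroup +-commutativeSemigroup using (interchange)
    open CSemigroup *-commutativeSemigroup using (x∙yz≈y∙xz)

    dot : Vec A n → Vec A n → A
    dot []       []       = 0#
    dot (a ∷ as) (x ∷ xs) = a * x + dot as xs

    dot-+ˡ : ∀ (a b x : Vec A n) → dot (Vec.zipWith _+_ a b) x ≈ dot a x + dot b x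
    dot-+ˡ []       []       []       = ≈-sym (+-identityˡ 0#)
    dot-+ˡ (a ∷ as) (b ∷ bs) (x ∷ xs) = ≈-trans (+-cong (distribʳ x a b) (dot-+ˡ as bs xs))
      (interchange (a * x) (b * x) (dot as xs) (dot bs xs))

    dot-+ʳ : ∀ (a x y : Vec A n) → dot a (Vec.zipWith _+_ x y) ≈ dot a x + dot a y
    dot-+ʳ []       []       []       = ≈-sym (+-identityˡ 0#)
    dot-+ʳ (a ∷ as) (x ∷ xs) (y ∷ ys) = ≈-trans (+-cong (distribˡ a x y) (dot-+ʳ as xs ys))
      (interchange (a * x) (a * y) (dot as xs) (dot as ys))

    dot-*ˡ : ∀ k (a x : Vec A n) → dot (Vec.map (k *_) a) x ≈ k * dot a x
    dot-*ˡ k []       []       = ≈-sym (zeroʳ k)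
    dot-*ˡ k (a ∷ as) (x ∷ xs) = ≈-trans (+-cong (*-assoc k a x) (dot-*ˡ k as xs))
      (≈-sym (distribˡ k (a * x) (dot as xs)))

    dot-*ʳ : ∀ k (a x : Vec A n) → dot a (Vec.map (k *_) x) ≈ k * dot a x
    dot-*ʳ k []       []       = ≈-sym (zeroʳ k)
    dot-*ʳ k (a ∷ as) (x ∷ xs) = ≈-trans (+-cong (x∙yz≈y∙xz a k x) (dot-*ʳ k as xs))
      (≈-sym (distribˡ k (a * x) (dot as xs)))

    dot-0ˡ : ∀ (x : Vec A n) → dot (Vec.replicate _ 0#) x ≈ 0#
    dot-0ˡ []       = ≈-refl
    dot-0ˡ (x ∷ xs) = ≈-trans (+-cong (zeroˡ x) (dot-0ˡ xs)) (+-identityˡ 0#)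

    dot-0ʳ : ∀ (a : Vec A n) → dot a (Vec.replicate _ 0#) ≈ 0#
    dot-0ʳ []       = ≈-refl
    dot-0ʳ (a ∷ as) = ≈-trans (+-cong (zeroʳ a) (dot-0ʳ as)) (+-identityˡ 0#)

    unit : Fin n → Vec A n
    unit zero    = 1# ∷ Vec.replicate _ 0#
    unit (suc i) = 0# ∷ unit i

    dot-unit : ∀ i (x : Vec A n) → dot (unit i) x ≈ Vec.lookup x i
    dot-unit zero    (x ∷ xs) = ≈-trans (+-cong (*-identityˡ x) (dot-0ˡ xs)) (+-identityʳ x)
    dot-unit (suc i) (x ∷ xs) = ≈-trans (+-cong (zeroˡ x) (dot-unit i xs)) (+-identityˡ (Vec.lookup xs i))

    coefficients : Term n → Vec A n
    coefficients (var i) = unit i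
    coefficients (s ⊕ t) = Vec.zipWith _+_ (coefficients s) (coefficients t)

    evaluate : Term n → Vec A n → A
    evaluate (var i) x = Vec.lookup x i
    evaluate (s ⊕ t) x = evaluate s x + evaluate t x

    dot-coefficients : ∀ (t : Term n) x → dot (coefficients t) x ≈ evaluate t x
    dot-coefficients (var i) x = dot-unit i x
    dot-coefficients (s ⊕ t) x = ≈-trans (dot-+ˡ (coefficients s) (coefficients t) x)
      (+-cong (dot-coefficients s x) (dot-coefficients t x))

  vectors : ∀ {A : Set} → List A → ∀ n → List (Vec A n)
  vectors xs zero    = [] ∷ []
  vectors xs (suc n) = List.cartesianProductWith _∷_ xs (vectors xs n)

  ∈-vectors : ∀ {A : Set} {xs : List A} {v : Vec A n} → Vecᴬ.All (List∈._∈ xs) v → v List∈.∈ vectors xs n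
  ∈-vectors Vecᴬ.[]       = here refl
  ∈-vectors (p Vecᴬ.∷ ps) = List∈.∈-cartesianProductWith⁺ _∷_ p (∈-vectors ps)

  open Dot ℤ.+-*-commutativeRing public

  infixl 7 _*ᶻ_
  _*ᶻ_ : ℤ → Vec ℤ n → Vec ℤ n
  k *ᶻ w = Vec.map (k ℤ.*_) w

  module _ where
    open Data.Integer.Solver.+-*-Solver

    -- A residue class modulo `M * k` is a class modulo `k` seen inside a class modulo `M`; this
    -- identity is what allows moduli to be multiplied.
    rescale : ∀ (r s : Vec ℤ n) M k w → r +ᶻ M *ᶻ (s +ᶻ k *ᶻ w) ≡ (r +ᶻ M *ᶻ s) +ᶻ (M ℤ.* k) *ᶻ w
    rescale []       []       M k []       = refl
    rescale (r ∷ rs) (s ∷ ss) M k (w ∷ ws) = cong₂ _∷_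
      (solve 5 (λ r s M k w → r :+ M :* (s :+ k :* w) := (r :+ M :* s) :+ (M :* k) :* w) refl r s M k w)
      (rescale rs ss M k ws)

    +ᶻ-assoc-scaled : ∀ (r s : Vec ℤ n) M w → (r +ᶻ M *ᶻ s) +ᶻ M *ᶻ w ≡ r +ᶻ M *ᶻ (s +ᶻ w)
    +ᶻ-assoc-scaled []       []       M []       = refl
    +ᶻ-assoc-scaled (r ∷ rs) (s ∷ ss) M (w ∷ ws) = cong₂ _∷_
      (solve 4 (λ r s M w → (r :+ M :* s) :+ M :* w := r :+ M :* (s :+ w)) refl r s M w)
      (+ᶻ-assoc-scaled rs ss M ws)

    0+1*ᶻ : ∀ (w : Vec ℤ n) → 0ᶻ +ᶻ 1ℤ *ᶻ w ≡ w
    0+1*ᶻ []       = refl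
    0+1*ᶻ (w ∷ ws) = cong₂ _∷_ (trans (ℤ.+-identityˡ _) (ℤ.*-identityˡ w)) (0+1*ᶻ ws)

  dot-affine : ∀ (a r : Vec ℤ n) M w → dot a (r +ᶻ M *ᶻ w) ≡ dot a r ℤ.+ M ℤ.* dot a w
  dot-affine a r M w = trans (dot-+ʳ a r (M *ᶻ w)) (cong (λ u → dot a r ℤ.+ u) (dot-*ʳ M a w))

  pos⇒nonZero : ∀ i .{{_ : ℤ.Positive i}} → ℤ.NonZero i
  pos⇒nonZero ℤ.+[1+ _ ] = _

  residues : ℤ → ∀ n → List (Vec ℤ n)
  residues M = vectors (List.map (λ k → + k) (List.upTo ℤ.∣ M ∣))

  residue : ∀ M .{{_ : ℤ.Positive M}} → (z : Vec ℤ n) →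
            ∃[ r ] ∃[ q ] (r List∈.∈ residues M n × z ≡ r +ᶻ M *ᶻ q)
  residue M z = let r , q , r∈ , z≡ = go z in r , q , ∈-vectors r∈ , z≡
    where
    instance
      M-nonZero : ℤ.NonZero M
      M-nonZero = pos⇒nonZero M
    go : (z : Vec ℤ n) → ∃[ r ] ∃[ q ]
         (Vecᴬ.All (List∈._∈ List.map (λ k → + k) (List.upTo ℤ.∣ M ∣)) r × z ≡ r +ᶻ M *ᶻ q)
    go []       = [] , [] , Vecᴬ.[] , refl
    go (z ∷ zs) = let r , q , r∈ , zs≡ = go zs in
      + (z ℤ.% M) ∷ r , (z ℤ./ M) ∷ q ,
      List∈.∈-map⁺ (λ k → + k) (List∈.∈-upTo⁺ (ℤ.n%d<d z M)) Vecᴬ.∷ r∈ ,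
      cong₂ _∷_ (trans (ℤ.a≡a%n+[a/n]*n z M) (cong (λ u → + (z ℤ.% M) ℤ.+ u) (ℤ.*-comm (z ℤ./ M) M))) zs≡

  Half : ℕ → Set
  Half n = Vec ℤ n × ℤ

  ⟦_⟧ : Half n → Pred (Vec ℤ n) 0ℓ
  ⟦ a , b ⟧ z = 0ℤ ℤ.≤ dot a z ℤ.+ b

  open module ZPoly {n} = Polyhedra {X = Vec ℤ n} {H = Half n} ⟦_⟧ public using (Poly; Poly-resp; half; FinUnion-Poly-algebra)

  ≐-≗ : ∀ {X Y : Set} {S : Pred Y 0ℓ} {f g : X → Y} → (∀ x → f x ≡ g x) → (S ∘ f) ≐ (S ∘ g)
  ≐-≗ {S = S} e = (λ {x} → subst S (e x)) , (λ {x} → subst S (sym (e x)))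

  preimage-additive : ∀ {X Y : Set} (f : X → Y) → Additive (λ S → S ∘ f)
  preimage-additive f = record { mono = λ S⊆T → S⊆T ; nil = id ; cup = id }

  projection-additive : ∀ {T X Y : Set} (f : T → X → Y) → Additive (λ S x → ∃[ t ] S (f t x))
  projection-additive f = record
    { mono = λ S⊆T (t , s) → t , S⊆T s
    ; nil  = λ ()
    ; cup  = λ { (t , inj₁ s) → inj₁ (t , s) ; (t , inj₂ s) → inj₂ (t , s) } }

  affine-preimage : ∀ (r : Vec ℤ n) k {S} → FinUnion Poly S → FinUnion Poly (λ w → S (r +ᶻ k *ᶻ w))
  affine-preimage r k = bind (FinUnion-unionClosed Poly-resp) (preimage-additive (λ w → r +ᶻ k *ᶻ w))
    λ (hs , S⊆ , ⊆S) → one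
      ( List.map pull hs
      , (λ s → All.map⁺ (All.map (λ {h} → proj₁ (pulled h _)) (S⊆ s)))
      , (λ all → ⊆S (All.map (λ {h} → proj₂ (pulled h _)) (All.map⁻ all))) )
    where
    pull : Half _ → Half _
    pull (a , b) = k *ᶻ a , dot a r ℤ.+ b
    value : ∀ a b w → dot a (r +ᶻ k *ᶻ w) ℤ.+ b ≡ dot (k *ᶻ a) w ℤ.+ (dot a r ℤ.+ b)
    value a b w rewrite dot-affine a r k w | dot-*ˡ k a w =
      trans (cong (ℤ._+ b) (ℤ.+-comm (dot a r) _)) (ℤ.+-assoc (k ℤ.* dot a w) (dot a r) b)
    pulled : ∀ h w → (⟦ h ⟧ (r +ᶻ k *ᶻ w) → ⟦ pull h ⟧ w) × (⟦ pull h ⟧ w → ⟦ h ⟧ (r +ᶻ k *ᶻ w))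
    pulled (a , b) w = subst (0ℤ ℤ.≤_) (value a b w) , subst (0ℤ ℤ.≤_) (sym (value a b w))

  -- Congruences are not atoms: divisibility is expressed by the modulus M alone.
  PolyMod : ℤ → Pred (Vec ℤ n) 0ℓ → Set₁
  PolyMod M S = ∀ r → FinUnion Poly (λ w → S (r +ᶻ M *ᶻ w))

  Presburger : Pred (Vec ℤ n) 0ℓ → Set₁
  Presburger S = Σ[ M ∈ ℤ ] ℤ.Positive M × PolyMod M S

  -- `PolyMod` admits every offset `r`, not only residues. Hence the restriction to the finer class
  -- through `r` is the preimage, under scaling by `k`, of the restriction to the coarser class
  -- through the same `r`.
  PolyMod-refine : ∀ {M} {S : Pred (Vec ℤ n) 0ℓ} → PolyMod M S → ∀ k → PolyMod (M ℤ.* k) S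
  PolyMod-refine {M = M} {S} S-mod k r = FinUnion-resp (≐-≗ {S = S} λ w → trans
      (rescale r 0ᶻ M k w) (cong (_+ᶻ (M ℤ.* k) *ᶻ w) (r+M0 r)))
    (affine-preimage 0ᶻ k (S-mod r))
    where
    open UnionClosed (FinUnion-unionClosed Poly-resp) renaming (resp to FinUnion-resp)
    r+M0 : ∀ {n} (r : Vec ℤ n) → r +ᶻ M *ᶻ 0ᶻ ≡ r
    r+M0 []       = refl
    r+M0 (r ∷ rs) = cong₂ _∷_ (trans (cong (λ u → r ℤ.+ u) (ℤ.*-zeroʳ M)) (ℤ.+-identityʳ r)) (r+M0 rs)

  PolyMod-refineʳ : ∀ {M} {S : Pred (Vec ℤ n) 0ℓ} → PolyMod M S → ∀ k → PolyMod (k ℤ.* M) S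
  PolyMod-refineʳ {M = M} {S} S-mod k = subst (λ L → PolyMod L S) (ℤ.*-comm M k) (PolyMod-refine {M = M} {S} S-mod k)

  FinUnion⇒Presburger : {S : Pred (Vec ℤ n) 0ℓ} → FinUnion Poly S → Presburger S
  FinUnion⇒Presburger FS = 1ℤ , _ , λ r → affine-preimage r 1ℤ FS

  open Data.Integer.Solver.+-*-Solver using (solve; _:=_; _:+_; _:*_; _:-_; :-_; con)

  -- Over ℤ the negation of `0 ≤ u` is `0 ≤ -1 - u`, so weak half-spaces alone are closed under
  -- complement.
  opposite : ∀ (h : Half n) → Σ[ h′ ∈ Half n ] ∁ ⟦ h ⟧ ≐ ⟦ h′ ⟧
  opposite (a , b) = (-1ℤ *ᶻ a , -1ℤ ℤ.- b)
    , (λ {z} ¬h → subst (0ℤ ℤ.≤_) (value z) (ℤ.i≤j⇒0≤j-i (ℤ.i<j⇒suc[i]≤j (ℤ.≰⇒> ¬h))))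
    , (λ {z} h′ h → ℤ.≤⇒≯ h (ℤ.suc[i]≤j⇒i<j (ℤ.0≤i-j⇒j≤i (subst (0ℤ ℤ.≤_) (sym (value z)) h′))))
    where
    value : ∀ z → 0ℤ ℤ.- ℤ.suc (dot a z ℤ.+ b) ≡ dot (-1ℤ *ᶻ a) z ℤ.+ (-1ℤ ℤ.- b)
    value z = trans (solve 2 (λ d b → con 0ℤ :- (con 1ℤ :+ (d :+ b)) := con -1ℤ :* d :+ (con -1ℤ :- b)) refl (dot a z) b)
      (cong (ℤ._+ (-1ℤ ℤ.- b)) (sym (dot-*ˡ -1ℤ a z)))

  pos*pos : ∀ i j → ℤ.Positive i → ℤ.Positive j → ℤ.Positive (i ℤ.* j)
  pos*pos ℤ.+[1+ m ] ℤ.+[1+ n ] _ _ = _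

  module _ (em : ExcludedMiddle 0ℓ) where

    private
      module PolyAlgebra {n} = SetAlgebra (FinUnion-Poly-algebra {n} em opposite)

    Presburger-algebra : SetAlgebra (Presburger {n})
    Presburger-algebra = record
      { unionClosed = record
        { resp  = λ (S⊆T , T⊆S) (M , M>0 , S-mod) → M , M>0 , λ r → PolyAlgebra.resp (S⊆T , T⊆S) (S-mod r)
        ; empty = 1ℤ , _ , λ r → PolyAlgebra.empty
        ; union = λ {S} {T} → both {_⋆_ = _⊎_} PolyAlgebra.union {S} {T} }
      ; inter = λ {S} {T} → both {_⋆_ = _×_} PolyAlgebra.inter {S} {T}
      ; compl = λ (M , M>0 , S-mod) → M , M>0 , λ r → PolyAlgebra.compl (S-mod r)
      }
      where
      both : ∀ {_⋆_ : Set → Set → Set} →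
             (∀ {S T : Pred (Vec ℤ n) 0ℓ} → FinUnion Poly S → FinUnion Poly T → FinUnion Poly (λ x → S x ⋆ T x)) →
             ∀ {S T : Pred (Vec ℤ n) 0ℓ} → Presburger S → Presburger T → Presburger (λ x → S x ⋆ T x)
      both op {S} {T} (M , M>0 , S-mod) (L , L>0 , T-mod) = M ℤ.* L , pos*pos M L M>0 L>0 , λ r →
        op (PolyMod-refine {M = M} {S} S-mod L r) (PolyMod-refineʳ {M = L} {T} T-mod M r)

    private
      module PresburgerAlgebra {n} = SetAlgebra (Presburger-algebra {n})

    common-modulus : ∀ {I : Set} (G : I → Pred (Vec ℤ n) 0ℓ) → (∀ i → Presburger (G i)) → ∀ is →
                     Σ[ L ∈ ℤ ] ℤ.Positive L × All (λ i → PolyMod L (G i)) is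
    common-modulus G GP [] = 1ℤ , _ , []
    common-modulus G GP (i ∷ is) =
      let M , M>0 , G-mod = GP i
          L , L>0 , Gs-mod = common-modulus G GP is
      in M ℤ.* L , pos*pos M L M>0 L>0 ,
         PolyMod-refine {M = M} {G i} G-mod L ∷ All.map (λ {j} T-mod → PolyMod-refineʳ {M = L} {G j} T-mod M) Gs-mod

    -- The restrictions to the finitely many residue classes come with different moduli, which are
    -- first replaced by a common `L`. A class modulo `M * L` then lies in one class modulo `M`,
    -- where it is a class modulo `L`.
    Presburger-glue : ∀ M .{{_ : ℤ.Positive M}} {S : Pred (Vec ℤ n) 0ℓ} →
                      (∀ r → Presburger (λ w → S (r +ᶻ M *ᶻ w))) → Presburger S
    Presburger-glue {n} M@(ℤ.+[1+ _ ]) {S} local = M ℤ.* L , pos*pos M L _ L>0 , λ r →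
      let ρ , q , ρ∈ , r≡ = residue M r in
      PolyAlgebra.resp
        (≐-≗ {S = S} λ w → trans (rescale ρ q M L w) (cong (_+ᶻ (M ℤ.* L) *ᶻ w) (sym r≡)))
        (All.lookup mods ρ∈ q)
      where
      common = common-modulus (λ r w → S (r +ᶻ M *ᶻ w)) local (residues M n)
      L = proj₁ common
      L>0 = proj₁ (proj₂ common)
      mods = proj₂ (proj₂ common)

    private
      -- As `a ≥ 1`, the value `∣e∣` already outweighs `e`. This is the witness that a single
      -- constraint on the eliminated variable is solvable.
      ascend : ∀ a e .{{_ : ℤ.Positive a}} → 0ℤ ℤ.≤ a ℤ.* (+ ℤ.∣ e ∣) ℤ.+ e
      ascend a@(ℤ.+[1+ _ ]) e = begin
        0ℤ                           ≤⟨ 0≤∣e∣+e e ⟩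
        + ℤ.∣ e ∣ ℤ.+ e              ≡⟨ cong (ℤ._+ e) (ℤ.*-identityˡ (+ ℤ.∣ e ∣)) ⟨
        1ℤ ℤ.* (+ ℤ.∣ e ∣) ℤ.+ e     ≤⟨ ℤ.+-monoˡ-≤ e (ℤ.*-monoʳ-≤-nonNeg (+ ℤ.∣ e ∣) {1ℤ} {a} (ℤ.+≤+ (ℕ.s≤s ℕ.z≤n))) ⟩
        a ℤ.* (+ ℤ.∣ e ∣) ℤ.+ e      ∎
        where
        open ℤ.≤-Reasoning
        0≤∣e∣+e : ∀ e → 0ℤ ℤ.≤ + ℤ.∣ e ∣ ℤ.+ e
        0≤∣e∣+e (+ _)        = ℤ.+≤+ ℕ.z≤n
        0≤∣e∣+e ℤ.-[1+ k ]   = ℤ.≤-reflexive (sym (ℤ.+-inverseʳ (+ suc k)))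

      Up Down : Half (suc n) → Set
      Up   ((a ∷ _) , _) = ℤ.Positive a
      Down ((a ∷ _) , _) = ℤ.Negative a

      ⟦_⟧₁ : Half (suc n) → ℤ → Vec ℤ n → Set
      ⟦ h ⟧₁ t x = ⟦ h ⟧ (t ∷ x)

    module Elim {n} = Elimination em {X = Vec ℤ n} ℤ._≤_ ℤ.≤-total 0ℤ ⟦_⟧₁ ⟦_⟧ Up Down
    open Elim

    private
      kind : ∀ (h : Half (suc n)) → Kind h
      kind (+ 0 ∷ as , b) = free (as , b)
        (λ t x → subst (λ u → 0ℤ ℤ.≤ u ℤ.+ b) (ℤ.+-identityˡ (dot as x)))
        (λ t x → subst (λ u → 0ℤ ℤ.≤ u ℤ.+ b) (sym (ℤ.+-identityˡ (dot as x))))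
      kind (ℤ.+[1+ _ ] ∷ _ , _) = up _
      kind (ℤ.-[1+ _ ] ∷ _ , _) = down _

      up-spec : ∀ {h : Half (suc n)} → Up h → ∀ x →
                (∀ s t → s ℤ.≤ t → ⟦ h ⟧ (s ∷ x) → ⟦ h ⟧ (t ∷ x)) × ∃[ t ] ⟦ h ⟧ (t ∷ x)
      up-spec {h = a@(ℤ.+[1+ _ ]) ∷ as , b} _ x =
        (λ s t s≤t 0≤ → ℤ.≤-trans 0≤ (ℤ.+-monoˡ-≤ b (ℤ.+-monoˡ-≤ (dot as x) (ℤ.*-monoˡ-≤-nonNeg a s≤t)))) ,
        + ℤ.∣ e ∣ , subst (0ℤ ℤ.≤_) (sym (ℤ.+-assoc (a ℤ.* (+ ℤ.∣ e ∣)) (dot as x) b)) (ascend a e)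
        where e = dot as x ℤ.+ b

      down-spec : ∀ {h : Half (suc n)} → Down h → ∀ x →
                  (∀ s t → s ℤ.≤ t → ⟦ h ⟧ (t ∷ x) → ⟦ h ⟧ (s ∷ x)) × ∃[ t ] ⟦ h ⟧ (t ∷ x)
      down-spec {h = a@(ℤ.-[1+ _ ]) ∷ as , b} _ x =
        (λ s t s≤t 0≤ → ℤ.≤-trans 0≤ (ℤ.+-monoˡ-≤ b (ℤ.+-monoˡ-≤ (dot as x) (ℤ.*-monoˡ-≤-nonPos a s≤t)))) ,
        ℤ.- (+ ℤ.∣ e ∣) ,
        subst (0ℤ ℤ.≤_)
          (solve 4 (λ a u d b → (:- a) :* u :+ (d :+ b) := (a :* (:- u) :+ d) :+ b) refl a (+ ℤ.∣ e ∣) (dot as x) b)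
          (ascend (ℤ.- a) e)
        where e = dot as x ℤ.+ b

      -- Along w = r + a·v the least integer t with 0 ≤ a·t + as·w + b is affine
      -- in v, so it can be substituted into the upper bound.
      pair : ∀ {h k : Half (suc n)} → Up h → Down k →
             Presburger (λ x → ∃[ t ] (⟦ h ⟧ (t ∷ x) × ⟦ k ⟧ (t ∷ x)))
      pair {n} {h = a@(ℤ.+[1+ _ ]) ∷ as , b} {k = c@(ℤ.-[1+ _ ]) ∷ cs , d} _ _ = a , _ , λ r →
        PolyAlgebra.resp
          ((λ {v} → from r v) , (λ {v} → to r v))
          (half (slope , const r))
        where
        open ℤ.≤-Reasoning
        slope : Vec ℤ n
        slope = (a *ᶻ cs) +ᶻ (ℤ.- c) *ᶻ as
        e q const : Vec ℤ n → ℤ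
        e r = dot as r ℤ.+ b
        q r = e r ℤ./ a
        const r = dot cs r ℤ.+ d ℤ.- c ℤ.* q r
        least : Vec ℤ n → Vec ℤ n → ℤ
        least r v = ℤ.- (dot as v ℤ.+ q r)

        at-least : ∀ r v → c ℤ.* least r v ℤ.+ dot cs (r +ᶻ a *ᶻ v) ℤ.+ d ≡ dot slope v ℤ.+ const r
        at-least r v rewrite dot-affine cs r a v | dot-+ˡ (a *ᶻ cs) ((ℤ.- c) *ᶻ as) v
          | dot-*ˡ a cs v | dot-*ˡ (ℤ.- c) as v =
          solve 7 (λ a c A C q R d →
            c :* (:- (A :+ q)) :+ (R :+ a :* C) :+ d := (a :* C :+ (:- c) :* A) :+ (R :+ d :- c :* q))
            refl a c (dot as v) (dot cs v) (q r) (dot cs r) d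

        -- The value of the lower constraint at `t` is the remainder of `e r` modulo `a` plus a
        -- multiple of `a`. As the remainder lies in [0, a), the value is nonnegative exactly from
        -- `least r v` on.
        remainder : ∀ r v t → (a ℤ.* t ℤ.+ dot as (r +ᶻ a *ᶻ v)) ℤ.+ b ≡ + (e r ℤ.% a) ℤ.+ a ℤ.* (t ℤ.- least r v)
        remainder r v t rewrite dot-affine as r a v = trans
          (solve 5 (λ a t R A b → (a :* t :+ (R :+ a :* A)) :+ b := (R :+ b) :+ a :* (t :+ A)) refl a t (dot as r) (dot as v) b)
          (trans (cong (ℤ._+ a ℤ.* (t ℤ.+ dot as v)) (ℤ.a≡a%n+[a/n]*n (e r) a))
            (solve 5 (λ m q a t A → (m :+ q :* a) :+ a :* (t :+ A) := m :+ a :* (t :- (:- (A :+ q))))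
              refl (+ (e r ℤ.% a)) (q r) a t (dot as v)))

        to : ∀ r v → ∃[ t ] (⟦ a ∷ as , b ⟧ (t ∷ (r +ᶻ a *ᶻ v)) × ⟦ c ∷ cs , d ⟧ (t ∷ (r +ᶻ a *ᶻ v))) → ⟦ slope , const r ⟧ v
        to r v (t , lower , upper) = begin
          0ℤ                                                    ≤⟨ upper ⟩
          (c ℤ.* t ℤ.+ dot cs (r +ᶻ a *ᶻ v)) ℤ.+ d              ≤⟨ ℤ.+-monoˡ-≤ d (ℤ.+-monoˡ-≤ (dot cs (r +ᶻ a *ᶻ v)) (ℤ.*-monoˡ-≤-nonPos c least≤t)) ⟩
          (c ℤ.* least r v ℤ.+ dot cs (r +ᶻ a *ᶻ v)) ℤ.+ d      ≡⟨ at-least r v ⟩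
          dot slope v ℤ.+ const r                               ∎
          where
          least≤t : least r v ℤ.≤ t
          least≤t with least r v ℤ.≤? t
          ... | yes p = p
          ... | no ¬p = ⊥-elim (ℤ.≤⇒≯ (subst (0ℤ ℤ.≤_) (remainder r v t) lower) (begin-strict
            + (e r ℤ.% a) ℤ.+ a ℤ.* (t ℤ.- least r v)
              <⟨ ℤ.+-monoˡ-< (a ℤ.* (t ℤ.- least r v)) (ℤ.+<+ (ℤ.n%d<d (e r) a)) ⟩
            a ℤ.+ a ℤ.* (t ℤ.- least r v)
              ≡⟨ solve 3 (λ a t l → a :+ a :* (t :- l) := a :* ((con 1ℤ :+ t) :- l)) refl a t (least r v) ⟩
            a ℤ.* (ℤ.suc t ℤ.- least r v)
              ≤⟨ ℤ.*-monoˡ-≤-nonNeg a (ℤ.i≤j⇒i-j≤0 (ℤ.i<j⇒suc[i]≤j (ℤ.≰⇒> ¬p))) ⟩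
            a ℤ.* 0ℤ
              ≡⟨ ℤ.*-zeroʳ a ⟩
            0ℤ ∎))

        from : ∀ r v → ⟦ slope , const r ⟧ v → ∃[ t ] (⟦ a ∷ as , b ⟧ (t ∷ (r +ᶻ a *ᶻ v)) × ⟦ c ∷ cs , d ⟧ (t ∷ (r +ᶻ a *ᶻ v)))
        from r v 0≤ = least r v , subst (0ℤ ℤ.≤_) (sym (remainder r v (least r v))) (begin
            0ℤ                                                   ≤⟨ ℤ.+≤+ ℕ.z≤n ⟩
            + (e r ℤ.% a)                                        ≡⟨ solve 3 (λ m a l → m := m :+ a :* (l :- l)) refl (+ (e r ℤ.% a)) a (least r v) ⟩
            + (e r ℤ.% a) ℤ.+ a ℤ.* (least r v ℤ.- least r v)    ∎)
          , subst (0ℤ ℤ.≤_) (sym (at-least r v)) 0≤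

    FinUnion-project : {S : Pred (Vec ℤ (suc n)) 0ℓ} → FinUnion Poly S → Presburger (λ x → ∃[ t ] S (t ∷ x))
    FinUnion-project = bind (SetAlgebra.unionClosed Presburger-algebra) (projection-additive _∷_)
      λ {P} (hs , S⊆ , ⊆S) → PresburgerAlgebra.resp
        {S = λ x → ∃[ t ] All (λ h → ⟦ h ⟧ (t ∷ x)) hs} {T = λ x → ∃[ t ] P (t ∷ x)}
        ((λ (t , all) → t , ⊆S all) , (λ (t , s) → t , S⊆ s))
        (eliminate Presburger-algebra (FinUnion⇒Presburger ∘ half) kind up-spec down-spec pair hs)

    -- The eliminated variable has to be split by residue as well: with the class of `x` and a
    -- residue `ρ` of the variable both fixed modulo `M`, the set is a union of polyhedra and
    -- `FinUnion-project` applies. The results are united over `ρ` and glued over the classes of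
    -- `x`.
    Presburger-project : {S : Pred (Vec ℤ (suc n)) 0ℓ} → Presburger S → Presburger (λ x → ∃[ t ] S (t ∷ x))
    Presburger-project {n} {S} (M@(ℤ.+[1+ _ ]) , _ , S-mod) = Presburger-glue M {S = λ x → ∃[ t ] S (t ∷ x)} λ r →
      PresburgerAlgebra.resp
      ( (λ {w} → in-slice r w)
      -- The eliminated integer is treated as a vector of length one, so that `residue` supplies its
      -- class.
      , (λ {w} (z , s) → let ρ , q , ρ∈ , z≡ = residue M (z ∷ []) in
           List∈.lose ρ∈ (Vec.head q , subst (λ u → S (u ∷ (r +ᶻ M *ᶻ w))) (head≡ ρ q z≡) s)) )
      (PresburgerAlgebra.unions (slice r) (λ ρ → FinUnion-project (S-mod (Vec.head ρ ∷ r))) (residues M 1))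
      where
      slice : Vec ℤ n → Vec ℤ 1 → Pred (Vec ℤ n) 0ℓ
      slice r ρ w = ∃[ t ] S ((Vec.head ρ ∷ r) +ᶻ M *ᶻ (t ∷ w))
      in-slice : ∀ r w → Any (λ ρ → slice r ρ w) (residues M 1) → ∃[ t ] S (t ∷ (r +ᶻ M *ᶻ w))
      in-slice r w some = let ρ , t , s = Any.satisfied some in Vec.head ρ ℤ.+ M ℤ.* t , s
      head≡ : ∀ {z : ℤ} (ρ q : Vec ℤ 1) → z ∷ [] ≡ ρ +ᶻ M *ᶻ q → z ≡ Vec.head ρ ℤ.+ M ℤ.* Vec.head q
      head≡ (_ ∷ []) (_ ∷ []) refl = refl

-- Dickson's lemma and the semilinearity of Presburger sets

module SemilinearSets where

  open Defs using (_+ᶻ_; 0ᶻ; _*; translate)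
  open FiniteUnions
  open IntegerSets

  private
    variable
      n : ℕ

  All-Any : ∀ {p q r} {A : Set} {P : Pred A p} {Q : Pred A q} {R : Pred A r} {xs} →
            (∀ {x} → P x → Q x → R x) → All P xs → Any Q xs → Any R xs
  All-Any f (p ∷ _)  (here q)   = here (f p q)
  All-Any f (_ ∷ ps) (there qs) = there (All-Any f ps qs)

  module _ (em : ExcludedMiddle 0ℓ) {A : Set} where

    -- Tuples of naturals are replaced by the values of finitely many measures on an arbitrary type,
    -- so that integer vectors can be compared directly by the slacks of constraints.
    Basis : List (A → ℕ) → Pred A 0ℓ → Set
    Basis fs S = Σ[ B ∈ List A ] All S B ×
      (∀ s → S s → Any (λ b → All (λ f → f b ℕ.≤ f s) fs) B)

    -- Induction on the number of measures. A basis `B₀` for the remaining measures serves every `s`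
    -- at which `f` is at least its maximum on `B₀`. Below that maximum `f` takes finitely many
    -- values, and each layer on which `f` is constant has a basis by induction.
    dickson : ∀ fs (S : Pred A 0ℓ) → Basis fs S
    dickson [] S with em {∃[ a ] S a}
    ... | yes (a , Sa) = a ∷ [] , Sa ∷ [] , λ _ _ → here []
    ... | no ¬∃ = [] , [] , λ s Ss → ⊥-elim (¬∃ (s , Ss))
    dickson (f ∷ fs) S =
      let B₀ , B₀⊆S , B₀-basis = dickson fs S
          B₁ , B₁⊆S , B₁-basis = layers (bound B₀)
      in B₀ ++ B₁ , All.++⁺ B₀⊆S B₁⊆S , λ s Ss → case-bound B₀ B₁ s (B₀-basis s Ss) (B₁-basis s Ss)
      where
      bound : List A → ℕ
      bound []       = 0
      bound (b ∷ bs) = f b ℕ.⊔ bound bs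

      layers : ∀ m → Σ[ B ∈ List A ] All S B ×
        (∀ s → S s → f s ℕ.< m → Any (λ b → All (λ g → g b ℕ.≤ g s) (f ∷ fs)) B)
      layers zero = [] , [] , λ _ _ ()
      layers (suc m) =
        let B , B⊆S , B-basis = layers m
            C , C⊆ , C-basis = dickson fs (λ s → S s × f s ≡ m)
        in B ++ C , All.++⁺ B⊆S (All.map proj₁ C⊆) , λ s Ss fs<1+m →
          [ (λ fs<m → Any.++⁺ˡ (B-basis s Ss fs<m))
          , (λ fs≡m → Any.++⁺ʳ B (All-Any
              (λ (_ , fb≡m) le → ℕ.≤-reflexive (trans fb≡m (sym fs≡m)) ∷ le)
              C⊆ (C-basis s (Ss , fs≡m))))
          ]′ (ℕ.m≤n⇒m<n∨m≡n (ℕ.s≤s⁻¹ fs<1+m))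

      case-bound : ∀ B₀ B₁ s → Any (λ b → All (λ g → g b ℕ.≤ g s) fs) B₀ →
        (f s ℕ.< bound B₀ → Any (λ b → All (λ g → g b ℕ.≤ g s) (f ∷ fs)) B₁) →
        Any (λ b → All (λ g → g b ℕ.≤ g s) (f ∷ fs)) (B₀ ++ B₁)
      case-bound B₀ B₁ s some below with f s ℕ.<? bound B₀
      ... | yes lt = Any.++⁺ʳ B₀ (below lt)
      ... | no ¬lt = Any.++⁺ˡ (add some (ℕ.≮⇒≥ ¬lt))
        where
        add : ∀ {B} → Any (λ b → All (λ g → g b ℕ.≤ g s) fs) B → bound B ℕ.≤ f s →
              Any (λ b → All (λ g → g b ℕ.≤ g s) (f ∷ fs)) B
        add {b ∷ bs} (here le) bd = here (ℕ.m⊔n≤o⇒m≤o (f b) (bound bs) bd ∷ le)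
        add {b ∷ bs} (there p) bd = there (add p (ℕ.m⊔n≤o⇒n≤o (f b) (bound bs) bd))

  IsLinear : Pred (Vec ℤ n) 0ℓ → Set
  IsLinear {n} S = Σ[ b ∈ Vec ℤ n ] Σ[ P ∈ List (Vec ℤ n) ] S ≐ translate b (P *)

  IsLinear-resp : ∀ {S T : Pred (Vec ℤ n) 0ℓ} → S ≐ T → IsLinear S → IsLinear T
  IsLinear-resp (S⊆T , T⊆S) (b , P , S⊆ , ⊆S) = b , P , S⊆ ∘ T⊆S , S⊆T ∘ ⊆S

  Semilinear : Pred (Vec ℤ n) 0ℓ → Set₁
  Semilinear = FinUnion IsLinear

  module SemilinearClosed {n} = UnionClosed (FinUnion-unionClosed (IsLinear-resp {n}))

  open Data.Integer.Solver.+-*-Solver using (solve; _:=_; _:+_; _:-_; :-_)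

  infixl 6 _-ᶻ_
  _-ᶻ_ : Vec ℤ n → Vec ℤ n → Vec ℤ n
  _-ᶻ_ = Vec.zipWith ℤ._-_

  b+[z-b] : ∀ (b z : Vec ℤ n) → b +ᶻ (z -ᶻ b) ≡ z
  b+[z-b] []       []       = refl
  b+[z-b] (b ∷ bs) (z ∷ zs) = cong₂ _∷_ (solve 2 (λ b z → b :+ (z :- b) := z) refl b z) (b+[z-b] bs zs)

  dot-minus : ∀ (a y p : Vec ℤ n) → dot a (y -ᶻ p) ≡ dot a y ℤ.- dot a p
  dot-minus a y p = begin
    dot a (y -ᶻ p)                                ≡⟨ solve 2 (λ u v → u := (v :+ u) :- v) refl (dot a (y -ᶻ p)) (dot a p) ⟩
    (dot a p ℤ.+ dot a (y -ᶻ p)) ℤ.- dot a p      ≡⟨ cong (ℤ._- dot a p) (dot-+ʳ a p (y -ᶻ p)) ⟨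
    dot a (p +ᶻ (y -ᶻ p)) ℤ.- dot a p             ≡⟨ cong (λ u → dot a u ℤ.- dot a p) (b+[z-b] p y) ⟩
    dot a y ℤ.- dot a p                           ∎
    where open ≡-Reasoning

  Recession : List (Half n) → Pred (Vec ℤ n) 0ℓ
  Recession hs y = All (λ h → 0ℤ ℤ.≤ dot (proj₁ h) y) hs

  Pointed : List (Half n) → Set
  Pointed hs = ∀ y → All (λ h → dot (proj₁ h) y ≡ 0ℤ) hs → y ≡ 0ᶻ

  private
    ∣∣-cancel-≤ : ∀ {i j} → 0ℤ ℤ.≤ i → 0ℤ ℤ.≤ j → ℤ.∣ i ∣ ℕ.≤ ℤ.∣ j ∣ → i ℤ.≤ j
    ∣∣-cancel-≤ {+ _} {+ _} _ _ le = ℤ.+≤+ le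

    ∣-∣+∣∣ : ∀ {i j} → 0ℤ ℤ.≤ i → i ℤ.≤ j → ℤ.∣ j ℤ.- i ∣ ℕ.+ ℤ.∣ i ∣ ≡ ℤ.∣ j ∣
    ∣-∣+∣∣ {i} {j} 0≤i i≤j = ℤ.+-injective (begin
      + ℤ.∣ j ℤ.- i ∣ ℤ.+ (+ ℤ.∣ i ∣)  ≡⟨ cong₂ ℤ._+_ (ℤ.0≤i⇒+∣i∣≡i (ℤ.i≤j⇒0≤j-i i≤j)) (ℤ.0≤i⇒+∣i∣≡i 0≤i) ⟩
      j ℤ.- i ℤ.+ i                    ≡⟨ solve 2 (λ i j → (j :- i) :+ i := j) refl i j ⟩
      j                                ≡⟨ ℤ.0≤i⇒+∣i∣≡i (ℤ.≤-trans 0≤i i≤j) ⟨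
      + ℤ.∣ j ∣                        ∎)
      where open ≡-Reasoning

    size : List (Half n) → Vec ℤ n → ℕ
    size []       y = 0
    size (h ∷ hs) y = ℤ.∣ dot (proj₁ h) y ∣ ℕ.+ size hs y

    -- Both `p` and `y - p` lie in the cone, where the absolute values are the forms themselves;
    -- hence the sizes add up.
    size-minus : ∀ (hs : List (Half n)) {p y} → Recession hs p →
             All (λ h → dot (proj₁ h) p ℤ.≤ dot (proj₁ h) y) hs → size hs (y -ᶻ p) ℕ.+ size hs p ≡ size hs y
    size-minus [] [] [] = refl
    size-minus (h@(a , _) ∷ hs) {p} {y} (0≤ ∷ 0≤s) (le ∷ les) = begin
      ℤ.∣ dot a (y -ᶻ p) ∣ ℕ.+ size hs (y -ᶻ p) ℕ.+ (ℤ.∣ dot a p ∣ ℕ.+ size hs p)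
        ≡⟨ interchange ℤ.∣ dot a (y -ᶻ p) ∣ (size hs (y -ᶻ p)) ℤ.∣ dot a p ∣ (size hs p) ⟩
      ℤ.∣ dot a (y -ᶻ p) ∣ ℕ.+ ℤ.∣ dot a p ∣ ℕ.+ (size hs (y -ᶻ p) ℕ.+ size hs p)
        ≡⟨ cong₂ ℕ._+_ (trans (cong (λ u → ℤ.∣ u ∣ ℕ.+ ℤ.∣ dot a p ∣) (dot-minus a y p)) (∣-∣+∣∣ 0≤ le)) (size-minus hs 0≤s les) ⟩
      ℤ.∣ dot a y ∣ ℕ.+ size hs y ∎
      where
      open ≡-Reasoning
      open CSemigroup ℕ.+-commutativeSemigroup using (interchange)

    size≡0 : ∀ (hs : List (Half n)) {y} → size hs y ≡ 0 → All (λ h → dot (proj₁ h) y ≡ 0ℤ) hs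
    size≡0 [] _ = []
    size≡0 ((a , _) ∷ hs) {y} eq =
      ℤ.∣i∣≡0⇒i≡0 (ℕ.m+n≡0⇒m≡0 ℤ.∣ dot a y ∣ eq) ∷ size≡0 hs (ℕ.m+n≡0⇒n≡0 ℤ.∣ dot a y ∣ eq)

  module _ (em : ExcludedMiddle 0ℓ) where

    -- The nonzero elements of the cone that are minimal for the values of the
    -- defining forms generate it, since subtracting one decreases the size.
    recession-generators : ∀ (hs : List (Half n)) → Pointed hs →
                           Σ[ P ∈ List (Vec ℤ n) ] Recession hs ≐ P *
    recession-generators {n} hs pointed = P , (λ {y} → generate (size hs y) y ℕ.≤-refl)
                                        , (λ { (ps , ps∈ , refl) → sums ps ps∈ })
      where
      -- Zero size is excluded because the zero vector lies below everything and would form a basis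
      -- by itself.
      basis = dickson em (List.map (λ h y → ℤ.∣ dot (proj₁ h) y ∣) hs)
                         (λ y → Recession hs y × size hs y ≢ 0)
      P = proj₁ basis
      P⊆ = proj₁ (proj₂ basis)

      sums : ∀ ps → All (List∈._∈ P) ps → Recession hs (List.foldr _+ᶻ_ 0ᶻ ps)
      sums [] [] = All.universal (λ h → ℤ.≤-reflexive (sym (dot-0ʳ (proj₁ h)))) hs
      sums (p ∷ ps) (p∈ ∷ ps∈) = All.zipWith
        (λ { {h} (0≤p , 0≤ps) → subst (0ℤ ℤ.≤_) (sym (dot-+ʳ (proj₁ h) p _)) (ℤ.+-mono-≤ 0≤p 0≤ps) })
        (proj₁ (All.lookup P⊆ p∈) , sums ps ps∈)

      generate : ∀ k y → size hs y ℕ.≤ k → Recession hs y → (P *) y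
      generate k y le y∈ with size hs y ℕ.≟ 0
      ... | yes zero-size = [] , [] , pointed y (size≡0 hs zero-size)
      generate zero    y le y∈ | no y≢ = ⊥-elim (y≢ (ℕ.n≤0⇒n≡0 le))
      generate (suc k) y le y∈ | no y≢ =
        let p , p∈ , p≤ = List∈.find (proj₂ (proj₂ basis) y (y∈ , y≢))
            0≤p , p≢ = All.lookup P⊆ p∈
            p≤y = All.zipWith (λ ((0≤p , 0≤y) , le) → ∣∣-cancel-≤ 0≤p 0≤y le)
                    (All.zip (0≤p , y∈) , All.map⁻ p≤)
            smaller = ℕ.s≤s⁻¹ (ℕ.≤-trans (ℕ.m<m+n (size hs (y -ᶻ p)) (ℕ.n≢0⇒n>0 p≢))
                        (ℕ.≤-trans (ℕ.≤-reflexive (size-minus hs 0≤p p≤y)) le))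
            ps , ps∈ , y-p≡ = generate k (y -ᶻ p) smaller
              (All.map (λ { {h} le → subst (0ℤ ℤ.≤_) (sym (dot-minus (proj₁ h) y p)) (ℤ.i≤j⇒0≤j-i le) }) p≤y)
        in p ∷ ps , p∈ ∷ ps∈ , trans (sym (b+[z-b] p y)) (cong (p +ᶻ_) y-p≡)

    -- A Dickson basis is taken with respect to the slacks of the constraints. If no slack of `b`
    -- exceeds that of `z`, the constants cancel and all homogeneous forms are nonnegative at
    -- `z - b`, so `z - b` is in the recession cone; conversely, adding a recession direction
    -- preserves every constraint.
    pointed-semilinear : ∀ (hs : List (Half n)) → Pointed hs → Semilinear (λ z → All (λ h → ⟦ h ⟧ z) hs)
    pointed-semilinear {n} hs pointed = SemilinearClosed.resp
      ( inside _
      , (λ {z} z∈ → Any.map (λ {b} ((0≤b , b≤z)) → z -ᶻ b , cone⊆ (All.zipWith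
              (λ { {h@(a , c)} ((0≤b , 0≤z) , le) → subst (0ℤ ℤ.≤_) (sym (dot-minus a z b))
                   (ℤ.i≤j⇒0≤j-i (cancel {dot a b} {dot a z} c (∣∣-cancel-≤ 0≤b 0≤z le))) })
              (All.zip (0≤b , z∈) , All.map⁻ b≤z)) , sym (b+[z-b] b z))
            (All-Any _,_ B⊆ (proj₂ (proj₂ basis) z z∈))) )
      (SemilinearClosed.unions (λ b → translate b (P *)) (λ b → one (b , P , id , id)) B)
      where
      basis = dickson em (List.map (λ (a , c) z → ℤ.∣ dot a z ℤ.+ c ∣) hs) (λ z → All (λ h → ⟦ h ⟧ z) hs)
      B = proj₁ basis
      B⊆ = proj₁ (proj₂ basis)
      cone = recession-generators hs pointed
      P = proj₁ cone
      cone⊆ = proj₁ (proj₂ cone)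
      ⊆cone = proj₂ (proj₂ cone)
      value : ∀ (a : Vec ℤ n) c b m → dot a b ℤ.+ c ℤ.+ dot a m ≡ dot a (b +ᶻ m) ℤ.+ c
      value a c b m = trans (solve 3 (λ B c M → B :+ c :+ M := (B :+ M) :+ c) refl (dot a b) c (dot a m))
        (cong (ℤ._+ c) (sym (dot-+ʳ a b m)))
      inside : ∀ z → Any (λ b → translate b (P *) z) B → All (λ h → ⟦ h ⟧ z) hs
      inside z some with b , b∈ , m , m∈ , refl ← List∈.find some = All.zipWith
        (λ { {a , c} (0≤b , 0≤m) → ℤ.≤-trans (ℤ.+-mono-≤ 0≤b 0≤m) (ℤ.≤-reflexive (value a c b m)) })
        (All.lookup B⊆ b∈ , ⊆cone m∈)
      cancel : ∀ {i j} c → i ℤ.+ c ℤ.≤ j ℤ.+ c → i ℤ.≤ j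
      cancel {i} {j} c le = subst₂ ℤ._≤_ (undo i) (undo j) (ℤ.+-monoˡ-≤ (ℤ.- c) le)
        where
        undo : ∀ i → i ℤ.+ c ℤ.- c ≡ i
        undo i = solve 2 (λ i c → i :+ c :- c := i) refl i c

    orthant : Vec Sign n → List (Half n)
    orthant []      = []
    orthant (s ∷ σ) = ((s ℤ.◃ 1) ∷ 0ᶻ , 0ℤ) ∷ List.map (λ (a , b) → 0ℤ ∷ a , b) (orthant σ)

    private
      head-value : ∀ k z (zs : Vec ℤ n) → dot (k ∷ 0ᶻ) (z ∷ zs) ≡ k ℤ.* z
      head-value k z zs = trans (cong (λ u → k ℤ.* z ℤ.+ u) (dot-0ˡ zs)) (ℤ.+-identityʳ _)

    orthant-pointed : ∀ (σ : Vec Sign n) → Pointed (orthant σ)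
    orthant-pointed [] [] _ = refl
    orthant-pointed (s ∷ σ) (y ∷ ys) (e ∷ es) = cong₂ _∷_ (cancel-sign s (trans (sym (head-value (s ℤ.◃ 1) y ys)) e))
      (orthant-pointed σ ys (All.map (λ { {a , b} e → trans (sym (ℤ.+-identityˡ (dot a ys))) e }) (All.map⁻ es)))
      where
      cancel-sign : ∀ s {y} → (s ℤ.◃ 1) ℤ.* y ≡ 0ℤ → y ≡ 0ℤ
      cancel-sign s {y} e with ℤ.i*j≡0⇒i≡0∨j≡0 (s ℤ.◃ 1) e
      cancel-sign Sign.+ e | inj₁ ()
      cancel-sign Sign.- e | inj₁ ()
      cancel-sign s e | inj₂ y≡0 = y≡0

    orthants-cover : ∀ (z : Vec ℤ n) → ∃[ σ ] All (λ h → ⟦ h ⟧ z) (orthant σ)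
    orthants-cover [] = [] , []
    orthants-cover (z ∷ zs) = let σ , all = orthants-cover zs in
      ℤ.sign z ∷ σ ,
      subst (0ℤ ℤ.≤_) (sym (trans (ℤ.+-identityʳ _) (head-value (ℤ.sign z ℤ.◃ 1) z zs))) (sign-* z) ∷
      All.map⁺ (All.map (λ { {a , b} → subst (λ u → 0ℤ ℤ.≤ u ℤ.+ b) (sym (ℤ.+-identityˡ (dot a zs))) }) all)
      where
      sign-* : ∀ z → 0ℤ ℤ.≤ (ℤ.sign z ℤ.◃ 1) ℤ.* z
      sign-* (+ n)       = subst (0ℤ ℤ.≤_) (sym (ℤ.*-identityˡ (+ n))) (ℤ.+≤+ ℕ.z≤n)
      sign-* ℤ.-[1+ n ]  = ℤ.+≤+ ℕ.z≤n

    -- Pointedness is inherited by every longer list of constraints, so prepending those of an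
    -- orthant is enough, and the finitely many orthants cover the whole space.
    poly-semilinear : {S : Pred (Vec ℤ n) 0ℓ} → Poly S → Semilinear S
    poly-semilinear {n} {S} (hs , S⊆ , ⊆S) = SemilinearClosed.resp
      ( inside _
      , (λ {z} s → let σ , z∈σ = orthants-cover z in
          List∈.lose (∈-vectors (all-signs σ)) (All.++⁺ z∈σ (S⊆ s))) )
      (SemilinearClosed.unions (λ σ z → All (λ h → ⟦ h ⟧ z) (orthant σ ++ hs))
        (λ σ → pointed-semilinear (orthant σ ++ hs)
          (λ y zeros → orthant-pointed σ y (All.++⁻ˡ (orthant σ) zeros)))
        (vectors signs n))
      where
      signs : List Sign
      signs = Sign.+ ∷ Sign.- ∷ []
      inside : ∀ z → Any (λ σ → All (λ h → ⟦ h ⟧ z) (orthant σ ++ hs)) (vectors signs n) → S z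
      inside z some = let σ , all = Any.satisfied some in ⊆S (All.++⁻ʳ (orthant σ) all)
      all-signs : ∀ {m} (σ : Vec Sign m) → Vecᴬ.All (List∈._∈ signs) σ
      all-signs [] = Vecᴬ.[]
      all-signs (Sign.+ ∷ σ) = here refl Vecᴬ.∷ all-signs σ
      all-signs (Sign.- ∷ σ) = there (here refl) Vecᴬ.∷ all-signs σ

  private
    *ᶻ-+ : ∀ k (y z : Vec ℤ n) → k *ᶻ (y +ᶻ z) ≡ k *ᶻ y +ᶻ k *ᶻ z
    *ᶻ-+ k []       []       = refl
    *ᶻ-+ k (y ∷ ys) (z ∷ zs) = cong₂ _∷_ (ℤ.*-distribˡ-+ k y z) (*ᶻ-+ k ys zs)

    *ᶻ-0 : ∀ n k → k *ᶻ 0ᶻ {n} ≡ 0ᶻ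
    *ᶻ-0 zero    k = refl
    *ᶻ-0 (suc n) k = cong₂ _∷_ (ℤ.*-zeroʳ k) (*ᶻ-0 n k)

    +ᶻ-assoc : ∀ (x y z : Vec ℤ n) → (x +ᶻ y) +ᶻ z ≡ x +ᶻ (y +ᶻ z)
    +ᶻ-assoc []       []       []       = refl
    +ᶻ-assoc (x ∷ xs) (y ∷ ys) (z ∷ zs) = cong₂ _∷_ (ℤ.+-assoc x y z) (+ᶻ-assoc xs ys zs)

  *ᶻ-* : ∀ k {P : List (Vec ℤ n)} {z} → (P *) z → (List.map (k *ᶻ_) P *) (k *ᶻ z)
  *ᶻ-* {n} k {P} (ps , ps∈ , refl) = List.map (k *ᶻ_) ps , All.map⁺ (All.map (List∈.∈-map⁺ (k *ᶻ_)) ps∈) , value ps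
    where
    value : ∀ ps → k *ᶻ List.foldr _+ᶻ_ 0ᶻ ps ≡ List.foldr _+ᶻ_ 0ᶻ (List.map (k *ᶻ_) ps)
    value []       = *ᶻ-0 n k
    value (p ∷ ps) = trans (*ᶻ-+ k p _) (cong (k *ᶻ p +ᶻ_) (value ps))

  *-*ᶻ : ∀ k {P : List (Vec ℤ n)} {y} → (List.map (k *ᶻ_) P *) y → ∃[ z ] ((P *) z × y ≡ k *ᶻ z)
  *-*ᶻ {n} k {P} (qs , qs∈ , refl) = go qs qs∈
    where
    go : ∀ qs → All (List∈._∈ List.map (k *ᶻ_) P) qs →
         ∃[ z ] ((P *) z × List.foldr _+ᶻ_ 0ᶻ qs ≡ k *ᶻ z)
    go [] [] = 0ᶻ , ([] , [] , refl) , sym (*ᶻ-0 n k)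
    go (q ∷ qs) (q∈ ∷ qs∈) =
      let p , p∈ , q≡ = List∈.∈-map⁻ (k *ᶻ_) q∈
          z , (ps , ps∈ , z≡) , qs≡ = go qs qs∈
      in p +ᶻ z , (p ∷ ps , p∈ ∷ ps∈ , cong (p +ᶻ_) z≡) , trans (cong₂ _+ᶻ_ q≡ qs≡) (sym (*ᶻ-+ k p z))

  affine-image : ∀ (r : Vec ℤ n) k {S} → Semilinear S → Semilinear (λ z → ∃[ w ] (S w × z ≡ r +ᶻ k *ᶻ w))
  affine-image r k = bind (FinUnion-unionClosed IsLinear-resp)
    (record { mono = λ S⊆T (w , s , e) → w , S⊆T s , e
            ; nil = λ ()
            ; cup = λ { (w , inj₁ s , e) → inj₁ (w , s , e) ; (w , inj₂ s , e) → inj₂ (w , s , e) } })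
    λ (b , P , S⊆ , ⊆S) → one
      ( r +ᶻ k *ᶻ b , List.map (k *ᶻ_) P
      , (λ (w , s , z≡) → let m , m∈ , w≡ = S⊆ s in k *ᶻ m , *ᶻ-* k {P} m∈ ,
           trans z≡ (trans (cong (λ u → r +ᶻ k *ᶻ u) w≡) (sym (+ᶻ-assoc-scaled r b k m))))
      , (λ (y , y∈ , z≡) → let m , m∈ , y≡ = *-*ᶻ k {P} y∈ in b +ᶻ m , ⊆S (m , m∈ , refl) ,
           trans z≡ (trans (cong (r +ᶻ k *ᶻ b +ᶻ_) y≡) (+ᶻ-assoc-scaled r b k m))) )

  -- On a residue class, `S` is the image of a union of polyhedra under `w ↦ r + M w`. This map
  -- sends linear sets to linear sets, with base `r + M b` and periods `M p`.
  Presburger⇒Semilinear : ExcludedMiddle 0ℓ → {S : Pred (Vec ℤ n) 0ℓ} → Presburger S → Semilinear S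
  Presburger⇒Semilinear {n} em {S} (M@(ℤ.+[1+ _ ]) , _ , S-mod) = SemilinearClosed.resp
    ( inside _
    , (λ {z} s → let r , q , r∈ , z≡ = residue M z in List∈.lose r∈ (q , subst S z≡ s , z≡)) )
    (SemilinearClosed.unions (λ r z → ∃[ w ] (S (r +ᶻ M *ᶻ w) × z ≡ r +ᶻ M *ᶻ w))
      (λ r → affine-image r M (bind (FinUnion-unionClosed IsLinear-resp) (preimage-additive id) (poly-semilinear em) (S-mod r)))
      (residues M n))
    where
    inside : ∀ z → Any (λ r → ∃[ w ] (S (r +ᶻ M *ᶻ w) × z ≡ r +ᶻ M *ᶻ w)) (residues M n) → S z
    inside z some = let r , w , s , z≡ = Any.satisfied some in subst S (sym z≡) s

-- Real polyhedra with strict and weak constraints, and Fourier-Motzkin elimination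

module RealPolyhedra where

  open Defs hiding (lt; le; eq; ge; gt)
  open RealNumbers
  open FiniteUnions
  open IntegerSets using (module Dot; projection-additive)

  private
    variable
      n : ℕ

  open Dot ℚ.+-*-commutativeRing
  open +-*-Solver using (solve; _:=_; _:+_; _:*_; _:-_; :-_; con)

  terms : Vec ℝ n → ℕ → Vec ℚ n
  terms c i = Vec.map (λ x → seq x i) c

  -- Index by index a linear form is a rational dot product, so identities between affine forms of
  -- reals reduce to ring algebra in ℚ.
  seq-linear : ∀ (α : Vec ℚ n) c i → seq (linear α c) i ≡ dot α (terms c i)
  seq-linear []      []      i = refl
  seq-linear (a ∷ α) (x ∷ c) i = cong (a ℚ.* seq x i ℚ.+_) (seq-linear α c i)

  -- `true` marks strictness. Complement exchanges strict and weak half-spaces, and a chain of two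
  -- comparisons has the disjunction of their flags.
  rel : Bool → ℝ → ℝ → Set
  rel false = _≤_
  rel true  = _<_

  infixl 6 _⊖_
  _⊖_ : ℝ → ℝ → ℝ
  y ⊖ x = y + (ℚ.- 1ℚ) · x

  Affine : ℕ → Set
  Affine n = Vec ℚ n × ℚ

  aff : Affine n → Vec ℝ n → ℝ
  aff (α , β) c = linear α c + fromℚ β

  infixl 7 _*ᴬ_
  infixl 6 _+ᴬ_
  _*ᴬ_ : ℚ → Affine n → Affine n
  q *ᴬ (α , β) = Vec.map (q ℚ.*_) α , q ℚ.* β

  _+ᴬ_ : Affine n → Affine n → Affine n
  (α , β) +ᴬ (α′ , β′) = Vec.zipWith ℚ._+_ α α′ , β ℚ.+ β′

  linear-* : ∀ q (α : Vec ℚ n) c i → seq (linear (Vec.map (q ℚ.*_) α) c) i ≡ q ℚ.* seq (linear α c) i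
  linear-* q α c i = trans (seq-linear (Vec.map (q ℚ.*_) α) c i)
    (trans (dot-*ˡ q α (terms c i)) (cong (q ℚ.*_) (sym (seq-linear α c i))))

  linear-+ : ∀ (α α′ : Vec ℚ n) c i →
             seq (linear (Vec.zipWith ℚ._+_ α α′) c) i ≡ seq (linear α c) i ℚ.+ seq (linear α′ c) i
  linear-+ α α′ c i = trans (seq-linear (Vec.zipWith ℚ._+_ α α′) c i)
    (trans (dot-+ˡ α α′ (terms c i)) (cong₂ ℚ._+_ (sym (seq-linear α c i)) (sym (seq-linear α′ c i))))

  aff-* : ∀ q (f : Affine n) c i → seq (aff (q *ᴬ f) c) i ≡ q ℚ.* seq (aff f c) i
  aff-* q (α , β) c i = trans (cong (ℚ._+ q ℚ.* β) (linear-* q α c i))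
    (sym (ℚ.*-distribˡ-+ q (seq (linear α c) i) β))

  aff-+ : ∀ (f g : Affine n) c i → seq (aff (f +ᴬ g) c) i ≡ seq (aff f c) i ℚ.+ seq (aff g c) i
  aff-+ (α , β) (α′ , β′) c i = trans (cong (ℚ._+ (β ℚ.+ β′)) (linear-+ α α′ c i))
    (interchange (seq (linear α c) i) (seq (linear α′ c) i) β β′)
    where open CSemigroup (CommutativeMonoid.commutativeSemigroup ℚ.+-0-commutativeMonoid) using (interchange)

  RHalf : ℕ → Set
  RHalf n = Bool × Affine n

  ⟦_⟧ᴿ : RHalf n → Pred (Vec ℝ n) 0ℓ
  ⟦ s , f ⟧ᴿ c = rel s 0ℝ (aff f c)

  open module RPoly {n} = Polyhedra {X = Vec ℝ n} {H = RHalf n} ⟦_⟧ᴿ public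
    using () renaming (Poly to RPoly; Poly-resp to RPoly-resp; half to Rhalf; FinUnion-Poly-algebra to FinUnion-RPoly-algebra)

  module _ (em : ExcludedMiddle 0ℓ) where

    open Classical em

    rel-trans : ∀ s s′ {x y z} → rel s x y → rel s′ y z → rel (s ∨ s′) x z
    rel-trans false false {x} {y} {z} = ≤-trans {x} {y} {z}
    rel-trans false true  {x} {y} {z} = ≤-<-trans {x} {y} {z}
    rel-trans true  false {x} {y} {z} = <-≤-trans {x} {y} {z}
    rel-trans true  true  {x} {y} {z} p q = <-≤-trans {x} {y} {z} p (<⇒≤ {y} {z} q)

    rel-weaken : ∀ s s′ {x y} → rel (s ∨ s′) x y → rel s x y × rel s′ x y
    rel-weaken false false p = p , p
    rel-weaken false true {x} {y} p = <⇒≤ {x} {y} p , p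
    rel-weaken true false {x} {y} p = p , <⇒≤ {x} {y} p
    rel-weaken true true  p = p , p

    rel-resp : ∀ s {x y u v} → x ≈ u → y ≈ v → rel s x y → rel s u v
    rel-resp false {x} {y} {u} {v} x≈u y≈v p = ≤-trans {u} {x} {v} (≈⇒≥ {x} {u} x≈u) (≤-trans {x} {y} {v} p (≈⇒≤ {y} {v} y≈v))
    rel-resp true  {x} {y} {u} {v} x≈u y≈v p = ≤-<-trans {u} {x} {v} (≈⇒≥ {x} {u} x≈u) (<-≤-trans {x} {y} {v} p (≈⇒≤ {y} {v} y≈v))

    rel-≗ : ∀ s {x y u v} → (∀ i → seq x i ≡ seq u i) → (∀ i → seq y i ≡ seq v i) → rel s x y → rel s u v
    rel-≗ s {x} {y} {u} {v} x≗u y≗v = rel-resp s {x} {y} {u} {v} (≗⇒≈ {x} {u} x≗u) (≗⇒≈ {y} {v} y≗v)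

    rel-+ : ∀ s {x y} z → rel s x y → rel s (x + z) (y + z)
    rel-+ false {x} {y} z p = +-mono-≤ {x} {y} {z} {z} p (≤-refl {z})
    rel-+ true  {x} {y} z p = +-mono-<-≤ {x} {y} {z} {z} p (≤-refl {z})

    rel-· : ∀ s q {x y} .{{_ : ℚ.Positive q}} → rel s x y → rel s (q · x) (q · y)
    rel-· false q {x} {y} = ·-mono-≤ q {x} {y}
    rel-· true  q {x} {y} = ·-mono-< q {x} {y}

    rel⇒0 : ∀ s {x y} → rel s x y → rel s 0ℝ (y ⊖ x)
    rel⇒0 s {x} {y} p = rel-≗ s {x ⊖ x} {y ⊖ x} {0ℝ} {y ⊖ x}
      (λ i → solve 1 (λ x → x :+ con (ℚ.- 1ℚ) :* x := con 0ℚ) refl (seq x i)) (λ _ → refl)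
      (rel-+ s {x} {y} ((ℚ.- 1ℚ) · x) p)

    0⇒rel : ∀ s {x y} → rel s 0ℝ (y ⊖ x) → rel s x y
    0⇒rel s {x} {y} p = rel-≗ s {0ℝ + x} {(y ⊖ x) + x} {x} {y}
      (λ i → ℚ.+-identityˡ (seq x i))
      (λ i → solve 2 (λ x y → y :+ con (ℚ.- 1ℚ) :* x :+ x := y) refl (seq x i) (seq y i))
      (rel-+ s {0ℝ} {y ⊖ x} x p)

    0-scale : ∀ s q {y z} .{{_ : ℚ.Positive q}} → (∀ i → q ℚ.* seq y i ≡ seq z i) → rel s 0ℝ y → rel s 0ℝ z
    0-scale s q {y} {z} e p = rel-≗ s {q · 0ℝ} {q · y} {0ℝ} {z} (λ _ → ℚ.*-zeroʳ q) e (rel-· s q {0ℝ} {y} p)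

    private
      -_ᴬ : Affine n → Affine n
      - f ᴬ = (ℚ.- 1ℚ) *ᴬ f

      seq-neg : ∀ (f : Affine n) c i → seq (0ℝ ⊖ aff f c) i ≡ seq (aff (- f ᴬ) c) i
      seq-neg f c i = trans (ℚ.+-identityˡ ((ℚ.- 1ℚ) ℚ.* seq (aff f c) i)) (sym (aff-* (ℚ.- 1ℚ) f c i))

      rel-neg : ∀ s (f : Affine n) c → rel s (aff f c) 0ℝ → rel s 0ℝ (aff (- f ᴬ) c)
      rel-neg s f c p = rel-≗ s {0ℝ} {0ℝ ⊖ aff f c} {0ℝ} {aff (- f ᴬ) c} (λ _ → refl) (seq-neg f c)
        (rel⇒0 s {aff f c} {0ℝ} p)

      neg-rel : ∀ s (f : Affine n) c → rel s 0ℝ (aff (- f ᴬ) c) → rel s (aff f c) 0ℝ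
      neg-rel s f c p = 0⇒rel s {aff f c} {0ℝ}
        (rel-≗ s {0ℝ} {aff (- f ᴬ) c} {0ℝ} {0ℝ ⊖ aff f c} (λ _ → refl) (λ i → sym (seq-neg f c i)) p)

    opposite-half : ∀ (h : RHalf n) → Σ[ h′ ∈ RHalf n ] ∁ ⟦ h ⟧ᴿ ≐ ⟦ h′ ⟧ᴿ
    opposite-half (false , f) = (true , - f ᴬ)
      , (λ {c} ¬p → rel-neg true f c (≰⇒> {0ℝ} {aff f c} ¬p))
      , (λ {c} p → <⇒≱ {aff f c} {0ℝ} (neg-rel true f c p))
    opposite-half (true , f) = (false , - f ᴬ)
      , (λ {c} ¬p → rel-neg false f c (≮⇒≥ {aff f c} {0ℝ} ¬p))
      , (λ {c} p q → <⇒≱ {0ℝ} {aff f c} q (neg-rel false f c p))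

    RealPoly-algebra : SetAlgebra (FinUnion (RPoly {n}))
    RealPoly-algebra = FinUnion-RPoly-algebra em opposite-half

    private
      Up Down : RHalf (suc n) → Set
      Up   (_ , a ∷ _ , _) = ℚ.Positive a
      Down (_ , a ∷ _ , _) = ℚ.Negative a

      ⟦_⟧₁ : RHalf (suc n) → ℝ → Vec ℝ n → Set
      ⟦ h ⟧₁ t x = ⟦ h ⟧ᴿ (t ∷ x)

      ≤-total : ∀ x y → x ≤ y ⊎ y ≤ x
      ≤-total x y = Sum.map₂ (<⇒≤ {y} {x}) (≤⊎> x y)

    module RElim {n} = Elimination em {X = Vec ℝ n} _≤_ ≤-total 0ℝ ⟦_⟧₁ ⟦_⟧ᴿ Up Down
    open RElim

    private
      zero-slope : ∀ {a} → a ≡ 0ℚ → ∀ (α : Vec ℚ n) β t x i →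
                   seq (aff (a ∷ α , β) (t ∷ x)) i ≡ seq (aff (α , β) x) i
      zero-slope {a = a} a≡0 α β t x i = cong (ℚ._+ β) (trans
        (cong (ℚ._+ seq (linear α x) i) (trans (cong (ℚ._* seq t i) a≡0) (ℚ.*-zeroˡ (seq t i))))
        (ℚ.+-identityˡ (seq (linear α x) i)))

      kind-by : ∀ s a (α : Vec ℚ n) β → Tri (a ℚ.< 0ℚ) (a ≡ 0ℚ) (0ℚ ℚ.< a) → Kind (s , a ∷ α , β)
      kind-by s a α β (tri< a<0 _ _) = down (ℚ.negative a<0)
      kind-by s a α β (tri> _ _ a>0) = up (ℚ.positive a>0)
      kind-by s a α β (tri≈ _ a≡0 _) = free (s , α , β)
        (λ t x → rel-≗ s {0ℝ} {aff (a ∷ α , β) (t ∷ x)} {0ℝ} {aff (α , β) x} (λ _ → refl)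
          (zero-slope a≡0 α β t x))
        (λ t x → rel-≗ s {0ℝ} {aff (α , β) x} {0ℝ} {aff (a ∷ α , β) (t ∷ x)} (λ _ → refl)
          (λ i → sym (zero-slope a≡0 α β t x i)))

      kind : ∀ (h : RHalf (suc n)) → Kind h
      kind (s , a ∷ α , β) = kind-by s a α β (ℚ.<-cmp a 0ℚ)

      root : ∀ a .{{_ : ℚ.NonZero a}} → Affine n → Affine n
      root a f = (ℚ.- ℚ.1/ a) *ᴬ f

      solve-up : ∀ u a t f → u ℚ.* a ≡ 1ℚ → u ℚ.* (a ℚ.* t ℚ.+ f) ≡ t ℚ.+ (ℚ.- 1ℚ) ℚ.* ((ℚ.- u) ℚ.* f)
      solve-up u a t f ua≡1 = trans
        (solve 4 (λ u a t f → u :* (a :* t :+ f) := (u :* a) :* t :+ u :* f) refl u a t f)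
        (trans (cong (λ k → k ℚ.* t ℚ.+ u ℚ.* f) ua≡1)
          (solve 3 (λ u t f → con 1ℚ :* t :+ u :* f := t :+ con (ℚ.- 1ℚ) :* ((:- u) :* f)) refl u t f))

      solve-down : ∀ u a t f → u ℚ.* a ≡ 1ℚ → (ℚ.- u) ℚ.* (a ℚ.* t ℚ.+ f) ≡ (ℚ.- u) ℚ.* f ℚ.+ (ℚ.- 1ℚ) ℚ.* t
      solve-down u a t f ua≡1 = trans
        (solve 4 (λ u a t f → (:- u) :* (a :* t :+ f) := (:- u) :* f :+ (:- (u :* a)) :* t) refl u a t f)
        (cong (λ k → (ℚ.- u) ℚ.* f ℚ.+ (ℚ.- k) ℚ.* t) ua≡1)

      neg*neg : ∀ a u h → (ℚ.- a) ℚ.* ((ℚ.- u) ℚ.* h) ≡ (a ℚ.* u) ℚ.* h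
      neg*neg = solve 3 (λ a u h → (:- a) :* ((:- u) :* h) := (a :* u) :* h) refl

      module Root (a : ℚ) .{{_ : ℚ.NonZero a}} (f : Affine n) (t : ℝ) (x : Vec ℝ n) where
        h : ℝ
        h = aff (a ∷ proj₁ f , proj₂ f) (t ∷ x)
        bound : ℝ
        bound = aff (root a f) x
        u : ℚ
        u = ℚ.1/ a

        seq-h : ∀ i → seq h i ≡ a ℚ.* seq t i ℚ.+ seq (aff f x) i
        seq-h i = ℚ.+-assoc (a ℚ.* seq t i) (seq (linear (proj₁ f) x) i) (proj₂ f)

        private
          T F : ℕ → ℚ
          T i = seq t i
          F i = seq (aff f x) i

        bound≡ : ∀ i → (ℚ.- u) ℚ.* F i ≡ seq bound i
        bound≡ i = sym (aff-* (ℚ.- u) f x i)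

        scale-up : ∀ i → u ℚ.* seq h i ≡ seq (t ⊖ bound) i
        scale-up i = trans (cong (u ℚ.*_) (seq-h i)) (trans (solve-up u a (T i) (F i) (ℚ.*-inverseˡ a))
          (cong (λ b → T i ℚ.+ (ℚ.- 1ℚ) ℚ.* b) (bound≡ i)))

        scale-down : ∀ i → (ℚ.- u) ℚ.* seq h i ≡ seq (bound ⊖ t) i
        scale-down i = trans (cong ((ℚ.- u) ℚ.*_) (seq-h i)) (trans (solve-down u a (T i) (F i) (ℚ.*-inverseˡ a))
          (cong (ℚ._+ (ℚ.- 1ℚ) ℚ.* T i) (bound≡ i)))

        unscale-up : ∀ i → a ℚ.* seq (t ⊖ bound) i ≡ seq h i
        unscale-up i = trans (cong (a ℚ.*_) (sym (scale-up i)))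
          (trans (sym (ℚ.*-assoc a u (seq h i))) (trans (cong (ℚ._* seq h i) (ℚ.*-inverseʳ a)) (ℚ.*-identityˡ (seq h i))))

        unscale-down : ∀ i → (ℚ.- a) ℚ.* seq (bound ⊖ t) i ≡ seq h i
        unscale-down i = trans (cong ((ℚ.- a) ℚ.*_) (sym (scale-down i)))
          (trans (neg*neg a u (seq h i)) (trans (cong (ℚ._* seq h i) (ℚ.*-inverseʳ a)) (ℚ.*-identityˡ (seq h i))))

      lower : ∀ (h : RHalf (suc n)) → Up h → Affine n
      lower (s , a ∷ α , β) a>0 = root a {{ℚ.pos⇒nonZero a {{a>0}}}} (α , β)

      upper : ∀ (h : RHalf (suc n)) → Down h → Affine n
      upper (s , a ∷ α , β) a<0 = root a {{ℚ.neg⇒nonZero a {{a<0}}}} (α , β)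

      lower≡ : ∀ s a (f : Affine n) (a>0 : ℚ.Positive a) →
               root a {{ℚ.pos⇒nonZero a {{a>0}}}} f ≡ lower (s , a ∷ proj₁ f , proj₂ f) a>0
      lower≡ s a f a>0 = refl

      upper≡ : ∀ s a (f : Affine n) (a<0 : ℚ.Negative a) →
               root a {{ℚ.neg⇒nonZero a {{a<0}}}} f ≡ upper (s , a ∷ proj₁ f , proj₂ f) a<0
      upper≡ s a f a<0 = refl

      Above : ∀ (h : RHalf (suc n)) → Up h → Vec ℝ n → ℝ → Set
      Above h U x t = rel (proj₁ h) (aff (lower h U) x) t

      Below : ∀ (h : RHalf (suc n)) → Down h → Vec ℝ n → ℝ → Set
      Below h D x t = rel (proj₁ h) t (aff (upper h D) x)

      neg-pos : ∀ a → ℚ.Negative a → ℚ.Positive (ℚ.- a)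
      neg-pos a a<0 = ℚ.positive (ℚ.neg-antimono-< (ℚ.negative⁻¹ a {{a<0}}))

      -- The substitutions keep Agda from comparing the Cauchy proofs inside two reals.
      to-above : ∀ (h : RHalf (suc n)) (U : Up h) x t → ⟦ h ⟧ᴿ (t ∷ x) → Above h U x t
      to-above (s , a ∷ α , β) a>0 x t p = subst (λ f → rel s (aff f x) t) (lower≡ s a (α , β) a>0)
        (0⇒rel s {bound} {t} (0-scale s u {h} {t ⊖ bound} {{ℚ.1/pos⇒pos a {{a>0}}}} scale-up p))
        where open Root a {{ℚ.pos⇒nonZero a {{a>0}}}} (α , β) t x

      from-above : ∀ (h : RHalf (suc n)) (U : Up h) x t → Above h U x t → ⟦ h ⟧ᴿ (t ∷ x)
      from-above (s , a ∷ α , β) a>0 x t p =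
        0-scale s a {t ⊖ bound} {h} {{a>0}} unscale-up (rel⇒0 s {bound} {t}
          (subst (λ f → rel s (aff f x) t) (sym (lower≡ s a (α , β) a>0)) p))
        where open Root a {{ℚ.pos⇒nonZero a {{a>0}}}} (α , β) t x

      to-below : ∀ (h : RHalf (suc n)) (D : Down h) x t → ⟦ h ⟧ᴿ (t ∷ x) → Below h D x t
      to-below (s , a ∷ α , β) a<0 x t p = subst (λ f → rel s t (aff f x)) (upper≡ s a (α , β) a<0)
        (0⇒rel s {t} {bound} (0-scale s (ℚ.- u) {h} {bound ⊖ t} {{neg-pos u (ℚ.1/neg⇒neg a {{a<0}})}} scale-down p))
        where open Root a {{ℚ.neg⇒nonZero a {{a<0}}}} (α , β) t x

      from-below : ∀ (h : RHalf (suc n)) (D : Down h) x t → Below h D x t → ⟦ h ⟧ᴿ (t ∷ x)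
      from-below (s , a ∷ α , β) a<0 x t p =
        0-scale s (ℚ.- a) {bound ⊖ t} {h} {{neg-pos a a<0}} unscale-down (rel⇒0 s {t} {bound}
          (subst (λ f → rel s t (aff f x)) (sym (upper≡ s a (α , β) a<0)) p))
        where open Root a {{ℚ.neg⇒nonZero a {{a<0}}}} (α , β) t x

      rel-≤ : ∀ s {x y z} → rel s x y → y ≤ z → rel s x z
      rel-≤ false {x} {y} {z} = ≤-trans {x} {y} {z}
      rel-≤ true  {x} {y} {z} = <-≤-trans {x} {y} {z}

      ≤-rel : ∀ s {x y z} → x ≤ y → rel s y z → rel s x z
      ≤-rel s {x} {y} {z} = rel-trans false s {x} {y} {z}

      0<1 : ∀ s → rel s 0ℝ 1ℝ
      0<1 false = fromℚ-mono-≤ (ℚ.<⇒≤ (ℚ.positive⁻¹ 1ℚ))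
      0<1 true  = fromℚ-mono-< (ℚ.positive⁻¹ 1ℚ)

      up-spec : ∀ {h : RHalf (suc n)} → Up h → ∀ x →
                (∀ t t′ → t ≤ t′ → ⟦ h ⟧ᴿ (t ∷ x) → ⟦ h ⟧ᴿ (t′ ∷ x)) × ∃[ t ] ⟦ h ⟧ᴿ (t ∷ x)
      up-spec {h = h} a>0 x =
        (λ t t′ t≤t′ p → from-above h a>0 x t′ (rel-≤ s {b} {t} {t′} (to-above h a>0 x t p) t≤t′)) ,
        -- One unit past the bound satisfies the weak and the strict constraint alike.
        b + 1ℝ , from-above h a>0 x (b + 1ℝ) (0⇒rel s {b} {b + 1ℝ}
          (rel-≗ s {0ℝ} {1ℝ} {0ℝ} {(b + 1ℝ) ⊖ b} (λ _ → refl) (λ i → beyond (seq b i)) (0<1 s)))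
        where
        s : Bool
        s = proj₁ h
        b : ℝ
        b = aff (lower h a>0) x
        beyond : ∀ b → 1ℚ ≡ (b ℚ.+ 1ℚ) ℚ.+ (ℚ.- 1ℚ) ℚ.* b
        beyond = solve 1 (λ b → con 1ℚ := (b :+ con 1ℚ) :+ con (ℚ.- 1ℚ) :* b) refl

      down-spec : ∀ {h : RHalf (suc n)} → Down h → ∀ x →
                  (∀ t t′ → t ≤ t′ → ⟦ h ⟧ᴿ (t′ ∷ x) → ⟦ h ⟧ᴿ (t ∷ x)) × ∃[ t ] ⟦ h ⟧ᴿ (t ∷ x)
      down-spec {h = h} a<0 x =
        (λ t t′ t≤t′ p → from-below h a<0 x t (≤-rel s {t} {t′} {b} t≤t′ (to-below h a<0 x t′ p))) ,
        b ⊖ 1ℝ , from-below h a<0 x (b ⊖ 1ℝ) (0⇒rel s {b ⊖ 1ℝ} {b}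
          (rel-≗ s {0ℝ} {1ℝ} {0ℝ} {b ⊖ (b ⊖ 1ℝ)} (λ _ → refl) (λ i → before (seq b i)) (0<1 s)))
        where
        s : Bool
        s = proj₁ h
        b : ℝ
        b = aff (upper h a<0) x
        before : ∀ b → 1ℚ ≡ b ℚ.+ (ℚ.- 1ℚ) ℚ.* (b ℚ.+ (ℚ.- 1ℚ) ℚ.* 1ℚ)
        before = solve 1 (λ b → con 1ℚ := b :+ con (ℚ.- 1ℚ) :* (b :+ con (ℚ.- 1ℚ) :* con 1ℚ)) refl

      midpoint : ∀ s x y → rel s x y → rel s x (½ · (x + y)) × rel s (½ · (x + y)) y
      midpoint s x y p =
        0⇒rel s {x} {½ · (x + y)} (0-scale s ½ {y ⊖ x} {½ · (x + y) ⊖ x} (λ i → left (seq x i) (seq y i)) (rel⇒0 s {x} {y} p)) ,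
        0⇒rel s {½ · (x + y)} {y} (0-scale s ½ {y ⊖ x} {y ⊖ ½ · (x + y)} (λ i → right (seq x i) (seq y i)) (rel⇒0 s {x} {y} p))
        where
        left : ∀ x y → ½ ℚ.* (y ℚ.+ (ℚ.- 1ℚ) ℚ.* x) ≡ ½ ℚ.* (x ℚ.+ y) ℚ.+ (ℚ.- 1ℚ) ℚ.* x
        left = solve 2 (λ x y → con ½ :* (y :+ con (ℚ.- 1ℚ) :* x) := con ½ :* (x :+ y) :+ con (ℚ.- 1ℚ) :* x) refl
        right : ∀ x y → ½ ℚ.* (y ℚ.+ (ℚ.- 1ℚ) ℚ.* x) ≡ y ℚ.+ (ℚ.- 1ℚ) ℚ.* (½ ℚ.* (x ℚ.+ y))
        right = solve 2 (λ x y → con ½ :* (y :+ con (ℚ.- 1ℚ) :* x) := y :+ con (ℚ.- 1ℚ) :* (con ½ :* (x :+ y))) refl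

      module Algebraᴿ {n} = SetAlgebra (RealPoly-algebra {n})

      -- Solvability is strict comparison of the two bounds as soon as either constraint is strict.
      -- The midpoint is the witness: it meets both sides with the stronger relation, which
      -- `rel-weaken` then relaxes.
      between : ∀ s s′ (lo hi : Affine n) →
                FinUnion RPoly (λ x → ∃[ t ] (rel s (aff lo x) t × rel s′ t (aff hi x)))
      between s s′ lo hi = Algebraᴿ.resp ((λ {x} → from x) , (λ {x} → to x)) (Rhalf (s ∨ s′ , hi +ᴬ (- lo ᴬ)))
        where
        gap : ∀ x i → seq (aff (hi +ᴬ (- lo ᴬ)) x) i ≡ seq (aff hi x ⊖ aff lo x) i
        gap x i = trans (aff-+ hi (- lo ᴬ) x i) (cong (λ u → seq (aff hi x) i ℚ.+ u) (aff-* (ℚ.- 1ℚ) lo x i))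
        to : ∀ x → ∃[ t ] (rel s (aff lo x) t × rel s′ t (aff hi x)) → ⟦ s ∨ s′ , hi +ᴬ (- lo ᴬ) ⟧ᴿ x
        to x (t , p , q) = rel-≗ (s ∨ s′) {0ℝ} {aff hi x ⊖ aff lo x} {0ℝ} {aff (hi +ᴬ (- lo ᴬ)) x} (λ _ → refl) (λ i → sym (gap x i))
          (rel⇒0 (s ∨ s′) {aff lo x} {aff hi x} (rel-trans s s′ {aff lo x} {t} {aff hi x} p q))
        from : ∀ x → ⟦ s ∨ s′ , hi +ᴬ (- lo ᴬ) ⟧ᴿ x → ∃[ t ] (rel s (aff lo x) t × rel s′ t (aff hi x))
        from x p =
          let m = ½ · (aff lo x + aff hi x)
              lo<hi = 0⇒rel (s ∨ s′) {aff lo x} {aff hi x}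
                (rel-≗ (s ∨ s′) {0ℝ} {aff (hi +ᴬ (- lo ᴬ)) x} {0ℝ} {aff hi x ⊖ aff lo x} (λ _ → refl) (gap x) p)
              lo<m , m<hi = midpoint (s ∨ s′) (aff lo x) (aff hi x) lo<hi
          in m , proj₁ (rel-weaken s s′ {aff lo x} {m} lo<m) , proj₂ (rel-weaken s s′ {m} {aff hi x} m<hi)

      pair : ∀ {h k : RHalf (suc n)} → Up h → Down k →
             FinUnion RPoly (λ x → ∃[ t ] (⟦ h ⟧ᴿ (t ∷ x) × ⟦ k ⟧ᴿ (t ∷ x)))
      pair {h = h} {k = k} U D = Algebraᴿ.resp
        {S = λ x → ∃[ t ] (Above h U x t × Below k D x t)}
        {T = λ x → ∃[ t ] (⟦ h ⟧ᴿ (t ∷ x) × ⟦ k ⟧ᴿ (t ∷ x))}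
        ( (λ {x} (t , p , q) → t , from-above h U x t p , from-below k D x t q)
        , (λ {x} (t , p , q) → t , to-above h U x t p , to-below k D x t q) )
        (between (proj₁ h) (proj₁ k) (lower h U) (upper k D))

    RealPoly-project : {S : Pred (Vec ℝ (suc n)) 0ℓ} → FinUnion RPoly S → FinUnion RPoly (λ x → ∃[ t ] S (t ∷ x))
    RealPoly-project = bind (SetAlgebra.unionClosed RealPoly-algebra) (projection-additive _∷_)
      λ {P} (hs , S⊆ , ⊆S) → Algebraᴿ.resp
        {S = λ x → ∃[ t ] All (λ h → ⟦ h ⟧ᴿ (t ∷ x)) hs} {T = λ x → ∃[ t ] P (t ∷ x)}
        ((λ (t , all) → t , ⊆S all) , (λ (t , s) → t , S⊆ s))
        (eliminate RealPoly-algebra Rhalf kind up-spec down-spec pair hs)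

-- Formulas as finite unions of products of a real and an integral condition

module MixedSets where

  open Defs hiding (lt; le; eq; ge; gt)
  open Pointwise using ([]; _∷_)
  open RealNumbers
  open FiniteUnions
  open IntegerSets using (module Dot; _*ᶻ_; projection-additive; Presburger; Presburger-algebra; Presburger-project; FinUnion⇒Presburger)
    renaming ( dot to dotᶻ; evaluate to evaluateᶻ; coefficients to coefficientsᶻ; half to halfᶻ; ⟦_⟧ to ⟦_⟧ᶻ
             ; dot-coefficients to dotᶻ-coefficients; dot-+ˡ to dotᶻ-+ˡ; dot-*ˡ to dotᶻ-*ˡ )
  open RealPolyhedra

  private
    variable
      n : ℕ

  module ℚ· = Dot ℚ.+-*-commutativeRing
  open Data.Integer.Solver.+-*-Solver using ()
    renaming (solve to solveᶻ; _:=_ to _≔_; _:+_ to _⊞ᶻ_; _:*_ to _⊠_; _:-_ to _⊟_; :-_ to ⊟_; con to conᶻ)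
  open +-*-Solver using (solve; _:=_; _:+_; _:*_; con)

  termᴬ : Term n → Affine n
  termᴬ t = ℚ·.coefficients t , 0ℚ

  constᴬ : ℚ → Affine n
  constᴬ q = Vec.replicate _ 0ℚ , q

  seq-term : ∀ (t : Term n) c i → seq (⟦ t ⟧ c) i ≡ ℚ·.evaluate t (terms c i)
  seq-term (var zero)    (x ∷ c) i = refl
  seq-term (var (suc j)) (x ∷ c) i = seq-term (var j) c i
  seq-term (s ⊕ t)       c       i = cong₂ ℚ._+_ (seq-term s c i) (seq-term t c i)

  aff-term : ∀ (t : Term n) c i → seq (aff (termᴬ t) c) i ≡ seq (⟦ t ⟧ c) i
  aff-term t c i = trans (ℚ.+-identityʳ (seq (linear (ℚ·.coefficients t) c) i))
    (trans (seq-linear (ℚ·.coefficients t) c i)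
      (trans (ℚ·.dot-coefficients t (terms c i)) (sym (seq-term t c i))))

  aff-const : ∀ q (c : Vec ℝ n) i → seq (aff (constᴬ q) c) i ≡ q
  aff-const q c i = trans (cong (ℚ._+ q) (trans (seq-linear (Vec.replicate _ 0ℚ) c i) (ℚ·.dot-0ˡ (terms c i))))
    (ℚ.+-identityˡ q)

  module _ (em : ExcludedMiddle 0ℓ) where

    open Classical em
    module Algebraᴿ {n} = SetAlgebra (RealPoly-algebra em {n})
    module Algebraᶻ {n} = SetAlgebra (Presburger-algebra em {n})

    RealPoly-rel : ∀ s (f g : Affine n) → FinUnion RPoly (λ c → rel s (aff f c) (aff g c))
    RealPoly-rel s f g = Algebraᴿ.resp ((λ {c} → from c) , (λ {c} → to c)) (Rhalf (s , g +ᴬ (ℚ.- 1ℚ) *ᴬ f))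
      where
      gap : ∀ c i → seq (aff (g +ᴬ (ℚ.- 1ℚ) *ᴬ f) c) i ≡ seq (aff g c ⊖ aff f c) i
      gap c i = trans (aff-+ g ((ℚ.- 1ℚ) *ᴬ f) c i) (cong (λ u → seq (aff g c) i ℚ.+ u) (aff-* (ℚ.- 1ℚ) f c i))
      to : ∀ c → rel s (aff f c) (aff g c) → ⟦ s , g +ᴬ (ℚ.- 1ℚ) *ᴬ f ⟧ᴿ c
      to c p = rel-≗ em s {0ℝ} {aff g c ⊖ aff f c} {0ℝ} {aff (g +ᴬ (ℚ.- 1ℚ) *ᴬ f) c} (λ _ → refl) (λ i → sym (gap c i))
        (rel⇒0 em s {aff f c} {aff g c} p)
      from : ∀ c → ⟦ s , g +ᴬ (ℚ.- 1ℚ) *ᴬ f ⟧ᴿ c → rel s (aff f c) (aff g c)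
      from c p = 0⇒rel em s {aff f c} {aff g c}
        (rel-≗ em s {0ℝ} {aff (g +ᴬ (ℚ.- 1ℚ) *ᴬ f) c} {0ℝ} {aff g c ⊖ aff f c} (λ _ → refl) (gap c) p)

    RealPoly-rel-≗ : ∀ s (f g : Affine n) (f′ g′ : Vec ℝ n → ℝ) →
                     (∀ c i → seq (aff f c) i ≡ seq (f′ c) i) → (∀ c i → seq (aff g c) i ≡ seq (g′ c) i) →
                     FinUnion RPoly (λ c → rel s (f′ c) (g′ c))
    RealPoly-rel-≗ s f g f′ g′ f≗ g≗ = Algebraᴿ.resp
      ( (λ {c} → rel-≗ em s {aff f c} {aff g c} {f′ c} {g′ c} (f≗ c) (g≗ c))
      , (λ {c} → rel-≗ em s {f′ c} {g′ c} {aff f c} {aff g c} (λ i → sym (f≗ c i)) (λ i → sym (g≗ c i))) )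
      (RealPoly-rel s f g)

    RealPoly-cube : FinUnion RPoly (UnitCube {n})
    RealPoly-cube {n} = Algebraᴿ.resp
      ( (λ all → Vecᴬ.lookup⁻ (λ i → All.lookup all (List∈.∈-allFin i)))
      , (λ c∈ → All.universal (Vecᴬ.lookup⁺ c∈) (List.allFin n)) )
      (Algebraᴿ.inters (λ i c → 0ℝ ≤ Vec.lookup c i × Vec.lookup c i < 1ℝ) {List.allFin n} (All.universal (λ i → Algebraᴿ.inter
        (RealPoly-rel-≗ false (constᴬ 0ℚ) (termᴬ (var i)) (λ _ → 0ℝ) (λ c → Vec.lookup c i) (aff-const 0ℚ) (aff-term (var i)))
        (RealPoly-rel-≗ true (termᴬ (var i)) (constᴬ 1ℚ) (λ c → Vec.lookup c i) (λ _ → 1ℝ) (aff-term (var i)) (aff-const 1ℚ)))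
        (List.allFin n)))

    Point : ℕ → Set
    Point n = Vec ℝ n × Vec ℤ n

    IsProduct : Pred (Point n) 0ℓ → Set₁
    IsProduct {n} S = Σ[ P ∈ Pred (Vec ℝ n) 0ℓ ] Σ[ Q ∈ Pred (Vec ℤ n) 0ℓ ]
      (FinUnion RPoly P × Presburger Q × S ≐ (λ (c , z) → P c × Q z))

    IsProduct-resp : ∀ {S T : Pred (Point n) 0ℓ} → S ≐ T → IsProduct S → IsProduct T
    IsProduct-resp (S⊆T , T⊆S) (P , Q , FP , FQ , S⊆ , ⊆S) = P , Q , FP , FQ , S⊆ ∘ T⊆S , S⊆T ∘ ⊆S

    Mixed : Pred (Point n) 0ℓ → Set₁
    Mixed = FinUnion IsProduct

    product : ∀ {P : Pred (Vec ℝ n) 0ℓ} {Q : Pred (Vec ℤ n) 0ℓ} → FinUnion RPoly P → Presburger Q →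
              Mixed (λ (c , z) → P c × Q z)
    product {P = P} {Q} FP FQ = one (P , Q , FP , FQ , id , id)

    -- Intersections are taken factor by factor, and the complement of `P × Q` is the union of
    -- `∁ P × U` and `U × ∁ Q`.
    Mixed-algebra : SetAlgebra (Mixed {n})
    Mixed-algebra = FinUnion-algebra IsProduct-resp
      (λ (P , Q , FP , FQ , S⊆ , ⊆S) (P′ , Q′ , FP′ , FQ′ , T⊆ , ⊆T) → one
        ( P ∩ P′ , Q ∩ Q′ , Algebraᴿ.inter FP FP′ , Algebraᶻ.inter {S = Q} {T = Q′} FQ FQ′
        , (λ (s , t) → let p , q = S⊆ s ; p′ , q′ = T⊆ t in (p , p′) , q , q′)
        , (λ ((p , p′) , q , q′) → ⊆S (p , q) , ⊆T (p′ , q′)) ))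
      (λ (P , Q , FP , FQ , S⊆ , ⊆S) → join (product (Algebraᴿ.compl FP) Algebraᶻ.full) (product Algebraᴿ.full (Algebraᶻ.compl {S = Q} FQ))
        ( (λ {(c , z)} ¬s → split P Q c z (¬s ∘ ⊆S))
        , (λ { (inj₁ (¬p , _)) s → ¬p (proj₁ (S⊆ s)) ; (inj₂ (_ , ¬q)) s → ¬q (proj₂ (S⊆ s)) }) ))
      (one (U , U , Algebraᴿ.full , Algebraᶻ.full , (λ _ → tt , tt) , λ _ → tt))
      where
      split : ∀ (P : Pred (Vec ℝ n) 0ℓ) (Q : Pred (Vec ℤ n) 0ℓ) c z → ¬ (P c × Q z) → (¬ P c × U z) ⊎ (U c × ¬ Q z)
      split P Q c z ¬pq with em {P c}
      ... | yes p = inj₂ (tt , λ q → ¬pq (p , q))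
      ... | no ¬p = inj₁ (¬p , tt)

    module Algebraᴹ {n} = SetAlgebra (Mixed-algebra {n})

    Mixed-project : {S : Pred (Point (suc n)) 0ℓ} → Mixed S →
                    Mixed (λ (c , z) → ∃[ (t , k) ] S (t ∷ c , k ∷ z))
    Mixed-project = bind (SetAlgebra.unionClosed Mixed-algebra)
      (projection-additive (λ (t , k) (c , z) → t ∷ c , k ∷ z))
      λ {S} (P , Q , FP , FQ , S⊆ , ⊆S) → Algebraᴹ.resp
        {S = λ (c , z) → (∃[ t ] P (t ∷ c)) × (∃[ k ] Q (k ∷ z))}
        {T = λ (c , z) → ∃[ (t , k) ] S (t ∷ c , k ∷ z)}
        ( (λ ((t , p) , k , q) → (t , k) , ⊆S (p , q))
        , (λ ((t , k) , s) → let p , q = S⊆ s in (t , p) , k , q) )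
        (product (RealPoly-project em FP) (Presburger-project em {S = Q} FQ))

    place : Vec ℝ n → Vec ℤ n → Vec ℝ n
    place c z = c +ⁿ fromℤⁿ z

    seq-place : ∀ (t : Term n) c z i →
                seq (⟦ t ⟧ (place c z)) i ≡ seq (⟦ t ⟧ c + fromℤ (evaluateᶻ t z)) i
    seq-place (var zero)    (x ∷ c) (k ∷ z) i = refl
    seq-place (var (suc j)) (x ∷ c) (k ∷ z) i = seq-place (var j) c z i
    seq-place (s ⊕ t)       c       z       i = trans (cong₂ ℚ._+_ (seq-place s c z i) (seq-place t c z i))
      (trans (solve 4 (λ a b c d → (a :+ b) :+ (c :+ d) := (a :+ c) :+ (b :+ d)) refl
                (seq (⟦ s ⟧ c) i) (toℚ (evaluateᶻ s z)) (seq (⟦ t ⟧ c) i) (toℚ (evaluateᶻ t z)))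
        (cong (λ u → seq (⟦ s ⟧ c) i ℚ.+ seq (⟦ t ⟧ c) i ℚ.+ u) (sym (toℚ-+ (evaluateᶻ s z) (evaluateᶻ t z)))))

    -- Counts variable occurrences. On the unit cube each of them contributes at most one, so this
    -- bounds the value of the term and thereby the offsets that have to be tried.
    size : Term n → ℕ
    size (var _) = 1
    size (s ⊕ t) = size s ℕ.+ size t

    term-bounds : ∀ (t : Term n) {c} → UnitCube c → 0ℝ ≤ ⟦ t ⟧ c × ⟦ t ⟧ c ≤ fromℤ (+ size t)
    term-bounds (var i) {c} c∈ = let 0≤x , x<1 = Vecᴬ.lookup⁺ c∈ i in
      0≤x , ≤-trans {Vec.lookup c i} {1ℝ} {fromℤ (+ 1)} (<⇒≤ {Vec.lookup c i} {1ℝ} x<1) (fromℚ-mono-≤ ℚ.≤-refl)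
    term-bounds (s ⊕ t) {c} c∈ =
      let 0≤s , s≤ = term-bounds s c∈ ; 0≤t , t≤ = term-bounds t c∈ in
      rel-≗ em false {0ℝ + 0ℝ} {⟦ s ⟧ c + ⟦ t ⟧ c} {0ℝ} {⟦ s ⟧ c + ⟦ t ⟧ c} (λ _ → refl) (λ _ → refl)
        (+-mono-≤ {0ℝ} {⟦ s ⟧ c} {0ℝ} {⟦ t ⟧ c} 0≤s 0≤t) ,
      rel-≗ em false {⟦ s ⟧ c + ⟦ t ⟧ c} {fromℤ (+ size s) + fromℤ (+ size t)} {⟦ s ⟧ c + ⟦ t ⟧ c} {fromℤ (+ (size s ℕ.+ size t))}
        (λ _ → refl) (λ _ → sym (toℚ-+ (+ size s) (+ size t)))
        (+-mono-≤ {⟦ s ⟧ c} {fromℤ (+ size s)} {⟦ t ⟧ c} {fromℤ (+ size t)} s≤ t≤)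

    range : ℕ → List ℤ
    range N = List.map (λ j → + j ℤ.- (+ N)) (List.upTo (suc (N ℕ.+ N)))

    ∈-range : ∀ N {k} → ℤ.- (+ N) ℤ.≤ k → k ℤ.≤ + N → k List∈.∈ range N
    ∈-range N {k} lo hi = subst (List∈._∈ range N) k≡
      (List∈.∈-map⁺ (λ j → + j ℤ.- (+ N)) (List∈.∈-upTo⁺ (ℕ.s≤s (ℤ.drop‿+≤+ j≤))))
      where
      0≤k+N : 0ℤ ℤ.≤ k ℤ.+ (+ N)
      0≤k+N = subst (ℤ._≤ k ℤ.+ (+ N)) (ℤ.+-inverseˡ (+ N)) (ℤ.+-monoˡ-≤ (+ N) lo)
      j≡ : + ℤ.∣ k ℤ.+ (+ N) ∣ ≡ k ℤ.+ (+ N)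
      j≡ = ℤ.0≤i⇒+∣i∣≡i 0≤k+N
      j≤ : + ℤ.∣ k ℤ.+ (+ N) ∣ ℤ.≤ + (N ℕ.+ N)
      j≤ = ℤ.≤-trans (ℤ.≤-reflexive j≡) (ℤ.+-monoˡ-≤ (+ N) hi)
      k≡ : + ℤ.∣ k ℤ.+ (+ N) ∣ ℤ.- (+ N) ≡ k
      k≡ = trans (cong (ℤ._- (+ N)) j≡) (solveᶻ 2 (λ k n → (k ⊞ᶻ n) ⊟ n ≔ k) refl k (+ N))

    +-cancelʳ : ∀ s x y z → rel s (x + z) (y + z) → rel s x y
    +-cancelʳ s x y z p = rel-≗ em s {x + z ⊖ z} {y + z ⊖ z} {x} {y} (λ i → undo (seq x i) (seq z i)) (λ i → undo (seq y i) (seq z i))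
      (rel-+ em s {x + z} {y + z} ((ℚ.- 1ℚ) · z) p)
      where
      undo : ∀ x z → x ℚ.+ z ℚ.+ (ℚ.- 1ℚ) ℚ.* z ≡ x
      undo = solve 2 (λ x z → x :+ z :+ con (ℚ.- 1ℚ) :* z := x) refl

    fromℤ-cancel-≤ : ∀ {a b} → fromℤ a ≤ fromℤ b → a ℤ.≤ b
    fromℤ-cancel-≤ = toℚ-cancel-≤ ∘ fromℚ-cancel-≤

    private
      difference-≤ : ∀ S T σ τ → S + fromℤ σ ≤ T + fromℤ τ → S ≤ T + fromℤ (τ ℤ.- σ)
      difference-≤ S T σ τ p = +-cancelʳ false S (T + fromℤ (τ ℤ.- σ)) (fromℤ σ)
        (rel-≗ em false {S + fromℤ σ} {T + fromℤ τ} {S + fromℤ σ} {T + fromℤ (τ ℤ.- σ) + fromℤ σ} (λ _ → refl) shifted p)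
        where
        τ≡ : τ ≡ (τ ℤ.- σ) ℤ.+ σ
        τ≡ = solveᶻ 2 (λ σ τ → τ ≔ (τ ⊟ σ) ⊞ᶻ σ) refl σ τ
        shifted : ∀ i → seq T i ℚ.+ toℚ τ ≡ seq T i ℚ.+ toℚ (τ ℤ.- σ) ℚ.+ toℚ σ
        shifted i = trans (cong (λ u → seq T i ℚ.+ u) (trans (cong toℚ τ≡) (toℚ-+ (τ ℤ.- σ) σ)))
          (sym (ℚ.+-assoc (seq T i) (toℚ (τ ℤ.- σ)) (toℚ σ)))

      0≤sum : ∀ T b D → T ≤ fromℤ b → 0ℝ ≤ T + fromℤ D → 0ℤ ℤ.≤ b ℤ.+ D
      0≤sum T b D T≤b p = fromℤ-cancel-≤ (≤-trans {0ℝ} {T + fromℤ D} {fromℤ (b ℤ.+ D)} p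
        (rel-≗ em false {T + fromℤ D} {fromℤ b + fromℤ D} {T + fromℤ D} {fromℤ (b ℤ.+ D)}
          (λ _ → refl) (λ _ → sym (toℚ-+ b D))
          (+-mono-≤ {T} {fromℤ b} {fromℤ D} {fromℤ D} T≤b (≤-refl {fromℤ D}))))

      ≤-add : ∀ T K → 0ℝ ≤ T → fromℤ K ≤ T + fromℤ K
      ≤-add T K 0≤T = rel-≗ em false {0ℝ + fromℤ K} {T + fromℤ K} {fromℤ K} {T + fromℤ K}
        (λ _ → ℚ.+-identityˡ (toℚ K)) (λ _ → refl)
        (+-mono-≤ {0ℝ} {T} {fromℤ K} {fromℤ K} 0≤T (≤-refl {fromℤ K}))

    -- Let `D = τ - σ`, so that `S ≤ T + D`. If `D ≤ a + b`, the offset is `D` itself, and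
    -- `0 ≤ S ≤ T + D ≤ b + D` bounds it from below. If `D` is larger, the offset `a + b` works,
    -- since `S ≤ a` and `0 ≤ T`: the weak condition `σ + k ≤ τ` absorbs all larger differences.
    to-shift : ∀ S T σ τ a b → 0ℝ ≤ S × S ≤ fromℤ (+ a) → 0ℝ ≤ T × T ≤ fromℤ (+ b) → S + fromℤ σ ≤ T + fromℤ τ →
               Any (λ k → (S ≤ T + fromℤ k) × (σ ℤ.+ k ℤ.≤ τ)) (range (a ℕ.+ b))
    to-shift S T σ τ a b (0≤S , S≤a) (0≤T , T≤b) p with τ ℤ.- σ ℤ.≤? + (a ℕ.+ b)
    ... | yes D≤K = List∈.lose (∈-range (a ℕ.+ b) -K≤D D≤K)
        (difference-≤ S T σ τ p , ℤ.≤-reflexive (solveᶻ 2 (λ σ τ → σ ⊞ᶻ (τ ⊟ σ) ≔ τ) refl σ τ))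
      where
      -K≤D : ℤ.- (+ (a ℕ.+ b)) ℤ.≤ τ ℤ.- σ
      -K≤D = ℤ.≤-trans (ℤ.neg-mono-≤ (ℤ.+≤+ (ℕ.m≤n+m b a)))
        (ℤ.0≤i-j⇒j≤i (subst (0ℤ ℤ.≤_) (solveᶻ 2 (λ T D → T ⊞ᶻ D ≔ D ⊟ (⊟ T)) refl (+ b) (τ ℤ.- σ))
          (0≤sum T (+ b) (τ ℤ.- σ) T≤b
            (≤-trans {0ℝ} {S} {T + fromℤ (τ ℤ.- σ)} 0≤S (difference-≤ S T σ τ p)))))
    ... | no D≰K = List∈.lose (∈-range (a ℕ.+ b) (ℤ.≤-trans (ℤ.neg-mono-≤ {0ℤ} (ℤ.+≤+ ℕ.z≤n)) (ℤ.+≤+ ℕ.z≤n)) ℤ.≤-refl)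
      ( ≤-trans {S} {fromℤ (+ (a ℕ.+ b))} {T + fromℤ (+ (a ℕ.+ b))}
          (≤-trans {S} {fromℤ (+ a)} {fromℤ (+ (a ℕ.+ b))} S≤a (fromℚ-mono-≤ (toℚ-mono-≤ {+ a} {+ (a ℕ.+ b)} (ℤ.+≤+ (ℕ.m≤m+n a b)))))
          (≤-add T (+ (a ℕ.+ b)) 0≤T)
      , subst (σ ℤ.+ (+ (a ℕ.+ b)) ℤ.≤_) (solveᶻ 2 (λ σ τ → σ ⊞ᶻ (τ ⊟ σ) ≔ τ) refl σ τ)
          (ℤ.+-monoʳ-≤ σ (ℤ.<⇒≤ (ℤ.≰⇒> D≰K))) )

    from-shift : ∀ S T σ τ k → S ≤ T + fromℤ k → σ ℤ.+ k ℤ.≤ τ → S + fromℤ σ ≤ T + fromℤ τ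
    from-shift S T σ τ k S≤T+k σ+k≤τ = ≤-trans {S + fromℤ σ} {T + fromℤ k + fromℤ σ} {T + fromℤ τ}
      (rel-+ em false {S} {T + fromℤ k} (fromℤ σ) S≤T+k)
      (rel-≗ em false {T + fromℤ (σ ℤ.+ k)} {T + fromℤ τ} {T + fromℤ k + fromℤ σ} {T + fromℤ τ}
        (λ i → trans (cong (λ u → seq T i ℚ.+ u) (trans (toℚ-+ σ k) (ℚ.+-comm (toℚ σ) (toℚ k))))
                 (sym (ℚ.+-assoc (seq T i) (toℚ k) (toℚ σ))))
        (λ _ → refl)
        (+-mono-≤ {T} {T} {fromℤ (σ ℤ.+ k)} {fromℤ τ} (≤-refl {T}) (fromℚ-mono-≤ (toℚ-mono-≤ σ+k≤τ))))

    module Comparison≤ (s t : Term n) where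

      AtomSet : Pred (Point n) 0ℓ
      AtomSet (c , z) = Any (λ k → (⟦ s ⟧ c ≤ ⟦ t ⟧ c + fromℤ k) × (evaluateᶻ s z ℤ.+ k ℤ.≤ evaluateᶻ t z))
                            (range (size s ℕ.+ size t))

      AtomSet-mixed : Mixed AtomSet
      AtomSet-mixed = Algebraᴹ.unions
        (λ k (c , z) → (⟦ s ⟧ c ≤ ⟦ t ⟧ c + fromℤ k) × (evaluateᶻ s z ℤ.+ k ℤ.≤ evaluateᶻ t z))
        (λ k → product
          (RealPoly-rel-≗ false (termᴬ s) (termᴬ t +ᴬ constᴬ (toℚ k)) ⟦ s ⟧ (λ c → ⟦ t ⟧ c + fromℤ k) (aff-term s)
            (λ c i → trans (aff-+ (termᴬ t) (constᴬ (toℚ k)) c i) (cong₂ ℚ._+_ (aff-term t c i) (aff-const (toℚ k) c i))))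
          (Algebraᶻ.resp ((λ {z} → 0≤⇒≤ k z) , (λ {z} → ≤⇒0≤ k z))
            (FinUnion⇒Presburger (halfᶻ (difference , ℤ.- k)))))
        (range (size s ℕ.+ size t))
        where
        difference : Vec ℤ n
        difference = coefficientsᶻ t +ᶻ -1ℤ *ᶻ coefficientsᶻ s
        value : ∀ k z → dotᶻ difference z ℤ.+ ℤ.- k ≡ evaluateᶻ t z ℤ.- (evaluateᶻ s z ℤ.+ k)
        value k z = begin
          dotᶻ difference z ℤ.+ ℤ.- k
            ≡⟨ cong (ℤ._+ ℤ.- k) (dotᶻ-+ˡ (coefficientsᶻ t) (-1ℤ *ᶻ coefficientsᶻ s) z) ⟩
          dotᶻ (coefficientsᶻ t) z ℤ.+ dotᶻ (-1ℤ *ᶻ coefficientsᶻ s) z ℤ.+ ℤ.- k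
            ≡⟨ cong₂ (λ u v → u ℤ.+ v ℤ.+ ℤ.- k) (dotᶻ-coefficients t z)
                 (trans (dotᶻ-*ˡ -1ℤ (coefficientsᶻ s) z) (cong (λ u → -1ℤ ℤ.* u) (dotᶻ-coefficients s z))) ⟩
          evaluateᶻ t z ℤ.+ -1ℤ ℤ.* evaluateᶻ s z ℤ.+ ℤ.- k
            ≡⟨ solveᶻ 3 (λ a b k → a ⊞ᶻ conᶻ -1ℤ ⊠ b ⊞ᶻ (⊟ k) ≔ a ⊟ (b ⊞ᶻ k)) refl (evaluateᶻ t z) (evaluateᶻ s z) k ⟩
          evaluateᶻ t z ℤ.- (evaluateᶻ s z ℤ.+ k) ∎
          where open ≡-Reasoning
        0≤⇒≤ : ∀ k z → ⟦ difference , ℤ.- k ⟧ᶻ z → evaluateᶻ s z ℤ.+ k ℤ.≤ evaluateᶻ t z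
        0≤⇒≤ k z 0≤ = ℤ.0≤i-j⇒j≤i (subst (0ℤ ℤ.≤_) (value k z) 0≤)
        ≤⇒0≤ : ∀ k z → evaluateᶻ s z ℤ.+ k ℤ.≤ evaluateᶻ t z → ⟦ difference , ℤ.- k ⟧ᶻ z
        ≤⇒0≤ k z le = subst (0ℤ ℤ.≤_) (sym (value k z)) (ℤ.i≤j⇒0≤j-i le)

      to-atom : ∀ c z → UnitCube c → ⟦ s ⟧ (place c z) ≤ ⟦ t ⟧ (place c z) → AtomSet (c , z)
      to-atom c z c∈ p = to-shift (⟦ s ⟧ c) (⟦ t ⟧ c) (evaluateᶻ s z) (evaluateᶻ t z) (size s) (size t)
        (term-bounds s c∈) (term-bounds t c∈)
        (rel-≗ em false {⟦ s ⟧ (place c z)} {⟦ t ⟧ (place c z)}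
          {⟦ s ⟧ c + fromℤ (evaluateᶻ s z)} {⟦ t ⟧ c + fromℤ (evaluateᶻ t z)} (seq-place s c z) (seq-place t c z) p)

      from-atom : ∀ c z → AtomSet (c , z) → ⟦ s ⟧ (place c z) ≤ ⟦ t ⟧ (place c z)
      from-atom c z some = let k , S≤T+k , σ+k≤τ = Any.satisfied {P = λ k → (⟦ s ⟧ c ≤ ⟦ t ⟧ c + fromℤ k) × (evaluateᶻ s z ℤ.+ k ℤ.≤ evaluateᶻ t z)} some in
        rel-≗ em false {⟦ s ⟧ c + fromℤ (evaluateᶻ s z)} {⟦ t ⟧ c + fromℤ (evaluateᶻ t z)} {⟦ s ⟧ (place c z)} {⟦ t ⟧ (place c z)}
          (λ i → sym (seq-place s c z i)) (λ i → sym (seq-place t c z i))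
          (from-shift (⟦ s ⟧ c) (⟦ t ⟧ c) (evaluateᶻ s z) (evaluateᶻ t z) k S≤T+k σ+k≤τ)

    module Integrality (t : Term n) where

      -- At `c + z` the term differs from its value at `c` by an integer, so integrality is a
      -- condition on `c` alone. The value at `c` is bounded, which leaves the integers in
      -- `range (size t)` as candidates.
      IntSet : Pred (Point n) 0ℓ
      IntSet (c , z) = Any (λ k → (⟦ t ⟧ c ≤ fromℤ k × fromℤ k ≤ ⟦ t ⟧ c) × U z) (range (size t))

      IntSet-mixed : Mixed IntSet
      IntSet-mixed = Algebraᴹ.unions (λ k (c , z) → (⟦ t ⟧ c ≤ fromℤ k × fromℤ k ≤ ⟦ t ⟧ c) × U z)
        (λ k → product (Algebraᴿ.inter
          (RealPoly-rel-≗ false (termᴬ t) (constᴬ (toℚ k)) ⟦ t ⟧ (λ _ → fromℤ k) (aff-term t) (aff-const (toℚ k)))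
          (RealPoly-rel-≗ false (constᴬ (toℚ k)) (termᴬ t) (λ _ → fromℤ k) ⟦ t ⟧ (aff-const (toℚ k)) (aff-term t)))
          Algebraᶻ.full)
        (range (size t))

      private
        shift : ∀ s T σ m → rel s (T + fromℤ σ) (fromℤ m) → rel s T (fromℤ (m ℤ.- σ))
        shift s T σ m p = +-cancelʳ s T (fromℤ (m ℤ.- σ)) (fromℤ σ)
          (rel-≗ em s {T + fromℤ σ} {fromℤ m} {T + fromℤ σ} {fromℤ (m ℤ.- σ) + fromℤ σ} (λ _ → refl)
            (λ _ → trans (cong toℚ (solveᶻ 2 (λ σ m → m ≔ (m ⊟ σ) ⊞ᶻ σ) refl σ m)) (toℚ-+ (m ℤ.- σ) σ)) p)

        shift′ : ∀ s T σ m → rel s (fromℤ m) (T + fromℤ σ) → rel s (fromℤ (m ℤ.- σ)) T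
        shift′ s T σ m p = +-cancelʳ s (fromℤ (m ℤ.- σ)) T (fromℤ σ)
          (rel-≗ em s {fromℤ m} {T + fromℤ σ} {fromℤ (m ℤ.- σ) + fromℤ σ} {T + fromℤ σ}
            (λ _ → trans (cong toℚ (solveᶻ 2 (λ σ m → m ≔ (m ⊟ σ) ⊞ᶻ σ) refl σ m)) (toℚ-+ (m ℤ.- σ) σ)) (λ _ → refl) p)

        bounded-integer : ∀ T N k → 0ℝ ≤ T × T ≤ fromℤ (+ N) → T ≤ fromℤ k × fromℤ k ≤ T → k List∈.∈ range N
        bounded-integer T N k (0≤T , T≤N) (T≤k , k≤T) = ∈-range N
          (ℤ.≤-trans (ℤ.neg-mono-≤ {0ℤ} (ℤ.+≤+ ℕ.z≤n)) (fromℤ-cancel-≤ (≤-trans {0ℝ} {T} {fromℤ k} 0≤T T≤k)))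
          (fromℤ-cancel-≤ (≤-trans {fromℤ k} {T} {fromℤ (+ N)} k≤T T≤N))

      to-int : ∀ c z → UnitCube c → IsInteger (⟦ t ⟧ (place c z)) → IntSet (c , z)
      to-int c z c∈ (m , T≈m) = List∈.lose (bounded-integer (⟦ t ⟧ c) (size t) (m ℤ.- evaluateᶻ t z) (term-bounds t c∈) close)
        (close , tt)
        where
        close : ⟦ t ⟧ c ≤ fromℤ (m ℤ.- evaluateᶻ t z) × fromℤ (m ℤ.- evaluateᶻ t z) ≤ ⟦ t ⟧ c
        close =
          shift false (⟦ t ⟧ c) (evaluateᶻ t z) m
            (rel-≗ em false {⟦ t ⟧ (place c z)} {fromℤ m} {⟦ t ⟧ c + fromℤ (evaluateᶻ t z)} {fromℤ m} (seq-place t c z) (λ _ → refl)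
              (≈⇒≤ {⟦ t ⟧ (place c z)} {fromℤ m} T≈m)) ,
          shift′ false (⟦ t ⟧ c) (evaluateᶻ t z) m
            (rel-≗ em false {fromℤ m} {⟦ t ⟧ (place c z)} {fromℤ m} {⟦ t ⟧ c + fromℤ (evaluateᶻ t z)} (λ _ → refl) (seq-place t c z)
              (≈⇒≥ {⟦ t ⟧ (place c z)} {fromℤ m} T≈m))

      from-int : ∀ c z → IntSet (c , z) → IsInteger (⟦ t ⟧ (place c z))
      from-int c z some =
        let k , (T≤k , k≤T) , _ = Any.satisfied {P = λ k → (⟦ t ⟧ c ≤ fromℤ k × fromℤ k ≤ ⟦ t ⟧ c) × U z} some in
        k ℤ.+ evaluateᶻ t z , ≤-antisym {⟦ t ⟧ (place c z)} {fromℤ (k ℤ.+ evaluateᶻ t z)}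
          (rel-≗ em false {⟦ t ⟧ c + fromℤ (evaluateᶻ t z)} {fromℤ k + fromℤ (evaluateᶻ t z)} {⟦ t ⟧ (place c z)} {fromℤ (k ℤ.+ evaluateᶻ t z)}
            (λ i → sym (seq-place t c z i)) (λ _ → sym (toℚ-+ k (evaluateᶻ t z)))
            (rel-+ em false {⟦ t ⟧ c} {fromℤ k} (fromℤ (evaluateᶻ t z)) T≤k))
          (rel-≗ em false {fromℤ k + fromℤ (evaluateᶻ t z)} {⟦ t ⟧ c + fromℤ (evaluateᶻ t z)} {fromℤ (k ℤ.+ evaluateᶻ t z)} {⟦ t ⟧ (place c z)}
            (λ _ → sym (toℚ-+ k (evaluateᶻ t z))) (λ i → sym (seq-place t c z i))
            (rel-+ em false {fromℤ k} {⟦ t ⟧ c} (fromℤ (evaluateᶻ t z)) k≤T))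

    +-cong : ∀ {x y u v} → x ≈ y → u ≈ v → x + u ≈ y + v
    +-cong {x} {y} {u} {v} p q = ≤-antisym {x + u} {y + v}
      (+-mono-≤ {x} {y} {u} {v} (≈⇒≤ {x} {y} p) (≈⇒≤ {u} {v} q))
      (+-mono-≤ {y} {x} {v} {u} (≈⇒≥ {x} {y} p) (≈⇒≥ {u} {v} q))

    ⟦⟧-cong : ∀ (t : Term n) {x y} → x ≈ⁿ y → ⟦ t ⟧ x ≈ ⟦ t ⟧ y
    ⟦⟧-cong (var zero)    (p ∷ _)  = p
    ⟦⟧-cong (var (suc i)) (_ ∷ ps) = ⟦⟧-cong (var i) ps
    ⟦⟧-cong (s ⊕ t) {x} {y} ps = +-cong {⟦ s ⟧ x} {⟦ s ⟧ y} {⟦ t ⟧ x} {⟦ t ⟧ y} (⟦⟧-cong s ps) (⟦⟧-cong t ps)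

    ≈ⁿ-refl : ∀ {x : Vec ℝ n} → x ≈ⁿ x
    ≈ⁿ-refl {x = []}    = []
    ≈ⁿ-refl {x = x ∷ _} = ≈-refl {x} ∷ ≈ⁿ-refl

    ≈ⁿ-sym : ∀ {x y : Vec ℝ n} → x ≈ⁿ y → y ≈ⁿ x
    ≈ⁿ-sym []                         = []
    ≈ⁿ-sym (_∷_ {x = x} {y = y} p ps) = ≈-sym {x} {y} p ∷ ≈ⁿ-sym ps

    -- Negation and implication reverse the direction; the induction passes through them because
    -- `≈ⁿ` is symmetric.
    ⊨-resp : ∀ (φ : Formula n) {x y} → x ≈ⁿ y → (x ⊨ φ) → y ⊨ φ
    ⊨-resp (s ≤ᶠ t) {x} {y} e p = rel-resp em false {⟦ s ⟧ x} {⟦ t ⟧ x} {⟦ s ⟧ y} {⟦ t ⟧ y} (⟦⟧-cong s e) (⟦⟧-cong t e) p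
    ⊨-resp (s ≈ᶠ t) {x} {y} e p = ≈-trans {⟦ s ⟧ y} {⟦ s ⟧ x} {⟦ t ⟧ y} (≈-sym {⟦ s ⟧ x} {⟦ s ⟧ y} (⟦⟧-cong s e))
      (≈-trans {⟦ s ⟧ x} {⟦ t ⟧ x} {⟦ t ⟧ y} p (⟦⟧-cong t e))
    ⊨-resp (isInt t) {x} {y} e (m , p) = m , ≈-trans {⟦ t ⟧ y} {⟦ t ⟧ x} {fromℤ m} (≈-sym {⟦ t ⟧ x} {⟦ t ⟧ y} (⟦⟧-cong t e)) p
    ⊨-resp (¬ᶠ φ) e ¬p q = ¬p (⊨-resp φ (≈ⁿ-sym e) q)
    ⊨-resp (φ ∧ᶠ ψ) e (p , q) = ⊨-resp φ e p , ⊨-resp ψ e q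
    ⊨-resp (φ ∨ᶠ ψ) e (inj₁ p) = inj₁ (⊨-resp φ e p)
    ⊨-resp (φ ∨ᶠ ψ) e (inj₂ q) = inj₂ (⊨-resp ψ e q)
    ⊨-resp (φ ⇒ᶠ ψ) e f p = ⊨-resp ψ e (f (⊨-resp φ (≈ⁿ-sym e) p))
    ⊨-resp (∃ᶠ φ) e (r , p) = r , ⊨-resp φ (≈-refl {r} ∷ e) p
    ⊨-resp (∀ᶠ φ) e f r = ⊨-resp φ (≈-refl {r} ∷ e) (f r)

    toℚ-suc : ∀ k → toℚ (ℤ.suc k) ≡ 1ℚ ℚ.+ toℚ k
    toℚ-suc k = trans (cong toℚ {ℤ.suc k} {1ℤ ℤ.+ k} refl)
      (trans (toℚ-+ 1ℤ k) (cong (λ u → u ℚ.+ toℚ k) {toℚ 1ℤ} {1ℚ} refl))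

    split-real : ∀ r → ∃[ t ] ∃[ k ] ((0ℝ ≤ t × t < 1ℝ) × r ≈ t + fromℤ k)
    split-real r = let k , k≤r , r<1+k = floor r in
      r ⊖ fromℤ k , k ,
      ( rel⇒0 em false {fromℤ k} {r} k≤r
      , +-cancelʳ true (r ⊖ fromℤ k) 1ℝ (fromℤ k)
          (rel-≗ em true {r} {fromℤ (ℤ.suc k)} {(r ⊖ fromℤ k) + fromℤ k} {1ℝ + fromℤ k}
            (λ i → sym (restore (seq r i) (toℚ k))) (λ _ → toℚ-suc k) r<1+k) ) ,
      ≗⇒≈ {r} {(r ⊖ fromℤ k) + fromℤ k} (λ i → sym (restore (seq r i) (toℚ k)))
      where
      restore : ∀ r k → r ℚ.+ (ℚ.- 1ℚ) ℚ.* k ℚ.+ k ≡ r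
      restore = solve 2 (λ r k → r :+ con (ℚ.- 1ℚ) :* k :+ k := r) refl

    place-∷ : ∀ {r : ℝ} {x : Vec ℝ n} t k {c z} → r ≈ t + fromℤ k → x ≈ⁿ place c z →
              r ∷ x ≈ⁿ place (t ∷ c) (k ∷ z)
    place-∷ {r = r} t k r≈ x≈ = _∷_ {x = r} {y = t + fromℤ k} r≈ x≈

    private
      cons-split : ∀ (r : ℝ) (x : Vec ℝ n) → ∃[ t ] ∃[ k ] ((0ℝ ≤ t × t < 1ℝ) × r ≈ t + fromℤ k) →
                   ∃[ c ] ∃[ z ] (UnitCube c × x ≈ⁿ place c z) →
                   ∃[ c ] ∃[ z ] (UnitCube c × r ∷ x ≈ⁿ place c z)
      cons-split r x (t , k , t∈ , r≈) (c , z , c∈ , x≈) = t ∷ c , k ∷ z , t∈ Vecᴬ.∷ c∈ , place-∷ t k r≈ x≈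

    split-vector : ∀ (x : Vec ℝ n) → ∃[ c ] ∃[ z ] (UnitCube c × x ≈ⁿ place c z)
    split-vector []      = [] , [] , Vecᴬ.[] , []
    split-vector (r ∷ x) = cons-split r x (split-real r) (split-vector x)

    -- Agreement is demanded only for `c` in the cube, where finitely many offsets suffice for the
    -- atoms. Both implications are kept, because negation interchanges them.
    MixedForm : Formula n → Set₁
    MixedForm {n} φ = Σ[ D ∈ Pred (Point n) 0ℓ ] Mixed D ×
      (∀ c z → UnitCube c → (place c z ⊨ φ) → D (c , z)) × (∀ c z → UnitCube c → D (c , z) → place c z ⊨ φ)

    -- A witness `r` is split as `t + k`. The cube condition on `t ∷ c` is imposed before
    -- projecting, because `D` is tied to `φ` only inside the cube.
    form-∃ : ∀ (φ : Formula (suc n)) → MixedForm φ → MixedForm (∃ᶠ φ)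
    form-∃ φ (D , D-mixed , to , from) =
      (λ (c , z) → ∃[ (t , k) ] (UnitCube (t ∷ c) × U (k ∷ z)) × D (t ∷ c , k ∷ z)) ,
      Mixed-project (Algebraᴹ.inter (product RealPoly-cube Algebraᶻ.full) D-mixed) ,
      (λ c z c∈ (r , p) → witness c z c∈ r p (split-real r)) ,
      (λ c z c∈ ((t , k) , (tc∈ , _) , d) → t + fromℤ k , from (t ∷ c) (k ∷ z) tc∈ d)
      where
      witness : ∀ c z → UnitCube c → ∀ r → (r ∷ place c z ⊨ φ) → ∃[ t ] ∃[ k ] ((0ℝ ≤ t × t < 1ℝ) × r ≈ t + fromℤ k) →
                ∃[ (t , k) ] (UnitCube (t ∷ c) × U (k ∷ z)) × D (t ∷ c , k ∷ z)
      witness c z c∈ r p (t , k , t∈ , r≈) = (t , k) , (t∈ Vecᴬ.∷ c∈ , tt) ,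
        to (t ∷ c) (k ∷ z) (t∈ Vecᴬ.∷ c∈) (⊨-resp φ (place-∷ t k r≈ ≈ⁿ-refl) p)

    form-¬ : ∀ (φ : Formula n) → MixedForm φ → MixedForm (¬ᶠ φ)
    form-¬ φ (D , D-mixed , to , from) = ∁ D , Algebraᴹ.compl D-mixed ,
      (λ c z c∈ ¬p d → ¬p (from c z c∈ d)) , (λ c z c∈ ¬d p → ¬d (to c z c∈ p))

    form-∧ : ∀ (φ ψ : Formula n) → MixedForm φ → MixedForm ψ → MixedForm (φ ∧ᶠ ψ)
    form-∧ φ ψ (D , D-mixed , toD , fromD) (E , E-mixed , toE , fromE) = D ∩ E , Algebraᴹ.inter D-mixed E-mixed ,
      (λ c z c∈ (p , q) → toD c z c∈ p , toE c z c∈ q) , (λ c z c∈ (p , q) → fromD c z c∈ p , fromE c z c∈ q)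

    form-∨ : ∀ (φ ψ : Formula n) → MixedForm φ → MixedForm ψ → MixedForm (φ ∨ᶠ ψ)
    form-∨ φ ψ (D , D-mixed , toD , fromD) (E , E-mixed , toE , fromE) = D ∪ E , Algebraᴹ.union D-mixed E-mixed ,
      (λ c z c∈ → Sum.map (toD c z c∈) (toE c z c∈)) , (λ c z c∈ → Sum.map (fromD c z c∈) (fromE c z c∈))

    form-≤ : ∀ (s t : Term n) → MixedForm (s ≤ᶠ t)
    form-≤ s t = AtomSet , AtomSet-mixed , to-atom , (λ c z _ → from-atom c z)
      where open Comparison≤ s t

    form-isInt : ∀ (t : Term n) → MixedForm (isInt t)
    form-isInt t = IntSet , IntSet-mixed , to-int , (λ c z _ → from-int c z)
      where open Integrality t

    form-equivalent : ∀ (φ ψ : Formula n) → (∀ x → (x ⊨ φ) → x ⊨ ψ) → (∀ x → (x ⊨ ψ) → x ⊨ φ) →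
                      MixedForm φ → MixedForm ψ
    form-equivalent φ ψ φ⇒ψ ψ⇒φ (D , D-mixed , to , from) = D , D-mixed ,
      (λ c z c∈ q → to c z c∈ (ψ⇒φ (place c z) q)) , (λ c z c∈ d → φ⇒ψ (place c z) (from c z c∈ d))

    double-negation : {A : Set} → ¬ ¬ A → A
    double-negation {A} ¬¬a with em {A}
    ... | yes a = a
    ... | no ¬a = ⊥-elim (¬¬a ¬a)

    form : ∀ (φ : Formula n) → MixedForm φ
    form (s ≤ᶠ t)  = form-≤ s t
    form (s ≈ᶠ t)  = form-equivalent (s ≤ᶠ t ∧ᶠ t ≤ᶠ s) (s ≈ᶠ t)
      (λ x (p , q) → ≤-antisym {⟦ s ⟧ x} {⟦ t ⟧ x} p q)
      (λ x p → ≈⇒≤ {⟦ s ⟧ x} {⟦ t ⟧ x} p , ≈⇒≥ {⟦ s ⟧ x} {⟦ t ⟧ x} p)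
      (form-∧ (s ≤ᶠ t) (t ≤ᶠ s) (form-≤ s t) (form-≤ t s))
    form (isInt t) = form-isInt t
    form (¬ᶠ φ)    = form-¬ φ (form φ)
    form (φ ∧ᶠ ψ)  = form-∧ φ ψ (form φ) (form ψ)
    form (φ ∨ᶠ ψ)  = form-∨ φ ψ (form φ) (form ψ)
    form (φ ⇒ᶠ ψ)  = form-equivalent (¬ᶠ (φ ∧ᶠ (¬ᶠ ψ))) (φ ⇒ᶠ ψ)
      (λ x f p → double-negation (λ ¬q → f (p , ¬q))) (λ x f (p , ¬q) → ¬q (f p))
      (form-¬ (φ ∧ᶠ (¬ᶠ ψ)) (form-∧ φ (¬ᶠ ψ) (form φ) (form-¬ ψ (form ψ))))
    form (∃ᶠ φ)    = form-∃ φ (form φ)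
    form (∀ᶠ φ)    = form-equivalent (¬ᶠ (∃ᶠ (¬ᶠ φ))) (∀ᶠ φ)
      (λ x f r → double-negation (λ ¬p → f (r , ¬p))) (λ x f (r , ¬p) → ¬p (f r))
      (form-¬ (∃ᶠ (¬ᶠ φ)) (form-∃ (¬ᶠ φ) (form-¬ φ (form φ))))

-- From products to polinear sets

module PolinearDecomposition where

  open Defs
  open RealNumbers
  open FiniteUnions
  open SemilinearSets using (IsLinear; Semilinear; Presburger⇒Semilinear)
  open RealPolyhedra
  open MixedSets

  private
    variable
      n : ℕ

  open +-*-Solver using (solve; _:=_; _:+_; _:-_; :-_)

  IsSemiPolinear-resp : ∀ {ℓ ℓ′} {S : Pred (Vec ℝ n) ℓ} {T : Pred (Vec ℝ n) ℓ′} →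
                        S ≐ T → IsSemiPolinear S → IsSemiPolinear T
  IsSemiPolinear-resp (S⊆T , T⊆S) (k , L , polinear , S⊆ , ⊆S) = k , L , polinear , S⊆ ∘ T⊆S , S⊆T ∘ ⊆S

  IsSemiPolinear-unionClosed : UnionClosed (IsSemiPolinear {n} {0ℓ})
  IsSemiPolinear-unionClosed {n} = record
    { resp  = IsSemiPolinear-resp
    ; empty = 0 , (λ ()) , (λ ()) , (λ ()) , λ ()
    ; union = union
    }
    where
    union : ∀ {S T : Pred (Vec ℝ n) 0ℓ} → IsSemiPolinear S → IsSemiPolinear T → IsSemiPolinear (S ∪ T)
    union {S} {T} (k , L , L-polinear , S⊆ , ⊆S) (l , M , M-polinear , T⊆ , ⊆T) =
      k ℕ.+ l , (λ i → [ L , M ]′ (splitAt k i)) , polinear , to , from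
      where
      polinear-by : ∀ u → IsPolinear ([ L , M ]′ u)
      polinear-by (inj₁ j) = L-polinear j
      polinear-by (inj₂ j) = M-polinear j
      polinear : ∀ i → IsPolinear ([ L , M ]′ (splitAt k i))
      polinear i = polinear-by (splitAt k i)
      to : S ∪ T ⊆ ⋃ (Fin (k ℕ.+ l)) (λ i → [ L , M ]′ (splitAt k i))
      to {x} (inj₁ s) = let j , x∈ = S⊆ s in j ↑ˡ l , subst (λ u → [ L , M ]′ u x) (sym (Fin.splitAt-↑ˡ k j l)) x∈
      to {x} (inj₂ t) = let j , x∈ = T⊆ t in k ↑ʳ j , subst (λ u → [ L , M ]′ u x) (sym (Fin.splitAt-↑ʳ k l j)) x∈
      from-by : ∀ {x} u → [ L , M ]′ u x → (S ∪ T) x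
      from-by (inj₁ j) x∈ = inj₁ (⊆S (j , x∈))
      from-by (inj₂ j) x∈ = inj₂ (⊆T (j , x∈))
      from : ⋃ (Fin (k ℕ.+ l)) (λ i → [ L , M ]′ (splitAt k i)) ⊆ S ∪ T
      from (i , x∈) = from-by (splitAt k i) x∈

  IsPolinear⇒IsSemiPolinear : ∀ {S : Pred (Vec ℝ n) 0ℓ} → IsPolinear S → IsSemiPolinear S
  IsPolinear⇒IsSemiPolinear {S = S} polinear = 1 , (λ _ → S) , (λ _ → polinear) , (λ s → zero , s) , proj₂

  comparison : Bool → Comparison
  comparison false = ge
  comparison true  = gt

  compare-comparison : ∀ s {x y} → (rel s y x → compare (comparison s) x y) × (compare (comparison s) x y → rel s y x)
  compare-comparison false = id , id
  compare-comparison true  = id , id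

  constraint : RHalf n → Constraint n
  constraint (s , α , β) = α , comparison s , ℚ.- β

  module _ (em : ExcludedMiddle 0ℓ) where

    constraint-to : ∀ (h : RHalf n) c → ⟦ h ⟧ᴿ c → Satisfies c (constraint h)
    constraint-to (s , α , β) c p = proj₁ (compare-comparison s {linear α c} {fromℚ (ℚ.- β)})
      (rel-≗ em s {0ℝ + fromℚ (ℚ.- β)} {linear α c + fromℚ β + fromℚ (ℚ.- β)} {fromℚ (ℚ.- β)} {linear α c}
        (λ _ → ℚ.+-identityˡ (ℚ.- β)) (λ i → undo (seq (linear α c) i))
        (rel-+ em s {0ℝ} {linear α c + fromℚ β} (fromℚ (ℚ.- β)) p))
      where
      undo : ∀ l → l ℚ.+ β ℚ.+ ℚ.- β ≡ l
      undo l = solve 2 (λ l b → l :+ b :+ :- b := l) refl l β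

    constraint-from : ∀ (h : RHalf n) c → Satisfies c (constraint h) → ⟦ h ⟧ᴿ c
    constraint-from (s , α , β) c p = rel-≗ em s {fromℚ (ℚ.- β) + fromℚ β} {linear α c + fromℚ β} {0ℝ} {linear α c + fromℚ β}
      (λ _ → ℚ.+-inverseˡ β) (λ _ → refl)
      (rel-+ em s {fromℚ (ℚ.- β)} {linear α c} (fromℚ β) (proj₂ (compare-comparison s {linear α c} {fromℚ (ℚ.- β)}) p))

    RPoly⇒IsPolyhedralConvex : ∀ {C : Pred (Vec ℝ n) 0ℓ} → RPoly C → IsPolyhedralConvex C
    RPoly⇒IsPolyhedralConvex (hs , C⊆ , ⊆C) = List.map constraint hs ,
      (λ {c} c∈ → All.map⁺ (All.map (λ {h} → constraint-to h c) (C⊆ c∈))) ,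
      (λ {c} all → ⊆C (All.map (λ {h} → constraint-from h c) (All.map⁻ all)))

    -- A polinear set requires a nonempty `C`, so an empty `P` is represented by the empty union
    -- instead; excluded middle decides which case holds.
    polinear-product : ∀ {P : Pred (Vec ℝ n) 0ℓ} {Q : Pred (Vec ℤ n) 0ℓ} → P ⊆ UnitCube → RPoly P → IsLinear Q →
                       IsSemiPolinear (P ⊞ Q)
    polinear-product {n} {P = P} {Q} P⊆cube P-poly (b , G , Q⊆ , ⊆Q) = decide em
      where
      decide : Dec (∃[ c ] P c) → IsSemiPolinear (P ⊞ Q)
      decide (yes nonempty) = IsPolinear⇒IsSemiPolinear
        ( P , b , (G *) , RPoly⇒IsPolyhedralConvex P-poly , nonempty , P⊆cube , (G , id , id)
        , (λ (c , z , p , q , x≈) → c , z , p , Q⊆ q , x≈) , (λ (c , z , p , q , x≈) → c , z , p , ⊆Q q , x≈) )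
      decide (no ¬nonempty) = IsSemiPolinear-resp ((λ ()) , λ (c , z , p , _) → ⊥-elim (¬nonempty (c , p)))
        (UnionClosed.empty IsSemiPolinear-unionClosed)

    -- Recursion rather than `bind`, so that the pieces are known to lie in the cube.
    product-semipolinear : ∀ {P : Pred (Vec ℝ n) 0ℓ} {Q : Pred (Vec ℤ n) 0ℓ} → P ⊆ UnitCube → FinUnion RPoly P →
                           Semilinear Q → IsSemiPolinear (P ⊞ Q)
    product-semipolinear {P = P} P⊆ (one P-poly) FQ = bind IsSemiPolinear-unionClosed
      (record { mono = λ S⊆T (c , z , p , q , x≈) → c , z , p , S⊆T q , x≈
              ; nil  = λ ()
              ; cup  = λ { (c , z , p , inj₁ q , x≈) → inj₁ (c , z , p , q , x≈)
                         ; (c , z , p , inj₂ q , x≈) → inj₂ (c , z , p , q , x≈) } })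
      (λ {Q} → polinear-product {P = P} {Q} P⊆ P-poly) FQ
    product-semipolinear P⊆ (none ¬P) FQ = IsSemiPolinear-resp
      ((λ ()) , λ (c , _ , p , _) → ⊥-elim (¬P c p)) (UnionClosed.empty IsSemiPolinear-unionClosed)
    product-semipolinear {P = P} {Q} P⊆ (join {P₁} {P₂} F₁ F₂ (P⊆∪ , ∪⊆P)) FQ = IsSemiPolinear-resp
      ( (λ { (inj₁ (c , z , p , q , x≈)) → c , z , ∪⊆P (inj₁ p) , q , x≈
           ; (inj₂ (c , z , p , q , x≈)) → c , z , ∪⊆P (inj₂ p) , q , x≈ })
      , (λ (c , z , p , q , x≈) → Sum.map (λ p → c , z , p , q , x≈) (λ p → c , z , p , q , x≈) (P⊆∪ p)) )
      (UnionClosed.union IsSemiPolinear-unionClosed {P₁ ⊞ Q} {P₂ ⊞ Q}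
        (product-semipolinear {P = P₁} {Q} (λ p → P⊆ (∪⊆P (inj₁ p))) F₁ FQ)
        (product-semipolinear {P = P₂} {Q} (λ p → P⊆ (∪⊆P (inj₂ p))) F₂ FQ))

    Realised : Pred (Vec ℝ n × Vec ℤ n) 0ℓ → Pred (Vec ℝ n) 0ℓ
    Realised D x = ∃[ c ] ∃[ z ] ((UnitCube c × D (c , z)) × x ≈ⁿ c +ⁿ fromℤⁿ z)

    -- The cube is itself a polyhedron, so every real factor may be intersected with it, while the
    -- integral factor is replaced by a union of linear sets.
    Mixed⇒IsSemiPolinear : {D : Pred (Vec ℝ n × Vec ℤ n) 0ℓ} → Mixed em D → IsSemiPolinear (Realised D)
    Mixed⇒IsSemiPolinear = bind {F = Realised} IsSemiPolinear-unionClosed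
      (record { mono = λ S⊆T (c , z , (c∈ , d) , x≈) → c , z , (c∈ , S⊆T d) , x≈
              ; nil  = λ ()
              ; cup  = λ { (c , z , (c∈ , inj₁ d) , x≈) → inj₁ (c , z , (c∈ , d) , x≈)
                         ; (c , z , (c∈ , inj₂ d) , x≈) → inj₂ (c , z , (c∈ , d) , x≈) } })
      λ {D} (P , Q , FP , FQ , D⊆ , ⊆D) → IsSemiPolinear-resp {S = (P ∩ UnitCube) ⊞ Q} {T = Realised D}
        ( (λ (c , z , (p , c∈) , q , x≈) → c , z , (c∈ , ⊆D (p , q)) , x≈)
        , (λ (c , z , (c∈ , d) , x≈) → let p , q = D⊆ d in c , z , (p , c∈) , q , x≈) )
        (product-semipolinear {P = P ∩ UnitCube} {Q} proj₂
          (SetAlgebra.inter (RealPoly-algebra em) FP (RealPoly-cube em)) (Presburger⇒Semilinear em {S = Q} FQ))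

    IsMixedLinear⇒IsSemiPolinear : ∀ {ℓ} {S : Pred (Vec ℝ n) ℓ} → IsMixedLinear S → IsSemiPolinear S
    IsMixedLinear⇒IsSemiPolinear (φ , S⊆ , ⊆S) = IsSemiPolinear-resp
      ( (λ {x} (c , z , (c∈ , d) , x≈) → ⊆S (⊨-resp em φ (≈ⁿ-sym em x≈) (from c z c∈ d)))
      , (λ {x} s → realise x (S⊆ s)) )
      (Mixed⇒IsSemiPolinear D-mixed)
      where
      D = proj₁ (form em φ)
      D-mixed = proj₁ (proj₂ (form em φ))
      to = proj₁ (proj₂ (proj₂ (form em φ)))
      from = proj₂ (proj₂ (proj₂ (form em φ)))
      realise-split : ∀ x → ∃[ c ] ∃[ z ] (UnitCube c × x ≈ⁿ place em c z) → (x ⊨ φ) → Realised D x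
      realise-split x (c , z , c∈ , x≈) p = c , z , (c∈ , to c z c∈ (⊨-resp em φ x≈ p)) , x≈
      realise : ∀ x → (x ⊨ φ) → Realised D x
      realise x = realise-split x (split-vector em x)

-- Formulas that define semi-polinear sets

module DefiningFormulas where

  open Defs
  open Pointwise using ([]; _∷_)
  open RealNumbers
  open IntegerSets using (_*ᶻ_)
  open RealPolyhedra
  open MixedSets

  private
    variable
      k m n : ℕ

  open +-*-Solver using (solve; _:=_; _:+_; _:*_; _:-_; :-_; con)

  positiveℚ : ∀ d → ℚ.Positive (toℚ ℤ.+[1+ d ])
  positiveℚ d = ℚ.positive (toℚ-mono-< {0ℤ} {ℤ.+[1+ d ]} (ℤ.+<+ (ℕ.s≤s ℕ.z≤n)))

  ↧*p≡↥ : ∀ p → toℚ (ℚ.↧ p) ℚ.* p ≡ toℚ (ℚ.↥ p)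
  ↧*p≡↥ p@(ℚ.mkℚ n d _) = ℚ.toℚᵘ-injective (begin
    ℚ.toℚᵘ (toℚ (ℚ.↧ p) ℚ.* p)              ≈⟨ ℚ.toℚᵘ-homo-* (toℚ (ℚ.↧ p)) p ⟩
    ℚ.toℚᵘ (toℚ (ℚ.↧ p)) ℚᵘ.* ℚᵘ.mkℚᵘ n d   ≈⟨ ℚᵘ.*-congʳ {ℚᵘ.mkℚᵘ n d} (ℚ.toℚᵘ-fromℚᵘ (ℚᵘ.mkℚᵘ (ℚ.↧ p) 0)) ⟩
    ℚᵘ.mkℚᵘ (ℚ.↧ p) 0 ℚᵘ.* ℚᵘ.mkℚᵘ n d      ≈⟨ ℚᵘ.*≡* cross ⟩
    ℚᵘ.mkℚᵘ n 0                             ≈⟨ ℚ.toℚᵘ-fromℚᵘ (ℚᵘ.mkℚᵘ n 0) ⟨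
    ℚ.toℚᵘ (toℚ (ℚ.↥ p))                    ∎)
    where
    open ℚᵘ.≃-Reasoning
    cross : (+ suc d ℤ.* n) ℤ.* 1ℤ ≡ n ℤ.* (+ (1 ℕ.* suc d))
    cross = trans (ℤ.*-identityʳ (+ suc d ℤ.* n)) (trans (ℤ.*-comm (+ suc d) n)
      (cong (λ e → n ℤ.* (+ e)) (sym (ℕ.*-identityˡ (suc d)))))

  -- Terms have neither subtraction nor negative multiples, so the negative part of a numerator is
  -- carried to the other side of an equation.
  positive-part negative-part : ℤ → ℕ
  positive-part (+ k)      = k
  positive-part ℤ.-[1+ _ ] = 0
  negative-part (+ _)      = 0
  negative-part ℤ.-[1+ k ] = suc k

  positive-negative : ∀ z → toℚ z ℚ.+ toℚ (+ negative-part z) ≡ toℚ (+ positive-part z)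
  positive-negative z = trans (sym (toℚ-+ z (+ negative-part z))) (cong toℚ (parts z))
    where
    parts : ∀ z → z ℤ.+ (+ negative-part z) ≡ + positive-part z
    parts (+ k)      = ℤ.+-identityʳ (+ k)
    parts ℤ.-[1+ k ] = ℤ.+-inverseˡ (+ suc k)

  -- The signature has no constant 0, so the copies of t are added to a base term e.
  add : ℕ → Term n → Term n → Term n
  add zero    t e = e
  add (suc k) t e = add k t e ⊕ t

  seq-add : ∀ k (t e : Term n) ρ i → seq (⟦ add k t e ⟧ ρ) i ≡ seq (⟦ e ⟧ ρ) i ℚ.+ toℚ (+ k) ℚ.* seq (⟦ t ⟧ ρ) i
  seq-add zero t e ρ i = zero-times (seq (⟦ e ⟧ ρ) i) (seq (⟦ t ⟧ ρ) i)
    where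
    zero-times : ∀ e t → e ≡ e ℚ.+ 0ℚ ℚ.* t
    zero-times = solve 2 (λ e t → e := e :+ con 0ℚ :* t) refl
  seq-add (suc k) t e ρ i = trans (cong (λ u → u ℚ.+ seq (⟦ t ⟧ ρ) i) (seq-add k t e ρ i))
    (trans (one-more (seq (⟦ e ⟧ ρ) i) (toℚ (+ k)) (seq (⟦ t ⟧ ρ) i))
      (cong (λ u → seq (⟦ e ⟧ ρ) i ℚ.+ u ℚ.* seq (⟦ t ⟧ ρ) i) (sym (toℚ-+ (+ 1) (+ k)))))
    where
    one-more : ∀ e k t → e ℚ.+ k ℚ.* t ℚ.+ t ≡ e ℚ.+ (1ℚ ℚ.+ k) ℚ.* t
    one-more = solve 3 (λ e k t → e :+ k :* t :+ t := e :+ (con 1ℚ :+ k) :* t) refl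

  -- The equation `y = (p / d) u` in the form `y + d y + p⁻ u = y + p⁺ u`, with natural coefficients
  -- only. The extra `y` on both sides is the base term.
  scaleᶠ : ℚ → Fin n → Fin n → Formula n
  scaleᶠ q y u = add (negative-part (ℚ.↥ q)) (var u) (add (ℚ.↧ₙ q) (var y) (var y))
              ≈ᶠ add (positive-part (ℚ.↥ q)) (var u) (var y)

  sumᶠ : Fin n → Fin n → Fin n → Formula n
  sumᶠ y u v = var y ≈ᶠ var u ⊕ var v

  -- Comparing `y + y` with `y` amounts to comparing `y` with zero, for which there is no symbol.
  zeroᶠ positiveᶠ nonNegativeᶠ : Fin n → Formula n
  zeroᶠ y        = var y ⊕ var y ≈ᶠ var y
  positiveᶠ y    = ¬ᶠ (var y ⊕ var y ≤ᶠ var y)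
  nonNegativeᶠ y = var y ≤ᶠ var y ⊕ var y

  oneᶠ : Fin n → Formula n
  oneᶠ o = isInt (var o) ∧ᶠ positiveᶠ o ∧ᶠ (∀ᶠ (isInt (var zero) ∧ᶠ positiveᶠ zero ⇒ᶠ var (suc o) ≤ᶠ var zero))

  linearᶠ : Vec ℚ k → Vec (Fin n) k → Fin n → Formula n
  linearᶠ []      []       y = zeroᶠ y
  linearᶠ (a ∷ α) (x ∷ xs) y = ∃ᶠ ∃ᶠ
    (scaleᶠ a (suc zero) (suc (suc x)) ∧ᶠ linearᶠ α (Vec.map (λ i → suc (suc i)) xs) zero ∧ᶠ sumᶠ (suc (suc y)) (suc zero) zero)

  compareᶠ : Comparison → Fin n → Fin n → Formula n
  compareᶠ lt x y = ¬ᶠ (var y ≤ᶠ var x)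
  compareᶠ le x y = var x ≤ᶠ var y
  compareᶠ eq x y = var x ≈ᶠ var y
  compareᶠ ge x y = var y ≤ᶠ var x
  compareᶠ gt x y = ¬ᶠ (var x ≤ᶠ var y)

  -- From the innermost outwards, the three bound variables are the number one, the constant `β` and
  -- the value of the linear form.
  constraintᶠ : Constraint n → Formula n
  constraintᶠ {n} (α , # , β) = ∃ᶠ ∃ᶠ ∃ᶠ
    ( oneᶠ zero ∧ᶠ scaleᶠ β (suc zero) zero
    ∧ᶠ linearᶠ α (Vec.map (λ i → suc (suc (suc i))) (Vec.allFin n)) (suc (suc zero))
    ∧ᶠ compareᶠ # (suc (suc zero)) (suc zero))

  -- The quantifier supplies a variable: `Term 0` is empty, so `Formula 0` has no atoms.
  trueᶠ falseᶠ : Formula n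
  falseᶠ = ∃ᶠ (¬ᶠ (var zero ≤ᶠ var zero))
  trueᶠ  = ¬ᶠ falseᶠ

  allᶠ : List (Formula n) → Formula n
  allᶠ []       = trueᶠ
  allᶠ (φ ∷ φs) = φ ∧ᶠ allᶠ φs

  someᶠ : (k : ℕ) → (Fin k → Formula n) → Formula n
  someᶠ zero    φ = falseᶠ
  someᶠ (suc k) φ = φ zero ∨ᶠ someᶠ k (φ ∘ suc)

  toℚⁿ : Vec ℤ n → Vec ℚ n
  toℚⁿ = Vec.map toℚ

  -- Membership of x - z in the constraint, as a constraint on x.
  shift : Vec ℤ n → Constraint n → Constraint n
  shift z (α , # , β) = α , # , β ℚ.+ ℚ·.dot α (toℚⁿ z)

  -- Membership of x - l p in the constraint, as a constraint on (l , x).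
  lift : Vec ℤ n → Constraint n → Constraint (suc n)
  lift p (α , # , β) = ℚ.- ℚ·.dot α (toℚⁿ p) ∷ α , # , β

  -- Each generator `p` gets a quantified multiplicity, which becomes a new coordinate. `lift p`
  -- makes the constraints see the vector with that multiple of `p` subtracted, and the remaining
  -- generators receive a zero in the new coordinate.
  polinearᶠ : List (Constraint n) → Vec (Vec ℤ n) k → Formula n
  polinearᶠ cs []      = allᶠ (List.map constraintᶠ cs)
  polinearᶠ cs (p ∷ P) = ∃ᶠ (isInt (var zero) ∧ᶠ nonNegativeᶠ zero ∧ᶠ polinearᶠ (List.map (lift p) cs) (Vec.map (0ℤ ∷_) P))

  module _ (em : ExcludedMiddle 0ℓ) where

    open Classical em

    ≈-≗ : ∀ {x y u v} → (∀ i → seq x i ≡ seq u i) → (∀ i → seq y i ≡ seq v i) → x ≈ y → u ≈ v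
    ≈-≗ {x} {y} {u} {v} x≗u y≗v p = ≈-trans {u} {x} {v} (≗⇒≈ {u} {x} (λ i → sym (x≗u i)))
      (≈-trans {x} {y} {v} p (≗⇒≈ {y} {v} y≗v))

    -- All five comparisons are made of weak and strict order in the two directions, so preserving
    -- `rel` both ways is enough.
    compare-map : ∀ # {x y u v} → (∀ s → rel s x y → rel s u v) → (∀ s → rel s y x → rel s v u) →
                  compare # x y → compare # u v
    compare-map lt f g p = f true p
    compare-map le f g p = f false p
    compare-map eq {x} {y} {u} {v} f g p = ≤-antisym {u} {v} (f false (≈⇒≤ {x} {y} p)) (g false (≈⇒≥ {x} {y} p))
    compare-map ge f g p = g false p
    compare-map gt f g p = g true p

    compare-≈ : ∀ # {x y u v} → x ≈ u → y ≈ v → compare # x y → compare # u v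
    compare-≈ # {x} {y} {u} {v} x≈u y≈v = compare-map # {x} {y} {u} {v}
      (λ s → rel-resp em s {x} {y} {u} {v} x≈u y≈v) (λ s → rel-resp em s {y} {x} {v} {u} y≈v x≈u)

    compare-+ : ∀ # x y z → compare # x y → compare # (x + z) (y + z)
    compare-+ # x y z = compare-map # {x} {y} {x + z} {y + z}
      (λ s → rel-+ em s {x} {y} z) (λ s → rel-+ em s {y} {x} z)

    compare-cancel : ∀ # x y z → compare # (x + z) (y + z) → compare # x y
    compare-cancel # x y z = compare-map # {x + z} {y + z} {x} {y}
      (λ s → +-cancelʳ em s x y z) (λ s → +-cancelʳ em s y x z)

    private
      unscale-left : ∀ d p⁻ y u → ((y ℚ.+ d ℚ.* y) ℚ.+ p⁻ ℚ.* u) ≡ d ℚ.* y ℚ.+ (y ℚ.+ p⁻ ℚ.* u)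
      unscale-left = solve 4 (λ d p⁻ y u → (y :+ d :* y) :+ p⁻ :* u := d :* y :+ (y :+ p⁻ :* u)) refl

      unscale-right : ∀ d p p⁻ p⁺ q y u → d ℚ.* q ≡ p → p ℚ.+ p⁻ ≡ p⁺ →
                      y ℚ.+ p⁺ ℚ.* u ≡ d ℚ.* (q ℚ.* u) ℚ.+ (y ℚ.+ p⁻ ℚ.* u)
      unscale-right d p p⁻ p⁺ q y u dq≡p pp≡ = trans
        (cong (λ v → y ℚ.+ v ℚ.* u) (sym (trans (cong (λ v → v ℚ.+ p⁻) dq≡p) pp≡)))
        (solve 5 (λ y d q u p⁻ → y :+ (d :* q :+ p⁻) :* u := d :* (q :* u) :+ (y :+ p⁻ :* u)) refl y d q u p⁻)

      ≈-·-cancel : ∀ d .{{_ : ℚ.Positive d}} x y → d · x ≈ d · y → x ≈ y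
      ≈-·-cancel d x y p = ≤-antisym {x} {y}
        (half x y (≈⇒≤ {d · x} {d · y} p)) (half y x (≈⇒≥ {d · x} {d · y} p))
        where
        instance
          nonZero : ℚ.NonZero d
          nonZero = ℚ.pos⇒nonZero d
        undo : ∀ x i → ℚ.1/ d ℚ.* (d ℚ.* seq x i) ≡ seq x i
        undo x i = trans (sym (ℚ.*-assoc (ℚ.1/ d) d (seq x i)))
          (trans (cong (λ v → v ℚ.* seq x i) (ℚ.*-inverseˡ d)) (ℚ.*-identityˡ (seq x i)))
        half : ∀ x y → d · x ≤ d · y → x ≤ y
        half x y p = rel-≗ em false {ℚ.1/ d · (d · x)} {ℚ.1/ d · (d · y)} {x} {y} (undo x) (undo y)
          (·-mono-≤ (ℚ.1/ d) {d · x} {d · y} {{ℚ.1/pos⇒pos d}} p)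

      ·-cong-pos : ∀ d .{{_ : ℚ.Positive d}} x y → x ≈ y → d · x ≈ d · y
      ·-cong-pos d x y p = ≤-antisym {d · x} {d · y}
        (·-mono-≤ d {x} {y} (≈⇒≤ {x} {y} p)) (·-mono-≤ d {y} {x} (≈⇒≥ {x} {y} p))

      ≈-cancel : ∀ x y z → x + z ≈ y + z → x ≈ y
      ≈-cancel x y z = compare-cancel eq x y z

      -- q is the difference of the positive numbers q + K and K.
      ·-cong : ∀ q x y → x ≈ y → q · x ≈ q · y
      ·-cong q x y x≈y = ≈-cancel (q · x) (q · y) (K · y)
        (≈-trans {q · x + K · y} {q · x + K · x} {q · y + K · y}
          (+-cong em {q · x} {q · x} {K · y} {K · x} (≈-refl {q · x}) (·-cong-pos K {{K-pos}} y x (≈-sym {x} {y} x≈y)))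
          (≈-≗ {(q ℚ.+ K) · x} {(q ℚ.+ K) · y} {q · x + K · x} {q · y + K · y}
            (λ i → ℚ.*-distribʳ-+ (seq x i) q K) (λ i → ℚ.*-distribʳ-+ (seq y i) q K)
            (·-cong-pos (q ℚ.+ K) {{q+K-pos}} x y x≈y)))
        where
        K : ℚ
        K = ℚ.∣ q ∣ ℚ.+ 1ℚ
        K-pos : ℚ.Positive K
        K-pos = ℚ.nonNeg+pos⇒pos ℚ.∣ q ∣ {{ℚ.nonNegative (ℚ.0≤∣p∣ q)}} 1ℚ
        0≤q+∣q∣ : 0ℚ ℚ.≤ q ℚ.+ ℚ.∣ q ∣
        0≤q+∣q∣ = subst (ℚ._≤ q ℚ.+ ℚ.∣ q ∣) (ℚ.+-inverseʳ q)
          (ℚ.+-monoʳ-≤ q (subst (ℚ.- q ℚ.≤_) (ℚ.∣-p∣≡∣p∣ q) (p≤∣p∣ (ℚ.- q))))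
        q+K-pos : ℚ.Positive (q ℚ.+ K)
        q+K-pos = subst ℚ.Positive (ℚ.+-assoc q ℚ.∣ q ∣ 1ℚ)
          (ℚ.nonNeg+pos⇒pos (q ℚ.+ ℚ.∣ q ∣) {{ℚ.nonNegative 0≤q+∣q∣}} 1ℚ)

      scale-lhs scale-rhs : ℚ → ℝ → ℝ → ℝ
      scale-lhs q y u = y + toℚ (ℚ.↧ q) · y + toℚ (+ negative-part (ℚ.↥ q)) · u
      scale-rhs q y u = y + toℚ (+ positive-part (ℚ.↥ q)) · u

      -- The equation of the formula is `d y = d (q u)` with `y + p⁻ u` added on both sides, since
      -- `d q + p⁻ = p⁺`. Cancelling that summand and then the positive denominator `d` is
      -- reversible.
      scale-real : ∀ q y u → (scale-lhs q y u ≈ scale-rhs q y u → y ≈ q · u) × (y ≈ q · u → scale-lhs q y u ≈ scale-rhs q y u)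
      scale-real q y u =
        (λ e → ≈-·-cancel d {{positiveℚ (ℚ.denominator-1 q)}} y (q · u) (≈-cancel (d · y) (d · (q · u)) (y + p⁻ · u)
          (≈-≗ {scale-lhs q y u} {scale-rhs q y u} {d · y + (y + p⁻ · u)} {d · (q · u) + (y + p⁻ · u)}
            (λ i → unscale-left d p⁻ (seq y i) (seq u i))
            (λ i → unscale-right d p p⁻ p⁺ q (seq y i) (seq u i) dq≡p pp≡) e))) ,
        (λ y≈ → ≈-≗ {d · y + (y + p⁻ · u)} {d · (q · u) + (y + p⁻ · u)} {scale-lhs q y u} {scale-rhs q y u}
            (λ i → sym (unscale-left d p⁻ (seq y i) (seq u i)))
            (λ i → sym (unscale-right d p p⁻ p⁺ q (seq y i) (seq u i) dq≡p pp≡))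
            (+-cong em {d · y} {d · (q · u)} {y + p⁻ · u} {y + p⁻ · u} (·-cong d y (q · u) y≈) (≈-refl {y + p⁻ · u})))
        where
        d p p⁻ p⁺ : ℚ
        d  = toℚ (ℚ.↧ q)
        p  = toℚ (ℚ.↥ q)
        p⁻ = toℚ (+ negative-part (ℚ.↥ q))
        p⁺ = toℚ (+ positive-part (ℚ.↥ q))
        dq≡p : d ℚ.* q ≡ p
        dq≡p = ↧*p≡↥ q
        pp≡ : p ℚ.+ p⁻ ≡ p⁺
        pp≡ = positive-negative (ℚ.↥ q)

      seq-add₁ : ∀ k (t e : Term n) ρ (E : ℝ) → (∀ i → seq (⟦ e ⟧ ρ) i ≡ seq E i) →
                 ∀ i → seq (⟦ add k t e ⟧ ρ) i ≡ seq (E + toℚ (+ k) · ⟦ t ⟧ ρ) i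
      seq-add₁ k t e ρ E e≗ i = trans (seq-add k t e ρ i) (cong (λ v → v ℚ.+ toℚ (+ k) ℚ.* seq (⟦ t ⟧ ρ) i) (e≗ i))

    ⊨scale : ∀ q (y u : Fin n) {ρ} →
             ((ρ ⊨ scaleᶠ q y u) → Vec.lookup ρ y ≈ q · Vec.lookup ρ u) ×
             (Vec.lookup ρ y ≈ q · Vec.lookup ρ u → ρ ⊨ scaleᶠ q y u)
    ⊨scale q y u {ρ} =
      (λ p → proj₁ (scale-real q Y V) (≈-≗ {⟦ L ⟧ ρ} {⟦ R ⟧ ρ} {scale-lhs q Y V} {scale-rhs q Y V} L≗ R≗ p)) ,
      (λ p → ≈-≗ {scale-lhs q Y V} {scale-rhs q Y V} {⟦ L ⟧ ρ} {⟦ R ⟧ ρ} (λ i → sym (L≗ i)) (λ i → sym (R≗ i)) (proj₂ (scale-real q Y V) p))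
      where
      Y V : ℝ
      Y = Vec.lookup ρ y
      V = Vec.lookup ρ u
      L R : Term _
      L = add (negative-part (ℚ.↥ q)) (var u) (add (ℚ.↧ₙ q) (var y) (var y))
      R = add (positive-part (ℚ.↥ q)) (var u) (var y)
      L≗ : ∀ i → seq (⟦ L ⟧ ρ) i ≡ seq (scale-lhs q Y V) i
      L≗ = seq-add₁ (negative-part (ℚ.↥ q)) (var u) (add (ℚ.↧ₙ q) (var y) (var y)) ρ (Y + toℚ (ℚ.↧ q) · Y)
        (seq-add₁ (ℚ.↧ₙ q) (var y) (var y) ρ Y (λ _ → refl))
      R≗ : ∀ i → seq (⟦ R ⟧ ρ) i ≡ seq (scale-rhs q Y V) i
      R≗ = seq-add₁ (positive-part (ℚ.↥ q)) (var u) (var y) ρ Y (λ _ → refl)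

    double-≤ : ∀ x → (x + x ≤ x → x ≤ 0ℝ) × (x ≤ 0ℝ → x + x ≤ x)
    double-≤ x =
      (λ p → +-cancelʳ em false x 0ℝ x (rel-≗ em false {x + x} {x} {x + x} {0ℝ + x} (λ _ → refl) (λ i → sym (ℚ.+-identityˡ (seq x i))) p)) ,
      (λ p → rel-≗ em false {x + x} {0ℝ + x} {x + x} {x} (λ _ → refl) (λ i → ℚ.+-identityˡ (seq x i)) (rel-+ em false {x} {0ℝ} x p))

    double-≥ : ∀ x → (x ≤ x + x → 0ℝ ≤ x) × (0ℝ ≤ x → x ≤ x + x)
    double-≥ x =
      (λ p → +-cancelʳ em false 0ℝ x x (rel-≗ em false {x} {x + x} {0ℝ + x} {x + x} (λ i → sym (ℚ.+-identityˡ (seq x i))) (λ _ → refl) p)) ,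
      (λ p → rel-≗ em false {0ℝ + x} {x + x} {x} {x + x} (λ i → ℚ.+-identityˡ (seq x i)) (λ _ → refl) (rel-+ em false {0ℝ} {x} x p))

    double-≈ : ∀ x → (x + x ≈ x → x ≈ 0ℝ) × (x ≈ 0ℝ → x + x ≈ x)
    double-≈ x =
      (λ p → ≤-antisym {x} {0ℝ} (proj₁ (double-≤ x) (≈⇒≤ {x + x} {x} p)) (proj₁ (double-≥ x) (≈⇒≥ {x + x} {x} p))) ,
      (λ p → ≤-antisym {x + x} {x} (proj₂ (double-≤ x) (≈⇒≤ {x} {0ℝ} p)) (proj₂ (double-≥ x) (≈⇒≥ {x} {0ℝ} p)))

    positive-integer : ∀ x → IsInteger x → ¬ (x + x ≤ x) → 1ℝ ≤ x
    positive-integer x (m , x≈m) ¬x+x≤x = ≤-trans {1ℝ} {fromℤ m} {x}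
      (fromℚ-mono-≤ (ℚ.≤-trans (ℚ.≤-refl {1ℚ}) (toℚ-mono-≤ {1ℤ} {m} (ℤ.i<j⇒suc[i]≤j 0<m)))) (≈⇒≥ {x} {fromℤ m} x≈m)
      where
      0<m : 0ℤ ℤ.< m
      0<m = ℤ.≰⇒> λ m≤0 → ¬x+x≤x (proj₂ (double-≤ x) (≤-trans {x} {fromℤ m} {0ℝ} (≈⇒≤ {x} {fromℤ m} x≈m)
        (fromℚ-mono-≤ {toℚ m} {0ℚ} (toℚ-mono-≤ {m} {0ℤ} m≤0))))

    one-positive : ∀ x → x ≈ 1ℝ → ¬ (x + x ≤ x)
    one-positive x x≈1 x+x≤x = <⇒≱ {0ℝ} {1ℝ} (fromℚ-mono-< (ℚ.positive⁻¹ 1ℚ))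
      (≤-trans {1ℝ} {x} {0ℝ} (≈⇒≥ {x} {1ℝ} x≈1) (proj₁ (double-≤ x) x+x≤x))

    ⊨one : ∀ (o : Fin n) {ρ} → ((ρ ⊨ oneᶠ o) → Vec.lookup ρ o ≈ 1ℝ) × (Vec.lookup ρ o ≈ 1ℝ → ρ ⊨ oneᶠ o)
    ⊨one o {ρ} =
      (λ (int , pos , least) → ≤-antisym {x} {1ℝ}
        (least 1ℝ ((1ℤ , ≗⇒≈ {1ℝ} {fromℤ 1ℤ} (λ _ → refl)) , one-positive 1ℝ (≈-refl {1ℝ})))
        (positive-integer x int pos)) ,
      (λ x≈1 → (1ℤ , ≈-trans {x} {1ℝ} {fromℤ 1ℤ} x≈1 (≗⇒≈ {1ℝ} {fromℤ 1ℤ} (λ _ → refl))) , one-positive x x≈1 ,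
        λ r (int , pos) → ≤-trans {x} {1ℝ} {r} (≈⇒≤ {x} {1ℝ} x≈1) (positive-integer r int pos))
      where
      x : ℝ
      x = Vec.lookup ρ o

    lookups : Vec ℝ n → Vec (Fin n) k → Vec ℝ k
    lookups ρ = Vec.map (Vec.lookup ρ)

    ⊨linear : ∀ (α : Vec ℚ k) (xs : Vec (Fin n) k) y {ρ} →
              ((ρ ⊨ linearᶠ α xs y) → Vec.lookup ρ y ≈ linear α (lookups ρ xs)) ×
              (Vec.lookup ρ y ≈ linear α (lookups ρ xs) → ρ ⊨ linearᶠ α xs y)
    ⊨linear [] [] y {ρ} = double-≈ (Vec.lookup ρ y)
    ⊨linear {k = suc k} {n = n} (a ∷ α) (x ∷ xs) y {ρ} =
      (λ (u , v , p , q , r) → ≈-trans {Y} {u + v} {a · X + rest} r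
        (+-cong em {u} {a · X} {v} {rest} (proj₁ (⊨scale a (suc zero) (suc (suc x)) {v ∷ u ∷ ρ}) p)
          (subst (v ≈_) (cong (linear α) (lookups-weaken v u)) (proj₁ (⊨linear α (Vec.map (λ i → suc (suc i)) xs) zero {v ∷ u ∷ ρ}) q)))) ,
      (λ e → a · X , rest , proj₂ (⊨scale a (suc zero) (suc (suc x)) {rest ∷ a · X ∷ ρ}) (≈-refl {a · X}) ,
        proj₂ (⊨linear α (Vec.map (λ i → suc (suc i)) xs) zero {rest ∷ a · X ∷ ρ})
          (subst (rest ≈_) (cong (linear α) (sym (lookups-weaken rest (a · X)))) (≈-refl {rest})) , e)
      where
      Y X rest : ℝ
      Y = Vec.lookup ρ y
      X = Vec.lookup ρ x
      rest = linear α (lookups ρ xs)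
      lookups-weaken : ∀ v u → lookups (v ∷ u ∷ ρ) (Vec.map (λ i → suc (suc i)) xs) ≡ lookups ρ xs
      lookups-weaken v u = sym (Vec.map-∘ (Vec.lookup (v ∷ u ∷ ρ)) (λ i → suc (suc i)) xs)

    ⊨compare : ∀ # (x y : Fin n) {ρ} →
               ((ρ ⊨ compareᶠ # x y) → compare # (Vec.lookup ρ x) (Vec.lookup ρ y)) ×
               (compare # (Vec.lookup ρ x) (Vec.lookup ρ y) → ρ ⊨ compareᶠ # x y)
    ⊨compare lt x y {ρ} = ≰⇒> {Vec.lookup ρ y} {Vec.lookup ρ x} , <⇒≱ {Vec.lookup ρ x} {Vec.lookup ρ y}
    ⊨compare le x y = id , id
    ⊨compare eq x y = id , id
    ⊨compare ge x y = id , id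
    ⊨compare gt x y {ρ} = ≰⇒> {Vec.lookup ρ x} {Vec.lookup ρ y} , <⇒≱ {Vec.lookup ρ y} {Vec.lookup ρ x}

    ⊨constraint : ∀ (con : Constraint n) x → ((x ⊨ constraintᶠ con) → Satisfies x con) × (Satisfies x con → x ⊨ constraintᶠ con)
    ⊨constraint {n} (α , # , β) x =
      (λ (y , w , o , p , q , r , s) → compare-≈ # {y} {w} {linear α x} {fromℚ β}
        (subst (y ≈_) (cong (linear α) (lookups-all y w o)) (proj₁ (⊨linear α vars (suc (suc zero)) {o ∷ w ∷ y ∷ x}) r))
        (≈-trans {w} {β · o} {fromℚ β} (proj₁ (⊨scale β (suc zero) zero {o ∷ w ∷ y ∷ x}) q) (β·one o (proj₁ (⊨one zero {o ∷ w ∷ y ∷ x}) p)))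
        (proj₁ (⊨compare # (suc (suc zero)) (suc zero) {o ∷ w ∷ y ∷ x}) s)) ,
      (λ s → let ρ = 1ℝ ∷ fromℚ β ∷ linear α x ∷ x in linear α x , fromℚ β , 1ℝ ,
        proj₂ (⊨one zero {ρ}) (≈-refl {1ℝ}) ,
        proj₂ (⊨scale β (suc zero) zero {ρ}) (≈-sym {β · 1ℝ} {fromℚ β} (β·one 1ℝ (≈-refl {1ℝ}))) ,
        proj₂ (⊨linear α vars (suc (suc zero)) {ρ})
          (subst (linear α x ≈_) (cong (linear α) (sym (lookups-all (linear α x) (fromℚ β) 1ℝ))) (≈-refl {linear α x})) ,
        proj₂ (⊨compare # (suc (suc zero)) (suc zero) {ρ}) s)
      where
      vars : Vec (Fin (suc (suc (suc n)))) n
      vars = Vec.map (λ i → suc (suc (suc i))) (Vec.allFin n)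
      lookups-all : ∀ y w o → lookups (o ∷ w ∷ y ∷ x) vars ≡ x
      lookups-all y w o = trans (sym (Vec.map-∘ (Vec.lookup (o ∷ w ∷ y ∷ x)) (λ i → suc (suc (suc i))) (Vec.allFin n)))
        (Vec.map-lookup-allFin x)
      β·one : ∀ o → o ≈ 1ℝ → β · o ≈ fromℚ β
      β·one o o≈1 = ≈-trans {β · o} {β · 1ℝ} {fromℚ β} (·-cong β o 1ℝ o≈1)
        (≗⇒≈ {β · 1ℝ} {fromℚ β} (λ _ → ℚ.*-identityʳ β))

    ⊨true : ∀ (x : Vec ℝ n) → x ⊨ trueᶠ
    ⊨true x (r , ¬r≤r) = ¬r≤r (≤-refl {r})

    ⊨all : ∀ {A : Set} (f : A → Formula n) {x} (as : List A) →
           ((x ⊨ allᶠ (List.map f as)) → All (λ a → x ⊨ f a) as) × (All (λ a → x ⊨ f a) as → x ⊨ allᶠ (List.map f as))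
    ⊨all f {x} [] = (λ _ → []) , (λ _ → ⊨true x)
    ⊨all f {x} (a ∷ as) = (λ (p , ps) → p ∷ proj₁ (⊨all f as) ps) , (λ { (p ∷ ps) → p , proj₂ (⊨all f as) ps })

    ⊨some : ∀ k (φ : Fin k → Formula n) {x} →
            ((x ⊨ someᶠ k φ) → ∃[ i ] (x ⊨ φ i)) × (∃[ i ] (x ⊨ φ i) → x ⊨ someᶠ k φ)
    ⊨some zero    φ {x} = (λ p → ⊥-elim (⊨true x p)) , (λ ())
    ⊨some (suc k) φ {x} =
      [ (λ p → zero , p) , (λ ps → let i , p = proj₁ (⊨some k (φ ∘ suc)) ps in suc i , p) ]′ ,
      (λ { (zero , p) → inj₁ p ; (suc i , p) → inj₂ (proj₂ (⊨some k (φ ∘ suc)) (i , p)) })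

    -- The monoid `P *` described by one multiplicity per generator instead of a list of summands,
    -- to match the quantifiers of `polinearᶠ`.
    Span : Vec (Vec ℤ n) k → Pred (Vec ℤ n) 0ℓ
    Span []      z = z ≡ 0ᶻ
    Span (p ∷ P) z = ∃[ l ] ∃[ z′ ] (Span P z′ × z ≡ z′ +ᶻ (+ l) *ᶻ p)

    Span-0∷ : ∀ (P : Vec (Vec ℤ n) k) →
              (∀ {z} → Span (Vec.map (0ℤ ∷_) P) z → ∃[ y ] (Span P y × z ≡ 0ℤ ∷ y)) ×
              (∀ {y} → Span P y → Span (Vec.map (0ℤ ∷_) P) (0ℤ ∷ y))
    Span-0∷ [] = (λ { refl → 0ᶻ , refl , refl }) , (λ { refl → refl })
    Span-0∷ (p ∷ P) =
      (λ { (l , z′ , z′∈ , refl) → let y , y∈ , z′≡ = proj₁ (Span-0∷ P) z′∈ in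
           y +ᶻ (+ l) *ᶻ p , (l , y , y∈ , refl) , trans (cong (_+ᶻ (+ l) *ᶻ (0ℤ ∷ p)) z′≡) (zero-head (+ l) y p) }) ,
      (λ { (l , y , y∈ , refl) → l , 0ℤ ∷ y , proj₂ (Span-0∷ P) y∈ , sym (zero-head (+ l) y p) })
      where
      zero-head : ∀ l (y p : Vec ℤ n) → (0ℤ ∷ y) +ᶻ l *ᶻ (0ℤ ∷ p) ≡ 0ℤ ∷ (y +ᶻ l *ᶻ p)
      zero-head l y p = cong (_∷ (y +ᶻ l *ᶻ p)) (trans (ℤ.+-identityˡ (l ℤ.* 0ℤ)) (ℤ.*-zeroʳ l))

    private
      toℚⁿ-+* : ∀ (z : Vec ℤ n) l p → toℚⁿ (z +ᶻ l *ᶻ p) ≡ Vec.zipWith ℚ._+_ (toℚⁿ z) (Vec.map (toℚ l ℚ.*_) (toℚⁿ p))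
      toℚⁿ-+* [] l [] = refl
      toℚⁿ-+* (z ∷ zs) l (p ∷ ps) = cong₂ _∷_ (trans (toℚ-+ z (l ℤ.* p)) (cong (λ u → toℚ z ℚ.+ u) (toℚ-* l p))) (toℚⁿ-+* zs l ps)

      dot-+* : ∀ (α : Vec ℚ n) z l p → ℚ·.dot α (toℚⁿ (z +ᶻ l *ᶻ p)) ≡ ℚ·.dot α (toℚⁿ z) ℚ.+ toℚ l ℚ.* ℚ·.dot α (toℚⁿ p)
      dot-+* α z l p = trans (cong (ℚ·.dot α) (toℚⁿ-+* z l p))
        (trans (ℚ·.dot-+ʳ α (toℚⁿ z) (Vec.map (toℚ l ℚ.*_) (toℚⁿ p)))
          (cong (λ u → ℚ·.dot α (toℚⁿ z) ℚ.+ u) (ℚ·.dot-*ʳ (toℚ l) α (toℚⁿ p))))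

    private
      -- Once `r` equals the integer `l`, the summand `A · r` of the linear form is the constant
      -- `A l`, which cancels against the same summand in the bound.
      compare-shear : ∀ # Y X r A γ δ l → (∀ i → seq Y i ≡ A ℚ.* seq r i ℚ.+ seq X i) → r ≈ fromℤ l →
                      γ ≡ δ ℚ.+ A ℚ.* toℚ l →
                      (compare # Y (fromℚ γ) → compare # X (fromℚ δ)) × (compare # X (fromℚ δ) → compare # Y (fromℚ γ))
      compare-shear # Y X r A γ δ l Y≗ r≈l γ≡ =
        (λ s → compare-cancel # X (fromℚ δ) (A · fromℤ l)
          (compare-≈ # {Y} {fromℚ γ} {X + A · fromℤ l} {fromℚ δ + A · fromℤ l} lhs rhs s)) ,
        (λ s → compare-≈ # {X + A · fromℤ l} {fromℚ δ + A · fromℤ l} {Y} {fromℚ γ}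
          (≈-sym {Y} {X + A · fromℤ l} lhs) (≈-sym {fromℚ γ} {fromℚ δ + A · fromℤ l} rhs)
          (compare-+ # X (fromℚ δ) (A · fromℤ l) s))
        where
        lhs : Y ≈ X + A · fromℤ l
        lhs = ≈-≗ {X + A · r} {X + A · fromℤ l} {Y} {X + A · fromℤ l}
          (λ i → trans (ℚ.+-comm (seq X i) (A ℚ.* seq r i)) (sym (Y≗ i))) (λ _ → refl)
          (+-cong em {X} {X} {A · r} {A · fromℤ l} (≈-refl {X}) (·-cong A r (fromℤ l) r≈l))
        rhs : fromℚ γ ≈ fromℚ δ + A · fromℤ l
        rhs = ≗⇒≈ {fromℚ γ} {fromℚ δ + A · fromℤ l} (λ _ → γ≡)

      lift-constant : ∀ (α : Vec ℚ n) β z l p →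
        β ℚ.+ ℚ·.dot (ℚ.- ℚ·.dot α (toℚⁿ p) ∷ α) (toℚⁿ (0ℤ ∷ z)) ≡
        β ℚ.+ ℚ·.dot α (toℚⁿ (z +ᶻ l *ᶻ p)) ℚ.+ (ℚ.- ℚ·.dot α (toℚⁿ p)) ℚ.* toℚ l
      lift-constant α β z l p = trans (cong (λ u → β ℚ.+ (e ℚ.* u ℚ.+ ℚ·.dot α (toℚⁿ z))) {toℚ 0ℤ} {0ℚ} refl)
        (trans (balance β (ℚ·.dot α (toℚⁿ z)) (ℚ·.dot α (toℚⁿ p)) (toℚ l))
          (cong (λ u → β ℚ.+ u ℚ.+ e ℚ.* toℚ l) (sym (dot-+* α z l p))))
        where
        e : ℚ
        e = ℚ.- ℚ·.dot α (toℚⁿ p)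
        balance : ∀ b d e l → b ℚ.+ ((ℚ.- e) ℚ.* 0ℚ ℚ.+ d) ≡ b ℚ.+ (d ℚ.+ l ℚ.* e) ℚ.+ (ℚ.- e) ℚ.* l
        balance = solve 4 (λ b d e l → b :+ ((:- e) :* con 0ℚ :+ d) := b :+ (d :+ l :* e) :+ (:- e) :* l) refl

    lift-shift : ∀ (p : Vec ℤ n) con l z x r → r ≈ fromℤ l →
                 (Satisfies (r ∷ x) (shift (0ℤ ∷ z) (lift p con)) → Satisfies x (shift (z +ᶻ l *ᶻ p) con)) ×
                 (Satisfies x (shift (z +ᶻ l *ᶻ p) con) → Satisfies (r ∷ x) (shift (0ℤ ∷ z) (lift p con)))
    lift-shift p (α , # , β) l z x r r≈l = compare-shear #
      (linear (ℚ.- ℚ·.dot α (toℚⁿ p) ∷ α) (r ∷ x)) (linear α x) r (ℚ.- ℚ·.dot α (toℚⁿ p))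
      (β ℚ.+ ℚ·.dot (ℚ.- ℚ·.dot α (toℚⁿ p) ∷ α) (toℚⁿ (0ℤ ∷ z))) (β ℚ.+ ℚ·.dot α (toℚⁿ (z +ᶻ l *ᶻ p))) l
      (λ _ → refl) r≈l (lift-constant α β z l p)

    natural : ∀ r → IsInteger r → 0ℝ ≤ r → ∃[ l ] (r ≈ fromℤ (+ l))
    natural r (m , r≈m) 0≤r = ℤ.∣ m ∣ , subst (λ l → r ≈ fromℤ l) (sym (ℤ.0≤i⇒+∣i∣≡i
      (fromℤ-cancel-≤ em {0ℤ} {m} (≤-trans {0ℝ} {r} {fromℤ m} 0≤r (≈⇒≤ {r} {fromℤ m} r≈m))))) r≈m

    -- Induction on the generators. The quantified real is a nonnegative integer, hence a
    -- multiplicity; the hypothesis is applied to the lifted constraints at `r ∷ x`, and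
    -- `lift-shift` turns the extra coordinate back into a shift by a multiple of `p`.
    ⊨polinear : ∀ (P : Vec (Vec ℤ n) k) (cs : List (Constraint n)) x →
                ((x ⊨ polinearᶠ cs P) → ∃[ z ] (Span P z × All (λ con → Satisfies x (shift z con)) cs)) ×
                (∃[ z ] (Span P z × All (λ con → Satisfies x (shift z con)) cs) → x ⊨ polinearᶠ cs P)
    ⊨polinear {n} [] cs x =
      (λ p → 0ᶻ , refl , All.map (λ {con} q → shift-0 con (proj₁ (⊨constraint con x) q)) (proj₁ (⊨all constraintᶠ cs) p)) ,
      (λ { (_ , refl , all) → proj₂ (⊨all constraintᶠ cs) (All.map (λ {con} s → proj₂ (⊨constraint con x) (0-shift con s)) all) })
      where
      β+0 : ∀ (α : Vec ℚ n) β → β ≡ β ℚ.+ ℚ·.dot α (toℚⁿ 0ᶻ)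
      β+0 α β = sym (trans (cong (λ u → β ℚ.+ u) (trans (cong (ℚ·.dot α) (Vec.map-replicate toℚ 0ℤ n)) (ℚ·.dot-0ʳ α))) (ℚ.+-identityʳ β))
      shift-0 : ∀ con → Satisfies x con → Satisfies x (shift 0ᶻ con)
      shift-0 (α , # , β) = subst (λ b → compare # (linear α x) (fromℚ b)) (β+0 α β)
      0-shift : ∀ con → Satisfies x (shift 0ᶻ con) → Satisfies x con
      0-shift (α , # , β) = subst (λ b → compare # (linear α x) (fromℚ b)) (sym (β+0 α β))
    ⊨polinear (p ∷ P) cs x = to , from
      where
      to : (x ⊨ polinearᶠ cs (p ∷ P)) → ∃[ z ] (Span (p ∷ P) z × All (λ con → Satisfies x (shift z con)) cs)
      to (r , int , nonneg , q) = assemble (natural r int (proj₁ (double-≥ r) nonneg))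
          (proj₁ (⊨polinear (Vec.map (0ℤ ∷_) P) (List.map (lift p) cs) (r ∷ x)) q)
        where
        assemble : ∃[ l ] (r ≈ fromℤ (+ l)) →
                   ∃[ z ] (Span (Vec.map (0ℤ ∷_) P) z × All (λ con → Satisfies (r ∷ x) (shift z con)) (List.map (lift p) cs)) →
                   ∃[ z ] (Span (p ∷ P) z × All (λ con → Satisfies x (shift z con)) cs)
        assemble (l , r≈l) (z , z∈ , all) = let y , y∈ , z≡ = proj₁ (Span-0∷ P) z∈ in
          y +ᶻ (+ l) *ᶻ p , (l , y , y∈ , refl) ,
          All.map (λ {con} s → proj₁ (lift-shift p con (+ l) y x r r≈l) (subst (λ z → Satisfies (r ∷ x) (shift z (lift p con))) z≡ s)) (All.map⁻ all)
      from : ∃[ z ] (Span (p ∷ P) z × All (λ con → Satisfies x (shift z con)) cs) → x ⊨ polinearᶠ cs (p ∷ P)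
      from (_ , (l , y , y∈ , refl) , all) = fromℤ (+ l) , (+ l , ≈-refl {fromℤ (+ l)}) ,
        proj₂ (double-≥ (fromℤ (+ l))) (fromℚ-mono-≤ {0ℚ} {toℚ (+ l)} (toℚ-mono-≤ {0ℤ} {+ l} (ℤ.+≤+ ℕ.z≤n))) ,
        proj₂ (⊨polinear (Vec.map (0ℤ ∷_) P) (List.map (lift p) cs) (fromℤ (+ l) ∷ x))
          (0ℤ ∷ y , proj₂ (Span-0∷ P) y∈ ,
           All.map⁺ (All.map (λ {con} → proj₂ (lift-shift p con (+ l) y x (fromℤ (+ l)) (≈-refl {fromℤ (+ l)}))) all))

    private
      open Data.Integer.Solver.+-*-Solver using ()
        renaming (solve to solveᶻ; _:=_ to _≔_; _:+_ to _⊞ᶻ_; _:*_ to _⊠_; con to conᶻ)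

      z+0p : ∀ (z p : Vec ℤ n) → z +ᶻ (+ 0) *ᶻ p ≡ z
      z+0p []       []       = refl
      z+0p (z ∷ zs) (p ∷ ps) = cong₂ _∷_ (ℤ.+-identityʳ z) (z+0p zs ps)

      z+sp : ∀ (z p : Vec ℤ n) l → p +ᶻ (z +ᶻ (+ l) *ᶻ p) ≡ z +ᶻ (+ suc l) *ᶻ p
      z+sp []       []       l = refl
      z+sp (z ∷ zs) (p ∷ ps) l = cong₂ _∷_
        (solveᶻ 3 (λ z p l → p ⊞ᶻ (z ⊞ᶻ l ⊠ p) ≔ z ⊞ᶻ (conᶻ 1ℤ ⊞ᶻ l) ⊠ p) refl z p (+ l)) (z+sp zs ps l)

      p+[z+lq] : ∀ (p z q : Vec ℤ n) l → p +ᶻ (z +ᶻ l *ᶻ q) ≡ (p +ᶻ z) +ᶻ l *ᶻ q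
      p+[z+lq] []       []       []       l = refl
      p+[z+lq] (p ∷ ps) (z ∷ zs) (q ∷ qs) l = cong₂ _∷_ (sym (ℤ.+-assoc p z (l ℤ.* q))) (p+[z+lq] ps zs qs l)

    Span⇒* : ∀ (P : List (Vec ℤ n)) {z} → Span (Vec.fromList P) z → (P *) z
    Span⇒* []      refl = [] , [] , refl
    Span⇒* (p ∷ P) (l , z′ , z′∈ , refl) = copies l
      where
      copies : ∀ l → ((p ∷ P) *) (z′ +ᶻ (+ l) *ᶻ p)
      copies zero    = let ps , ps∈ , z′≡ = Span⇒* P z′∈ in ps , All.map there ps∈ , trans (z+0p z′ p) z′≡
      copies (suc l) = let ps , ps∈ , z≡ = copies l in
        p ∷ ps , here refl ∷ ps∈ , trans (sym (z+sp z′ p l)) (cong (p +ᶻ_) z≡)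

    Span-0 : ∀ (P : Vec (Vec ℤ n) k) → Span P 0ᶻ
    Span-0 []      = refl
    Span-0 (p ∷ P) = 0 , 0ᶻ , Span-0 P , sym (z+0p 0ᶻ p)

    Span-+ : ∀ (P : List (Vec ℤ n)) {p z} → p List∈.∈ P → Span (Vec.fromList P) z → Span (Vec.fromList P) (p +ᶻ z)
    Span-+ (p ∷ P) (here refl) (l , z′ , z′∈ , refl) = suc l , z′ , z′∈ , z+sp z′ p l
    Span-+ (q ∷ P) {p} (there p∈) (l , z′ , z′∈ , refl) = l , p +ᶻ z′ , Span-+ P p∈ z′∈ , p+[z+lq] p z′ q (+ l)

    *⇒Span : ∀ (P : List (Vec ℤ n)) {z} → (P *) z → Span (Vec.fromList P) z
    *⇒Span P (ps , ps∈ , refl) = go ps ps∈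
      where
      go : ∀ ps → All (List∈._∈ P) ps → Span (Vec.fromList P) (List.foldr _+ᶻ_ 0ᶻ ps)
      go []       []          = Span-0 (Vec.fromList P)
      go (p ∷ ps) (p∈ ∷ ps∈) = Span-+ P p∈ (go ps ps∈)

    linear-cong : ∀ (α : Vec ℚ n) {x y} → x ≈ⁿ y → linear α x ≈ linear α y
    linear-cong [] [] = ≈-refl {0ℝ}
    linear-cong (a ∷ α) {x ∷ xs} {y ∷ ys} (e ∷ es) = +-cong em {a · x} {a · y} {linear α xs} {linear α ys}
      (·-cong a x y e) (linear-cong α es)

    linear-place : ∀ (α : Vec ℚ n) c z i → seq (linear α (place em c z)) i ≡ seq (linear α c) i ℚ.+ ℚ·.dot α (toℚⁿ z)
    linear-place [] [] [] i = refl
    linear-place (a ∷ α) (x ∷ c) (k ∷ z) i = trans (cong (λ u → a ℚ.* (seq x i ℚ.+ toℚ k) ℚ.+ u) (linear-place α c z i))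
      (regroup a (seq x i) (toℚ k) (seq (linear α c) i) (ℚ·.dot α (toℚⁿ z)))
      where
      regroup : ∀ a x k l d → a ℚ.* (x ℚ.+ k) ℚ.+ (l ℚ.+ d) ≡ (a ℚ.* x ℚ.+ l) ℚ.+ (a ℚ.* k ℚ.+ d)
      regroup = solve 5 (λ a x k l d → a :* (x :+ k) :+ (l :+ d) := (a :* x :+ l) :+ (a :* k :+ d)) refl

    private
      shift-+ : ∀ (α : Vec ℚ n) β b m → β ℚ.+ ℚ·.dot α (toℚⁿ (b +ᶻ m)) ≡ β ℚ.+ ℚ·.dot α (toℚⁿ b) ℚ.+ ℚ·.dot α (toℚⁿ m)
      shift-+ α β b m = trans (cong (λ u → β ℚ.+ u) (trans (cong (ℚ·.dot α) (toℚⁿ-+ b m)) (ℚ·.dot-+ʳ α (toℚⁿ b) (toℚⁿ m))))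
        (sym (ℚ.+-assoc β (ℚ·.dot α (toℚⁿ b)) (ℚ·.dot α (toℚⁿ m))))
        where
        toℚⁿ-+ : ∀ {n} (y z : Vec ℤ n) → toℚⁿ (y +ᶻ z) ≡ Vec.zipWith ℚ._+_ (toℚⁿ y) (toℚⁿ z)
        toℚⁿ-+ []       []       = refl
        toℚⁿ-+ (y ∷ ys) (z ∷ zs) = cong₂ _∷_ (toℚ-+ y z) (toℚⁿ-+ ys zs)

      translate-comparison : ∀ # (X L : ℝ) β d γ → X ≈ L + fromℚ d → β ℚ.+ d ≡ γ →
                             (compare # L (fromℚ β) → compare # X (fromℚ γ)) × (compare # X (fromℚ γ) → compare # L (fromℚ β))
      translate-comparison # X L β d γ X≈ β+d≡γ =
        (λ s → compare-≈ # {L + fromℚ d} {fromℚ β + fromℚ d} {X} {fromℚ γ} (≈-sym {X} {L + fromℚ d} X≈)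
          (≗⇒≈ {fromℚ β + fromℚ d} {fromℚ γ} (λ _ → β+d≡γ)) (compare-+ # L (fromℚ β) (fromℚ d) s)) ,
        (λ s → compare-cancel # L (fromℚ β) (fromℚ d) (compare-≈ # {X} {fromℚ γ} {L + fromℚ d} {fromℚ β + fromℚ d} X≈
          (≗⇒≈ {fromℚ γ} {fromℚ β + fromℚ d} (λ _ → sym β+d≡γ)) s))

    shift-place : ∀ (con : Constraint n) b m c x → x ≈ⁿ place em c (b +ᶻ m) →
                  (Satisfies c con → Satisfies x (shift m (shift b con))) × (Satisfies x (shift m (shift b con)) → Satisfies c con)
    shift-place (α , # , β) b m c x x≈ = translate-comparison # (linear α x) (linear α c) β (ℚ·.dot α (toℚⁿ (b +ᶻ m)))
      (β ℚ.+ ℚ·.dot α (toℚⁿ b) ℚ.+ ℚ·.dot α (toℚⁿ m))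
      (≈-trans {linear α x} {linear α (place em c (b +ᶻ m))} {linear α c + fromℚ (ℚ·.dot α (toℚⁿ (b +ᶻ m)))}
        (linear-cong α x≈) (≗⇒≈ {linear α (place em c (b +ᶻ m))} {linear α c + fromℚ (ℚ·.dot α (toℚⁿ (b +ᶻ m)))} (linear-place α c (b +ᶻ m))))
      (shift-+ α β b m)

    unplace : ∀ (x : Vec ℝ n) z → x ≈ⁿ place em (place em x (-1ℤ *ᶻ z)) z
    unplace []      []      = []
    unplace (r ∷ x) (k ∷ z) = place-∷ em (r + fromℤ (-1ℤ ℤ.* k)) k
      (≗⇒≈ {r} {r + fromℤ (-1ℤ ℤ.* k) + fromℤ k} (λ i → sym (restore (seq r i) k))) (unplace x z)
      where
      restore : ∀ q k → q ℚ.+ toℚ (-1ℤ ℤ.* k) ℚ.+ toℚ k ≡ q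
      restore q k = trans (ℚ.+-assoc q (toℚ (-1ℤ ℤ.* k)) (toℚ k))
        (trans (cong (λ u → q ℚ.+ u) (trans (sym (toℚ-+ (-1ℤ ℤ.* k) k)) (cong toℚ {(-1ℤ ℤ.* k) ℤ.+ k} {0ℤ} cancel))) (ℚ.+-identityʳ q))
        where
        cancel : -1ℤ ℤ.* k ℤ.+ k ≡ 0ℤ
        cancel = trans (cong (λ u → u ℤ.+ k) (ℤ.-1*i≡-i k)) (ℤ.+-inverseˡ k)

    IsPolinear⇒IsMixedLinear : ∀ {L : Pred (Vec ℝ n) 0ℓ} → IsPolinear L → IsMixedLinear L
    IsPolinear⇒IsMixedLinear {n} {L} (C , b , M , (cs , C⊆ , ⊆C) , _ , _ , (P , M⊆ , ⊆M) , L⊆ , ⊆L) =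
      polinearᶠ (List.map (shift b) cs) (Vec.fromList P) , (λ {x} x∈ → to x (L⊆ x∈)) , (λ {x} p → ⊆L (from x p))
      where
      to : ∀ x → (C ⊞ translate b M) x → x ⊨ polinearᶠ (List.map (shift b) cs) (Vec.fromList P)
      to x (c , _ , c∈ , (m , m∈ , refl) , x≈) = proj₂ (⊨polinear (Vec.fromList P) (List.map (shift b) cs) x)
        (m , *⇒Span P (M⊆ m∈) , All.map⁺ (All.map (λ {con} → proj₁ (shift-place con b m c x x≈)) (C⊆ c∈)))
      from : ∀ x → (x ⊨ polinearᶠ (List.map (shift b) cs) (Vec.fromList P)) → (C ⊞ translate b M) x
      from x p = let m , m∈ , all = proj₁ (⊨polinear (Vec.fromList P) (List.map (shift b) cs) x) p
                     -- The real part is forced to be `x` minus the integral part; the shifted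
                     -- constraints at `x` are the constraints of `C` at this point.
                     c = place em x (-1ℤ *ᶻ (b +ᶻ m)) in
        c , b +ᶻ m , ⊆C (All.map (λ {con} → proj₂ (shift-place con b m c x (unplace x (b +ᶻ m)))) (All.map⁻ all)) ,
        (m , ⊆M (Span⇒* P m∈) , refl) , unplace x (b +ᶻ m)

    IsSemiPolinear⇒IsMixedLinear : ∀ {ℓ} {S : Pred (Vec ℝ n) ℓ} → IsSemiPolinear S → IsMixedLinear S
    IsSemiPolinear⇒IsMixedLinear {n} (k , L , polinear , S⊆ , ⊆S) = someᶠ k φ ,
      (λ {x} s → let i , x∈ = S⊆ s in proj₂ (⊨some k φ) (i , proj₁ (proj₂ (mixed i)) x∈)) ,
      (λ {x} p → let i , q = proj₁ (⊨some k φ) p in ⊆S (i , proj₂ (proj₂ (mixed i)) q))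
      where
      mixed : ∀ i → IsMixedLinear (L i)
      mixed i = IsPolinear⇒IsMixedLinear (polinear i)
      φ : Fin k → Formula n
      φ i = proj₁ (mixed i)

theorem5p4 : ExcludedMiddle 0ℓ → ∀ {ℓ} (n : ℕ) → n ≥ 1 → (S : Pred (Vec ℝ n) ℓ) → IsSemiPolinear S ⇔ IsMixedLinear S
theorem5p4 em n _ S = mk⇔ (DefiningFormulas.IsSemiPolinear⇒IsMixedLinear em)
                          (PolinearDecomposition.IsMixedLinear⇒IsSemiPolinear em)
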